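{- Every finitely satisfiable $\mathrm{UNFO}{+}\mathcal{S}$ formula $\phi$ has a finite (admissible) model of size bounded triply exponentially in $|\phi|$, i.e. of size at most $2^{2^{2^{p(|\phi|)}}}$ for some fixed polynomial $p$.
   Context: Signatures are purely relational, $\sigma=\sigma_{\mathrm{base}}\cup\sigma_{\mathrm{dist}}$ with $\sigma_{\mathrm{dist}}=\{T_1,\dots,T_{2k}\}$ binary. $\mathrm{UNFO}$ formulas are given by $\phi ::= B\bar x \mid x=y \mid \phi\wedge\phi \mid \phi\vee\phi \mid \exists x\,\phi \mid \neg\phi(x)$, where $B$ is any relation symbol and in the last clause $\phi$ has at most the free variable $x$. $\mathrm{UNFO}{+}\mathcal{S}$ has the same syntax, but admissible structures must interpret each $T_u$ as a transitive relation and $T_{2u}$ as the inverse of $T_{2u-1}$ ($1\le u\le k$). -}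

module Defs where

open import Data.Nat using (ℕ; zero; suc; _+_; _*_; _^_; _≤_)
open import Data.Nat.Properties using (_≟_)
open import Data.Bool using (Bool; true; false; _∧_; _∨_; not)
open import Data.Fin using (Fin)
import Data.Fin as Fin
open import Data.Vec using (Vec; map)
open import Data.List using (List; []; _∷_; _++_; filter)
open import Data.List.Relation.Unary.All using (All)
open import Data.Product using (Σ; _×_; ∃)
open import Relation.Nullary using (¬_)
open import Relation.Nullary.Decidable using (⌊_⌋)
open import Relation.Binary.PropositionalEquality using (_≡_)

-- Signatures  σ = σ_base ∪ σ_dist
--   σ_base : nb relation symbols with arbitrary arities
--   σ_dist : 2k binary symbols T_1..T_2k, encoded as  dist u b  with
--            u : Fin k, and  b = false ↦ T_{2u+1},  b = true ↦ T_{2u+2}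
--            (0-based u), so  dist u true  is meant to be the inverse of
--            dist u false.

record Sig : Set where
  field
    nb    : ℕ
    arity : Fin nb → ℕ
    k     : ℕ

open Sig public

data Sym (σ : Sig) : Set where
  base : Fin (nb σ) → Sym σ
  dist : Fin (k σ) → Bool → Sym σ

ar : {σ : Sig} → Sym σ → ℕ
ar {σ} (base i) = arity σ i
ar (dist _ _)   = 2

Var : Set
Var = ℕ

data Formula (σ : Sig) : Set where
  atom : (B : Sym σ) → Vec Var (ar B) → Formula σ
  eq   : Var → Var → Formula σ
  and  : Formula σ → Formula σ → Formula σ
  or   : Formula σ → Formula σ → Formula σ
  ex   : Var → Formula σ → Formula σ
  -- neg x φ  stands for  ¬φ(x); legal only if fv φ ⊆ {x} (see UNFO below)
  neg  : Var → Formula σ → Formula σ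

fv : {σ : Sig} → Formula σ → List Var
fv (atom B xs) = Data.Vec.toList xs
fv (eq x y)    = x ∷ y ∷ []
fv (and φ ψ)   = fv φ ++ fv ψ
fv (or φ ψ)    = fv φ ++ fv ψ
fv (ex x φ)    = filter (λ y → Relation.Nullary.¬? (y ≟ x)) (fv φ)
fv (neg x φ)   = fv φ

data UNFO {σ : Sig} : Formula σ → Set where
  atom : ∀ B xs → UNFO (atom B xs)
  eq   : ∀ x y → UNFO (eq x y)
  and  : ∀ {φ ψ} → UNFO φ → UNFO ψ → UNFO (and φ ψ)
  or   : ∀ {φ ψ} → UNFO φ → UNFO ψ → UNFO (or φ ψ)
  ex   : ∀ x {φ} → UNFO φ → UNFO (ex x φ)
  neg  : ∀ x {φ} → UNFO φ → All (_≡ x) (fv φ) → UNFO (neg x φ)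

size : {σ : Sig} → Formula σ → ℕ
size (atom B xs) = 1 + ar B
size (eq x y)    = 3
size (and φ ψ)   = 1 + size φ + size ψ
size (or φ ψ)    = 1 + size φ + size ψ
size (ex x φ)    = 2 + size φ
size (neg x φ)   = 2 + size φ

record Structure (σ : Sig) (n : ℕ) : Set where
  field
    rel : (B : Sym σ) → Vec (Fin n) (ar B) → Bool

open Structure public

T : {σ : Sig} {n : ℕ} → Structure σ n → Fin (k σ) → Bool → Fin n → Fin n → Bool
T 𝔄 u b x y = rel 𝔄 (dist u b) (x Data.Vec.∷ y Data.Vec.∷ Data.Vec.[])

Admissible : {σ : Sig} {n : ℕ} → Structure σ n → Set
Admissible {σ} {n} 𝔄 =
  (∀ (u : Fin (k σ)) (b : Bool) (x y z : Fin n) →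
     T 𝔄 u b x y ≡ true → T 𝔄 u b y z ≡ true → T 𝔄 u b x z ≡ true)
  × (∀ (u : Fin (k σ)) (x y : Fin n) → T 𝔄 u true x y ≡ T 𝔄 u false y x)

anyFin : (n : ℕ) → (Fin n → Bool) → Bool
anyFin zero    f = false
anyFin (suc n) f = f Fin.zero ∨ anyFin n (λ i → f (Fin.suc i))

Assignment : ℕ → Set
Assignment n = Var → Fin n

update : {n : ℕ} → Assignment n → Var → Fin n → Assignment n
update ρ x a y with ⌊ y ≟ x ⌋
... | true  = a
... | false = ρ y

sat : {σ : Sig} {n : ℕ} → Structure σ n → Formula σ → Assignment n → Bool
sat 𝔄 (atom B xs) ρ = rel 𝔄 B (map ρ xs)
sat 𝔄 (eq x y)    ρ = ⌊ ρ x Fin.≟ ρ y ⌋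
sat 𝔄 (and φ ψ)   ρ = sat 𝔄 φ ρ ∧ sat 𝔄 ψ ρ
sat 𝔄 (or φ ψ)    ρ = sat 𝔄 φ ρ ∨ sat 𝔄 ψ ρ
sat {n = n} 𝔄 (ex x φ) ρ = anyFin n (λ a → sat 𝔄 φ (update ρ x a))
sat 𝔄 (neg x φ)   ρ = not (sat 𝔄 φ ρ)

-- 𝔄 is a finite admissible model of φ (of size n), under some assignment
-- of the free variables.  Since an assignment ℕ → Fin n exists only for
-- n ≥ 1, models are automatically nonempty.
FinModelOfSize : {σ : Sig} → Formula σ → ℕ → Set
FinModelOfSize {σ} φ n =
  Σ (Structure σ n) λ 𝔄 → Admissible 𝔄 × Σ (Assignment n) λ ρ → sat 𝔄 φ ρ ≡ true

FinitelySatisfiable : {σ : Sig} → Formula σ → Set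
FinitelySatisfiable φ = ∃ λ n → FinModelOfSize φ n

Poly : Set
Poly = List ℕ

evalPoly : Poly → ℕ → ℕ
evalPoly []       x = 0
evalPoly (c ∷ cs) x = c + x * evalPoly cs x

{-# OPTIONS --safe #-}
module Submission where

-- Replace the model 𝔄 by a finite automaton whose states carry elements of 𝔄. A state and its children copy the facts
-- between an element and its witnesses, and every T u is the transitive closure of the copied edges. The sentence
-- survives if each bounded query true at a state is true at its element; then an element may be exchanged for another
-- one with the same bounded queries (its type, one of doubly exponentially many).
--
-- Without transitive relations it is enough that states count depth modulo a large number and remember a truncated
-- history: a query misses some colour, and cutting there unfolds it into a tree. A chain of T u can be long, however.
-- Along a branch the relations that have held so far (in either direction) are therefore ordered by age, and elements
-- are chosen maximal for their type with respect to each initial segment of this list; then an initial segment V is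
-- left, or makes a strict step, boundedly often during the life of a younger relation. This yields a hierarchy of
-- levels, one for each length of V: inside a component of a level V is total, and the component is a cyclic
-- arrangement, with its own counter and history, of components of the next level. By induction over the levels
-- bounded queries are sound: they are cut at an unused colour, split along the resulting tree of components, and the
-- pieces, which only V still relates, are put into a single V-clique of 𝔄.

open import Data.Bool using (Bool; true; false; _∧_; _∨_; not; if_then_else_)
import Data.Bool as Bool
open import Data.Empty using (⊥; ⊥-elim)
open import Data.Fin using (Fin; zero; suc; toℕ)
import Data.Fin as Fin
import Data.Fin.Properties as Finₚ
open import Data.List as List using (List; []; _∷_; length; _++_; take; filter; concat; concatMap; mapMaybe; allFin; cartesianProduct)
open import Data.List.Membership.Propositional using (_∈_; _∉_)
open import Data.List.Membership.Propositional.Properties using (∈-allFin; ∈-lookup; ∈-map⁺; ∈-map⁻; ∈-++⁺ˡ; ∈-++⁺ʳ; ∈-++⁻; ∈-concat⁺′; ∈-filter⁺; ∈-filter⁻; ∈-cartesianProduct⁺)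
import Data.List.Properties as Listₚ
open import Data.List.Relation.Unary.All as All using (All; []; _∷_)
import Data.List.Relation.Unary.All.Properties as Allₚ
open import Data.List.Relation.Unary.AllPairs using ([]; _∷_)
open import Data.List.Relation.Unary.Any as Any using (here; there)
open import Data.List.Relation.Unary.Any.Properties using (lookup-index)
open import Data.List.Relation.Unary.Unique.Propositional using (Unique)
import Data.List.Relation.Unary.Unique.Propositional.Properties as Uniqueₚ
open import Data.Maybe as Maybe using (Maybe; just; nothing)
open import Data.Nat using (ℕ; zero; suc; _+_; _*_; _∸_; _^_; _≤_; _<_; z≤n; s≤s; _≤?_)
open import Data.Nat.Properties
open import Data.Nat.Solver using (module +-*-Solver)
open import Data.Product using (Σ; ∃; _×_; _,_; proj₁; proj₂)
import Data.Product.Properties as Prodₚ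
open import Data.Sum using (_⊎_; inj₁; inj₂; [_,_]′)
import Data.Sum.Properties as Sumₚ
open import Data.Unit using (⊤; tt)
open import Data.Vec as Vec using (Vec; []; _∷_; lookup; map; tabulate)
import Data.Vec.Properties as Vecₚ
open import Function using (_∘_; id; case_of_)
open import Relation.Binary.Definitions using (DecidableEquality)
open import Relation.Binary.PropositionalEquality using (_≡_; refl; sym; trans; cong; cong₂; subst; subst₂)
open import Relation.Nullary using (¬_; Dec; yes; no; does; ¬?)
open import Relation.Nullary.Decidable using (⌊_⌋; map′; _×-dec_; _⊎-dec_; _→-dec_; dec-true; dec-false; recompute)

-- A colour can serve as a cut only if each `T`-path between two nodes of a query can be rerouted
-- around it, so the colours on a path must be bounded in number, although a relation may hold along
-- a branch forever. A step that is not strict for the prefix `V` stays in one `V`-clique; there the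
-- symbols of `V` are made total and need no counting. A strict step up from a maximal element loses
-- a type for good, so at most `N = 2 ^ Q` of them occur while the prefix persists, and the position
-- of a living symbol in the list only decreases. This is the origin of `M`, and `M` determines the
-- number `L` of colours. The order by age matters because prefixes form a chain: an element can be
-- made maximal for all of them at once, which is not possible for arbitrary sets of relations. The
-- three exponentials: a query has polynomially many bits, a type is a set of queries (`Q = 2 ^ qc`
-- bits), and a state remembers sets of types (`N` bits each). A level multiplies the code length
-- roughly by `L`, which is doubly exponential; with linearly many levels the code length remains
-- so.

-- Finite types as retracts of bit vectors

record Code (X : Set) (e : ℕ) : Set where
  field
    enc     : X → Vec Bool e
    dec     : Vec Bool e → X
    dec-enc : ∀ x → dec (enc x) ≡ x

open Code public

∃bits? : ∀ e {P : Vec Bool e → Set} → (∀ v → Dec (P v)) → Dec (∃ P)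
∃bits? zero    P? = map′ (λ p → [] , p) (λ { ([] , p) → p }) (P? [])
∃bits? (suc e) P? = map′
  (λ { (inj₁ (v , p)) → (false ∷ v) , p ; (inj₂ (v , p)) → (true ∷ v) , p })
  (λ { (false ∷ v , p) → inj₁ (v , p) ; (true ∷ v , p) → inj₂ (v , p) })
  (∃bits? e (λ v → P? (false ∷ v)) ⊎-dec ∃bits? e (λ v → P? (true ∷ v)))

module _ {X : Set} {e : ℕ} (c : Code X e) where

  ∃code? : {P : X → Set} → (∀ x → Dec (P x)) → Dec (∃ P)
  ∃code? {P} P? = map′ (λ { (v , p) → dec c v , p })
    (λ { (x , p) → enc c x , subst P (sym (dec-enc c x)) p })
    (∃bits? e (λ v → P? (dec c v)))

  enc-injective : ∀ {x y} → enc c x ≡ enc c y → x ≡ y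
  enc-injective {x} {y} eq = trans (sym (dec-enc c x)) (trans (cong (dec c) eq) (dec-enc c y))

_≟ᵛ_ : ∀ {e} → DecidableEquality (Vec Bool e)
_≟ᵛ_ = Vecₚ.≡-dec Bool._≟_

code-≟ : ∀ {X e} → Code X e → DecidableEquality X
code-≟ c x y = map′ (enc-injective c) (cong (enc c)) (enc c x ≟ᵛ enc c y)

code-retract : ∀ {X Y e} → Code Y e → (f : X → Y) (g : Y → X) → (∀ x → g (f x) ≡ x) → Code X e
code-retract c f g gf = record
  { enc = enc c ∘ f ; dec = g ∘ dec c ; dec-enc = λ x → trans (cong g (dec-enc c (f x))) (gf x) }

code-Bits : ∀ {e} → Code (Vec Bool e) e
code-Bits = record { enc = id ; dec = id ; dec-enc = λ _ → refl }

code-Bool : Code Bool 1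
code-Bool = record { enc = λ b → b ∷ [] ; dec = λ { (b ∷ []) → b } ; dec-enc = λ _ → refl }

take-++ : ∀ {X : Set} {m n} (v : Vec X m) (w : Vec X n) → Vec.take m (v Vec.++ w) ≡ v
take-++ {m = m} v w = Vecₚ.++-injectiveˡ _ v (Vecₚ.take++drop≡id m (v Vec.++ w))

drop-++ : ∀ {X : Set} {m n} (v : Vec X m) (w : Vec X n) → Vec.drop m (v Vec.++ w) ≡ w
drop-++ {m = m} v w = Vecₚ.++-injectiveʳ _ v (Vecₚ.take++drop≡id m (v Vec.++ w))

code-× : ∀ {X Y e f} → Code X e → Code Y f → Code (X × Y) (e + f)
code-× {e = e} c d = record
  { enc = λ { (x , y) → enc c x Vec.++ enc d y }
  ; dec = λ v → dec c (Vec.take e v) , dec d (Vec.drop e v)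
  ; dec-enc = λ { (x , y) → cong₂ _,_
      (trans (cong (dec c) (take-++ (enc c x) (enc d y))) (dec-enc c x))
      (trans (cong (dec d) (drop-++ (enc c x) (enc d y))) (dec-enc d y)) }
  }

code-Vec : ∀ {X e} → Code X e → ∀ m → Code (Vec X m) (m * e)
code-Vec c zero    = record { enc = λ _ → [] ; dec = λ _ → [] ; dec-enc = λ { [] → refl } }
code-Vec c (suc m) = code-retract (code-× c (code-Vec c m))
  (λ { (x ∷ v) → x , v }) (λ { (x , v) → x ∷ v }) (λ { (x ∷ v) → refl })

-- A unary code. The waste is harmless: the numbers coded are at most doubly exponential, and so may
-- be the length of a code.
code-Fin : ∀ n → Code (Fin (suc n)) n
code-Fin zero = record { enc = λ _ → [] ; dec = λ _ → zero ; dec-enc = λ { zero → refl } }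
code-Fin (suc n) = record
  { enc = λ { zero → false ∷ Vec.replicate n false ; (suc i) → true ∷ enc (code-Fin n) i }
  ; dec = λ { (false ∷ _) → zero ; (true ∷ v) → suc (dec (code-Fin n) v) }
  ; dec-enc = λ { zero → refl ; (suc i) → cong suc (dec-enc (code-Fin n) i) } }

code-MaybeFin : ∀ n → Code (Maybe (Fin n)) n
code-MaybeFin n = code-retract (code-Fin n)
  (λ { nothing → zero ; (just i) → suc i })
  (λ { zero → nothing ; (suc i) → just i })
  (λ { nothing → refl ; (just i) → refl })

bits→fin : ∀ e → Vec Bool e → Fin (2 ^ e)
bits→fin zero    []          = zero
bits→fin (suc e) (false ∷ v) = bits→fin e v Fin.↑ˡ (2 ^ e + 0)
bits→fin (suc e) (true ∷ v)  = 2 ^ e Fin.↑ʳ (bits→fin e v Fin.↑ˡ 0)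

fin→bits : ∀ e → Fin (2 ^ e) → Vec Bool e
fin→bits zero    _ = []
fin→bits (suc e) i with Fin.splitAt (2 ^ e) i
... | inj₁ j = false ∷ fin→bits e j
... | inj₂ j with Fin.splitAt (2 ^ e) j
...   | inj₁ j′ = true ∷ fin→bits e j′

fin→bits→fin : ∀ e v → fin→bits e (bits→fin e v) ≡ v
fin→bits→fin zero    [] = refl
fin→bits→fin (suc e) (false ∷ v) rewrite Finₚ.splitAt-↑ˡ (2 ^ e) (bits→fin e v) (2 ^ e + 0) =
  cong (false ∷_) (fin→bits→fin e v)
fin→bits→fin (suc e) (true ∷ v)
  rewrite Finₚ.splitAt-↑ʳ (2 ^ e) (2 ^ e + 0) (bits→fin e v Fin.↑ˡ 0)
        | Finₚ.splitAt-↑ˡ (2 ^ e) (bits→fin e v) 0 =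
  cong (true ∷_) (fin→bits→fin e v)

table : ∀ e → (Vec Bool e → Bool) → Vec Bool (2 ^ e)
table zero    f = f [] ∷ []
table (suc e) f = table e (f ∘ (false ∷_)) Vec.++ (table e (f ∘ (true ∷_)) Vec.++ [])

table-injective : ∀ e {f g} → table e f ≡ table e g → ∀ v → f v ≡ g v
table-injective zero    eq [] = Vecₚ.∷-injectiveˡ eq
table-injective (suc e) eq (false ∷ v) = table-injective e (Vecₚ.++-injectiveˡ _ _ eq) v
table-injective (suc e) {f} {g} eq (true ∷ v) = table-injective e
  (Vecₚ.++-injectiveˡ _ _ (Vecₚ.++-injectiveʳ (table e (f ∘ (false ∷_))) (table e (g ∘ (false ∷_))) eq)) v

bit : Bool → ℕ
bit b = if b then 1 else 0

ones : ∀ e → (Vec Bool e → Bool) → ℕ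
ones zero    f = bit (f [])
ones (suc e) f = ones e (f ∘ (false ∷_)) + ones e (f ∘ (true ∷_))

ones-≤ : ∀ e f → ones e f ≤ 2 ^ e
ones-≤ zero    f with f []
... | true  = s≤s z≤n
... | false = z≤n
ones-≤ (suc e) f = +-mono-≤ (ones-≤ e _) (≤-trans (ones-≤ e _) (m≤m+n _ 0))

ones-mono : ∀ e {f g} → (∀ v → f v ≡ true → g v ≡ true) → ones e f ≤ ones e g
ones-mono zero {f} {g} imp with f [] in p | g [] in q
... | false | _     = z≤n
... | true  | true  = s≤s z≤n
... | true  | false with () ← trans (sym q) (imp [] p)
ones-mono (suc e) imp = +-mono-≤ (ones-mono e (imp ∘ (false ∷_))) (ones-mono e (imp ∘ (true ∷_)))

ones-strict : ∀ e {f g} → (∀ v → f v ≡ true → g v ≡ true) → ∀ v → f v ≡ false → g v ≡ true →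
  ones e f < ones e g
ones-strict zero {f} {g} imp [] p q rewrite p | q = s≤s z≤n
ones-strict (suc e) imp (false ∷ v) p q =
  +-mono-<-≤ (ones-strict e (imp ∘ (false ∷_)) v p q) (ones-mono e (imp ∘ (true ∷_)))
ones-strict (suc e) imp (true ∷ v) p q =
  +-mono-≤-< (ones-mono e (imp ∘ (false ∷_))) (ones-strict e (imp ∘ (true ∷_)) v p q)

ones-cong : ∀ e {f g} → (∀ v → f v ≡ g v) → ones e f ≡ ones e g
ones-cong zero    eq = cong bit (eq [])
ones-cong (suc e) eq = cong₂ _+_ (ones-cong e (eq ∘ (false ∷_))) (ones-cong e (eq ∘ (true ∷_)))

does-cong : ∀ {P Q : Set} (p : Dec P) (q : Dec Q) → (P → Q) → (Q → P) → does p ≡ does q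
does-cong (yes p) (yes q) f g = refl
does-cong (yes p) (no ¬q) f g = ⊥-elim (¬q (f p))
does-cong (no ¬p) (yes q) f g = ⊥-elim (¬p (g q))
does-cong (no ¬p) (no ¬q) f g = refl

does-true : ∀ {P : Set} (p : Dec P) → does p ≡ true → P
does-true (yes p) _ = p

-- Transitive closure and its decidability

data Path {X : Set} (E : X → X → Set) : X → X → Set where
  one : ∀ {x y} → E x y → Path E x y
  _◅_ : ∀ {x y z} → E x y → Path E y z → Path E x z

infixr 5 _◅_

path-trans : ∀ {X} {E : X → X → Set} {x y z} → Path E x y → Path E y z → Path E x z
path-trans (one e) q = e ◅ q
path-trans (e ◅ p) q = e ◅ path-trans p q

path-fold : ∀ {X Y : Set} {E : X → X → Set} (f : X → Y) {T : Y → Y → Set} →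
  (∀ {x y z} → T x y → T y z → T x z) → (∀ {x y} → E x y → T (f x) (f y)) →
  ∀ {x y} → Path E x y → T (f x) (f y)
path-fold f tr h (one e) = h e
path-fold f {T} tr h (e ◅ p) = tr (h e) (path-fold f {T} tr h p)

-- Warshall's algorithm: the list holds the admitted intermediate points.
module Warshall {X : Set} {E : X → X → Set} (E? : ∀ x y → Dec (E x y)) where

  W : List X → X → X → Set
  W []       x y = E x y
  W (z ∷ zs) x y = W zs x y ⊎ (W zs x z × W zs z y)

  W? : ∀ zs x y → Dec (W zs x y)
  W? []       x y = E? x y
  W? (z ∷ zs) x y = W? zs x y ⊎-dec (W? zs x z ×-dec W? zs z y)

  W-edge : ∀ zs {x y} → E x y → W zs x y
  W-edge []       e = e
  W-edge (z ∷ zs) e = inj₁ (W-edge zs e)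

  W-path : ∀ zs {x y} → W zs x y → Path E x y
  W-path []       e              = one e
  W-path (z ∷ zs) (inj₁ w)       = W-path zs w
  W-path (z ∷ zs) (inj₂ (v , w)) = path-trans (W-path zs v) (W-path zs w)

  W-through : ∀ zs {x y z} → z ∈ zs → W zs x z → W zs z y → W zs x y
  W-through (z ∷ zs) (here refl) p q = inj₂ ([ id , proj₁ ]′ p , [ id , proj₂ ]′ q)
  W-through (z ∷ zs) (there i) (inj₁ p) (inj₁ q) = inj₁ (W-through zs i p q)
  W-through (z ∷ zs) (there i) (inj₁ p) (inj₂ (q , r)) = inj₂ (W-through zs i p q , r)
  W-through (z ∷ zs) (there i) (inj₂ (p , q)) (inj₁ r) = inj₂ (p , W-through zs i q r)
  -- Both halves visit the head of the list; the loop between the two visits is discarded.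
  W-through (z ∷ zs) (there i) (inj₂ (p , _)) (inj₂ (_ , r)) = inj₂ (p , r)

  path? : ∀ zs → (∀ z → z ∈ zs) → ∀ x y → Dec (Path E x y)
  path? zs all x y = map′ (W-path zs) from (W? zs x y)
    where
    from : ∀ {x y} → Path E x y → W zs x y
    from (one e)        = W-edge zs e
    from (_◅_ {y = y} e p) = W-through zs (all y) (W-edge zs e) (from p)

allBits : ∀ e → List (Vec Bool e)
allBits e = List.map (fin→bits e) (allFin (2 ^ e))

∈-allBits : ∀ {e} v → v ∈ allBits e
∈-allBits {e} v = subst (_∈ allBits e) (fin→bits→fin e v) (∈-map⁺ (fin→bits e) (∈-allFin (bits→fin e v)))

allCode : ∀ {X e} → Code X e → List X
allCode {e = e} c = List.map (dec c) (allBits e)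

∈-allCode : ∀ {X e} (c : Code X e) x → x ∈ allCode c
∈-allCode {e = e} c x = subst (_∈ allCode c) (dec-enc c x) (∈-map⁺ (dec c) (∈-allBits (enc c x)))

missing : ∀ L (cs : List (Fin L)) → length cs < L → ∃ λ κ → κ ∉ cs
missing L cs lt with Finₚ.any? (λ κ → ¬? (Any.any? (κ Fin.≟_) cs))
... | yes p = p
... | no ¬p = ⊥-elim (<⇒≱ lt (Finₚ.injective⇒≤ {f = λ κ → Any.index (mem κ)} inj))
  where
  mem : ∀ κ → κ ∈ cs
  mem κ with Any.any? (κ Fin.≟_) cs
  ... | yes q = q
  ... | no ¬q = ⊥-elim (¬p (κ , ¬q))
  inj : ∀ {x y} → Any.index (mem x) ≡ Any.index (mem y) → x ≡ y
  inj {x} {y} eq = trans (lookup-index (mem x)) (trans (cong (List.lookup cs) eq) (sym (lookup-index (mem y))))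

∈-mapMaybe : ∀ {X Y : Set} (f : X → Maybe Y) {x y xs} → x ∈ xs → f x ≡ just y → y ∈ mapMaybe f xs
∈-mapMaybe f {xs = x ∷ xs} (here refl) eq with f x
∈-mapMaybe f {xs = x ∷ xs} (here refl) refl | just _ = here refl
∈-mapMaybe f {xs = x ∷ xs} (there i) eq with f x
... | just _  = there (∈-mapMaybe f i eq)
... | nothing = ∈-mapMaybe f i eq

-- Structures, bounded queries and amalgams

-- The view of the given model on which the construction works. Labels will hold the truth values of
-- the negated subformulas, so that only positive queries have to be reflected; `Use` singles out
-- the symbols of the formula, since the bound may not depend on the rest of the signature.
record Model : Set₁ where
  field
    n     : ℕ
    a₀    : Fin n
    Lab   : Set
    lab   : Fin n → Lab
    nb    : ℕ
    ar    : Fin nb → ℕ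
    RA    : (i : Fin nb) → Vec (Fin n) (ar i) → Bool
    Use   : Fin nb → Set
    k     : ℕ
    TA    : Fin k → Fin n → Fin n → Bool
    TA-trans : ∀ u {x y z} → TA u x y ≡ true → TA u y z ≡ true → TA u x z ≡ true
    -- nv and nf bound the numbers of nodes and of base facts of a query.
    nv nf : ℕ

module Structures (𝔐 : Model) where
  open Model 𝔐

  A : Set
  A = Fin n

  record Str (C : Set) : Set₁ where
    field
      labS    : C → Lab
      R       : (i : Fin nb) → Vec C (ar i) → Set
      T       : Fin k → C → C → Set
      T-trans : ∀ {u x y z} → T u x y → T u y z → T u x z

  open Str public

  record Fact {C : Set} (S : Str C) : Set where
    constructor fact
    field
      rsym  : Fin nb
      use   : Use rsym
      args  : Vec C (ar rsym)
      holds : R S rsym args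

  open Fact public

  record Pres {C : Set} (S : Str C) (zs : List C) (Γ : List (Fact S)) (h : C → A) : Set where
    constructor pres
    field
      T-pres   : ∀ u {x y} → x ∈ zs → y ∈ zs → T S u x y → TA u (h x) (h y) ≡ true
      lab-pres : ∀ {x} → x ∈ zs → lab (h x) ≡ labS S x
      R-pres   : ∀ {f} → f ∈ Γ → RA (rsym f) (map h (args f)) ≡ true

  open Pres public

  -- A query has at most nv nodes and nf base facts, but all T-facts between its nodes: since these are not counted,
  -- a query splits along an amalgam without growing.
  Ok : {C : Set} → Str C → C → A → Set
  Ok S p a = ∀ zs → length zs ≤ nv → (Γ : List (Fact S)) → length Γ ≤ nf →
    Σ (_ → A) λ h → h p ≡ a × Pres S (p ∷ zs) Γ h

  -- The reflexive closure: a node may coincide with the point of attachment, and the relations need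
  -- not be reflexive.
  Lk : {C : Set} → Str C → Fin k → C → C → Set
  Lk S u x y = x ≡ y ⊎ T S u x y

  Lk-trans : ∀ {C} (S : Str C) {u x y z} → Lk S u x y → Lk S u y z → Lk S u x z
  Lk-trans S (inj₁ refl) q           = q
  Lk-trans S (inj₂ p)    (inj₁ refl) = inj₂ p
  Lk-trans S (inj₂ p)    (inj₂ q)    = inj₂ (T-trans S p q)

  Lk-T : ∀ {C} (S : Str C) {u x y z} → Lk S u x y → T S u y z → T S u x z
  Lk-T S (inj₁ refl) q = q
  Lk-T S (inj₂ p)    q = T-trans S p q

  T-Lk : ∀ {C} (S : Str C) {u x y z} → T S u x y → Lk S u y z → T S u x z
  T-Lk S p (inj₁ refl) = p
  T-Lk S p (inj₂ q)    = T-trans S p q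

  modelStr : Str A
  modelStr = record { labS = lab ; R = λ i v → RA i v ≡ true ; T = λ u x y → TA u x y ≡ true
                    ; T-trans = λ {u} → TA-trans u }

  Ok-hom : ∀ {C C′} {S : Str C} {S′ : Str C′} (F : C → C′) →
    (∀ {x} → labS S′ (F x) ≡ labS S x) →
    (∀ {i v} → R S i v → R S′ i (map F v)) →
    (∀ {u x y} → T S u x y → T S′ u (F x) (F y)) →
    ∀ {p a} → Ok S′ (F p) a → Ok S p a
  Ok-hom {S = S} {S′} F fl fR fT {p} ok zs zs≤ Γ Γ≤ =
    let h , hp , pr = ok (List.map F zs) (≤-trans (≤-reflexive (Listₚ.length-map F zs)) zs≤)
                         (List.map Ff Γ) (≤-trans (≤-reflexive (Listₚ.length-map Ff Γ)) Γ≤)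
    in h ∘ F , hp , pres
        (λ u x∈ y∈ t → T-pres pr u (∈-map⁺ F x∈) (∈-map⁺ F y∈) (fT t))
        (λ x∈ → trans (lab-pres pr (∈-map⁺ F x∈)) fl)
        (λ {f} f∈ → trans (cong (RA (rsym f)) (Vecₚ.map-∘ h F (args f))) (R-pres pr (∈-map⁺ Ff f∈)))
    where
    Ff : Fact S → Fact S′
    Ff (fact i us v r) = fact i us (map F v) (fR r)

  module Amalgam {Y C : Set} (K : Str Y) (D : Y → Str C) (pt : Y → C) where

    -- A connection through `K` runs inside one part to its point, along one relation of `K`, and
    -- inside another part away from its point. As `K` is transitive, this form is already closed
    -- under composition.
    data AT (u : Fin k) : Y × C → Y × C → Set where
      inn : ∀ {y c c′} → T (D y) u c c′ → AT u (y , c) (y , c′)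
      acr : ∀ {y c y′ c′} → Lk (D y) u c (pt y) → T K u y y′ → Lk (D y′) u (pt y′) c′ →
        AT u (y , c) (y′ , c′)

    data AR (i : Fin nb) : Vec (Y × C) (ar i) → Set where
      inn : ∀ y v → R (D y) i v → AR i (map (y ,_) v)
      cor : ∀ v → R K i v → AR i (map (λ y → y , pt y) v)

    AT-trans : ∀ {u x y z} → AT u x y → AT u y z → AT u x z
    AT-trans (inn {y} p) (inn q)     = inn (T-trans (D y) p q)
    AT-trans (inn {y} p) (acr q t r) = acr (Lk-trans (D y) (inj₂ p) q) t r
    AT-trans (acr {y′ = y′} p t q) (inn r)     = acr p t (Lk-trans (D y′) q (inj₂ r))
    AT-trans (acr p t q) (acr _ t′ r) = acr p (T-trans K t t′) r

    amalgam : Str (Y × C)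
    amalgam = record { labS = λ { (y , c) → labS (D y) c } ; R = AR ; T = AT ; T-trans = AT-trans }

  open Amalgam public using (inn; acr; cor; amalgam)

  -- A copy of the whole model at each node is the most general attachment: by `collapse`, any part
  -- that is sound at `tl y` may be traded for it.
  withModel : {Y : Set} → Str Y → (Y → A) → Str (Y × A)
  withModel K tl = amalgam K (λ _ → modelStr) tl

  module _ {Y C : Set} (_≟_ : DecidableEquality Y) (K : Str Y) (D : Y → Str C) (pt : Y → C) (tl : Y → A) where

    private
      𝔄𝔪 = amalgam K D pt

      only : Y → Y × C → Maybe C
      only y (y′ , c) with y′ ≟ y
      ... | yes _ = just c
      ... | no  _ = nothing

      only-self : ∀ y c → only y (y , c) ≡ just c
      only-self y c with y ≟ y
      ... | yes _ = refl
      ... | no ¬p = ⊥-elim (¬p refl)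

      onlyF : (y : Y) → Fact 𝔄𝔪 → Maybe (Fact (D y))
      onlyF y (fact i us _ (inn y′ v r)) with y′ ≟ y
      ... | yes refl = just (fact i us v r)
      ... | no  _    = nothing
      onlyF y (fact i us _ (cor v r)) = nothing

      onlyF-self : ∀ y i us v r → onlyF y (fact i us (map (y ,_) v) (inn y v r)) ≡ just (fact i us v r)
      onlyF-self y i us v r with y ≟ y
      ... | yes refl = refl
      ... | no ¬p = ⊥-elim (¬p refl)

    -- The queries of the attached parts are answered in the model, so copies of the model may replace the parts.
    collapse : (∀ y → Ok (D y) (pt y) (tl y)) → ∀ y₀ {a} →
      Ok (withModel K tl) (y₀ , tl y₀) a → Ok 𝔄𝔪 (y₀ , pt y₀) a
    collapse oks y₀ {a} ok zs zs≤ Γ Γ≤ =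
      proj₁ res ∘ F , trans (cong (proj₁ res) Fp) (proj₁ (proj₂ res)) , pres tp lp rp
      where
      -- Each part is asked only about the nodes and base facts of the query that lie in it, so the
      -- bounds `nv` and `nf` suffice for all parts.
      part : ∀ y → Σ (C → A) λ h → h (pt y) ≡ tl y ×
               Pres (D y) (pt y ∷ mapMaybe (only y) zs) (mapMaybe (onlyF y) Γ) h
      part y = oks y _ (≤-trans (Listₚ.length-mapMaybe (only y) zs) zs≤)
                     _ (≤-trans (Listₚ.length-mapMaybe (onlyF y) Γ) Γ≤)
      h : Y → C → A
      h y = proj₁ (part y)
      hp : ∀ y → Pres (D y) _ _ (h y)
      hp y = proj₂ (proj₂ (part y))
      F : Y × C → Y × A
      F (y , c) = y , h y c
      Fpt : ∀ y → F (y , pt y) ≡ (y , tl y)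
      Fpt y = cong (y ,_) (proj₁ (proj₂ (part y)))
      Fp : F (y₀ , pt y₀) ≡ (y₀ , tl y₀)
      Fp = Fpt y₀
      holds′ : ∀ {f} → f ∈ Γ → R (withModel K tl) (rsym f) (map F (args f))
      holds′ {fact i us _ (inn y v r)} f∈ = subst (R (withModel K tl) i)
        (trans (sym (Vecₚ.map-∘ (y ,_) (h y) v)) (Vecₚ.map-∘ F (y ,_) v))
        (inn y (map (h y) v) (R-pres (hp y) (∈-mapMaybe (onlyF y) f∈ (onlyF-self y i us v r))))
      holds′ {fact i us _ (cor v r)} f∈ = subst (R (withModel K tl) i)
        (trans (Vecₚ.map-cong (λ y → sym (Fpt y)) v) (Vecₚ.map-∘ F (λ y → y , pt y) v))
        (cor v r)
      good : All (λ f → R (withModel K tl) (rsym f) (map F (args f))) Γ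
      good = All.tabulate holds′
      trs : ∀ {Γ} → All (λ f → R (withModel K tl) (rsym f) (map F (args f))) Γ → List (Fact (withModel K tl))
      trs = All.reduce (λ {f} r → fact (rsym f) (use f) (map F (args f)) r)
      trs-length : ∀ {Γ} (g : All _ Γ) → length (trs g) ≡ length Γ
      trs-length []      = refl
      trs-length (_ ∷ g) = cong suc (trs-length g)
      trs-∈ : ∀ {Γ f} (g : All _ Γ) → f ∈ Γ → Σ (R (withModel K tl) (rsym f) (map F (args f))) λ r →
                fact (rsym f) (use f) (map F (args f)) r ∈ trs g
      trs-∈ (r ∷ _) (here refl) = r , here refl
      trs-∈ (_ ∷ g) (there i) = let r , j = trs-∈ g i in r , there j
      res = ok (List.map F zs) (≤-trans (≤-reflexive (Listₚ.length-map F zs)) zs≤)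
               (trs good) (≤-trans (≤-reflexive (trs-length good)) Γ≤)
      pr = proj₂ (proj₂ res)
      mem : ∀ {y c} → (y , c) ∈ ((y₀ , pt y₀) ∷ zs) → c ∈ (pt y ∷ mapMaybe (only y) zs)
      mem (here refl) = here refl
      mem {y} {c} (there i) = there (∈-mapMaybe (only y) i (only-self y c))
      memF : ∀ {z} → z ∈ ((y₀ , pt y₀) ∷ zs) → F z ∈ ((y₀ , tl y₀) ∷ List.map F zs)
      memF (here refl) = here Fp
      memF (there i)   = there (∈-map⁺ F i)
      lkp : ∀ {u y c c′} → c ∈ (pt y ∷ mapMaybe (only y) zs) → c′ ∈ (pt y ∷ mapMaybe (only y) zs) →
            Lk (D y) u c c′ → Lk modelStr u (h y c) (h y c′)
      lkp i j (inj₁ refl) = inj₁ refl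
      lkp {u} {y} i j (inj₂ t) = inj₂ (T-pres (hp y) u i j t)
      tF : ∀ u {x y} → x ∈ ((y₀ , pt y₀) ∷ zs) → y ∈ ((y₀ , pt y₀) ∷ zs) → T 𝔄𝔪 u x y →
           T (withModel K tl) u (F x) (F y)
      tF u x∈ y∈ (inn {y} t) = inn (T-pres (hp y) u (mem x∈) (mem y∈) t)
      tF u x∈ y∈ (acr {y} {c} {y′} {c′} p t q) = acr
        (subst (Lk modelStr u (h y c)) (proj₁ (proj₂ (part y))) (lkp (mem x∈) (here refl) p)) t
        (subst (λ z → Lk modelStr u z (h y′ c′)) (proj₁ (proj₂ (part y′))) (lkp (here refl) (mem y∈) q))
      tp : ∀ u {x y} → x ∈ ((y₀ , pt y₀) ∷ zs) → y ∈ ((y₀ , pt y₀) ∷ zs) → T 𝔄𝔪 u x y → _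
      tp u x∈ y∈ t = T-pres pr u (memF x∈) (memF y∈) (tF u x∈ y∈ t)
      lp : ∀ {x} → x ∈ ((y₀ , pt y₀) ∷ zs) → _
      lp {y , c} x∈ = trans (lab-pres pr (memF x∈)) (lab-pres (hp y) (mem x∈))
      rp : ∀ {f} → f ∈ Γ → _
      rp {f} f∈ = trans (cong (RA (rsym f)) (Vecₚ.map-∘ (proj₁ res) F (args f)))
                        (R-pres pr (proj₂ (trs-∈ good f∈)))

  Ok-exact : {Y : Set} (K : Str Y) (tl : Y → A) →
    (∀ {i v} → R K i v → RA i (map tl v) ≡ true) →
    (∀ {u x y} → T K u x y → TA u (tl x) (tl y) ≡ true) →
    ∀ y → Ok (withModel K tl) (y , tl y) (tl y)
  Ok-exact K tl fR fT y zs _ Γ _ = proj₂ , refl , pres (λ u _ _ → tp u) (λ _ → refl) (λ {f} _ → rp f)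
    where
    tp : ∀ u {x y} → T (withModel K tl) u x y → TA u (proj₂ x) (proj₂ y) ≡ true
    tp u (inn t) = t
    tp u (acr p t q) = T-Lk modelStr (Lk-T modelStr p (fT t)) q
    rp : ∀ f → RA (rsym f) (map proj₂ (args f)) ≡ true
    rp (fact i us _ (inn y v r)) = trans (cong (RA i)
      (trans (sym (Vecₚ.map-∘ proj₂ (y ,_) v)) (Vecₚ.map-id v))) r
    rp (fact i us _ (cor v r)) = trans (cong (RA i) (sym (Vecₚ.map-∘ proj₂ (λ y → y , tl y) v))) (fR r)

-- The type of an element

fit : ∀ {X : Set} → X → ∀ {a} b → Vec X a → Vec X b
fit d zero    _       = []
fit d (suc b) []      = d ∷ fit d b []
fit d (suc b) (x ∷ v) = x ∷ fit d b v

fit-fit : ∀ {X : Set} (d : X) {b c} → b ≤ c → (v : Vec X b) → fit d b (fit d c v) ≡ v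
fit-fit d z≤n     []      = refl
fit-fit d (s≤s l) (x ∷ v) = cong (x ∷_) (fit-fit d l v)

fit-∈ : ∀ {X : Set} (d : X) {x} {l : List X} {b} → x ∈ l → length l ≤ b →
  ∃ λ j → lookup (fit d b (Vec.fromList l)) j ≡ x
fit-∈ d (here refl) (s≤s l) = zero , refl
fit-∈ d (there i)   (s≤s l) = let j , eq = fit-∈ d i l in suc j , eq

fit-lookup : ∀ {X : Set} (d : X) (l : List X) {b} j →
  lookup (fit d b (Vec.fromList l)) j ≡ d ⊎ lookup (fit d b (Vec.fromList l)) j ∈ l
fit-lookup d []      zero    = inj₁ refl
fit-lookup d []      (suc j) = fit-lookup d [] j
fit-lookup d (x ∷ l) zero    = inj₂ (here refl)
fit-lookup d (x ∷ l) (suc j) with fit-lookup d l j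
... | inj₁ p = inj₁ p
... | inj₂ p = inj₂ (there p)

map-cong-lookup : ∀ {X Y : Set} {f g : X → Y} {m} (v : Vec X m) →
  (∀ i → f (lookup v i) ≡ g (lookup v i)) → map f v ≡ map g v
map-cong-lookup []      eq = refl
map-cong-lookup (x ∷ v) eq = cong₂ _∷_ (eq zero) (map-cong-lookup v (eq ∘ suc))

lookup∈toList : ∀ {X : Set} {m} (v : Vec X m) i → lookup v i ∈ Vec.toList v
lookup∈toList (x ∷ v) zero    = here refl
lookup∈toList (x ∷ v) (suc i) = there (lookup∈toList v i)

∃vec? : ∀ {n} m {P : Vec (Fin n) m → Set} → (∀ v → Dec (P v)) → Dec (∃ P)
∃vec? zero    P? = map′ (λ p → [] , p) (λ { ([] , p) → p }) (P? [])
∃vec? (suc m) P? = map′ (λ { (x , v , p) → (x ∷ v) , p }) (λ { (x ∷ v , p) → x , v , p })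
  (Finₚ.any? (λ x → ∃vec? m (λ v → P? (x ∷ v))))

concat-length : ∀ {X : Set} (ls : List (List X)) r → (∀ {l} → l ∈ ls → length l ≤ r) →
  length (concat ls) ≤ length ls * r
concat-length []       r b = z≤n
concat-length (l ∷ ls) r b = ≤-trans (≤-reflexive (Listₚ.length-++ l))
  (+-mono-≤ (b (here refl)) (concat-length ls r (b ∘ there)))

module Types (𝔐 : Model) (m : ℕ) (labc : Code (Model.Lab 𝔐) m)
  (β : ℕ) (used : Fin β → Fin (Model.nb 𝔐))
  (useIx : ∀ {i} → Model.Use 𝔐 i → ∃ λ j → used j ≡ i)
  (ra : ℕ) (ar≤ : ∀ j → Model.ar 𝔐 (used j) ≤ ra) where

  open Model 𝔐
  open Structures 𝔐

  -- Besides the distinguished point, a query mentions its nodes and the arguments of its base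
  -- facts, which need not be nodes.
  nw V : ℕ
  nw = nv + nf * ra
  V  = suc nw

  CQFact CQ : Set
  CQFact = Maybe (Fin β) × Vec (Fin V) ra
  CQ = Vec (Vec (Vec Bool V) V) k × Vec Lab V × Vec CQFact nf

  qc : ℕ
  qc = k * (V * (V * 1)) + (V * m + nf * (β + ra * nw))

  abstract
   code-CQ : Code CQ qc
   code-CQ = code-× (code-Vec (code-Vec (code-Vec code-Bool V) V) k)
    (code-× (code-Vec labc V) (code-Vec (code-× (code-MaybeFin β) (code-Vec (code-Fin nw) ra)) nf))

  SatF : Vec A V → CQFact → Set
  SatF f (nothing , _) = ⊤
  SatF f (just j , v)  = RA (used j) (map (lookup f) (fit zero (ar (used j)) v)) ≡ true

  SatCQ : Vec A V → CQ → Set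
  SatCQ f (tb , lb , fs) =
    (∀ u p q → lookup (lookup (lookup tb u) p) q ≡ true → TA u (lookup f p) (lookup f q) ≡ true)
    × (∀ p → lab (lookup f p) ≡ lookup lb p)
    × (∀ i → SatF f (lookup fs i))

  SatF? : ∀ f c → Dec (SatF f c)
  SatF? f (nothing , _) = yes tt
  SatF? f (just j , v)  = _ Bool.≟ true

  SatCQ? : ∀ f c → Dec (SatCQ f c)
  SatCQ? f (tb , lb , fs) =
    Finₚ.all? (λ u → Finₚ.all? λ p → Finₚ.all? λ q → (_ Bool.≟ true) →-dec (_ Bool.≟ true))
    ×-dec Finₚ.all? (λ p → code-≟ labc _ _) ×-dec Finₚ.all? (λ i → SatF? f (lookup fs i))

  Holds : A → CQ → Set
  Holds a c = ∃ λ (f : Vec A nw) → SatCQ (a ∷ f) c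

  abstract
   Holds? : ∀ a c → Dec (Holds a c)
   Holds? a c = ∃vec? nw (λ f → SatCQ? (a ∷ f) c)

  Q : ℕ
  Q = 2 ^ qc

  tp : A → Vec Bool Q
  tp a = table qc (λ v → does (Holds? a (dec code-CQ v)))

  tp-Holds : ∀ {a a′} → tp a ≡ tp a′ → ∀ c → Holds a c → Holds a′ c
  tp-Holds {a} {a′} eq c hc = subst (Holds a′) (dec-enc code-CQ c) (does-true (Holds? a′ _)
    (trans (sym (table-injective qc {λ v → does (Holds? a (dec code-CQ v))} {λ v → does (Holds? a′ (dec code-CQ v))} eq (enc code-CQ c)))
      (dec-true (Holds? a _) (subst (Holds a) (sym (dec-enc code-CQ c)) hc))))

  -- An answer `h` at `a` makes a coded query true at `a`, hence at `a′`. The point `p` gets index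
  -- zero, the index of the distinguished variable.
  transfer : ∀ {C} (_≟_ : DecidableEquality C) {S : Str C} {p a a′} → tp a ≡ tp a′ → Ok S p a → Ok S p a′
  transfer {C} _≟_ {S} {p} {a} {a′} eq ok zs zs≤ Γ Γ≤ = h′ , h′p , pres t-pres l-pres r-pres
    where
    h = proj₁ (ok zs zs≤ Γ Γ≤)
    hp = proj₁ (proj₂ (ok zs zs≤ Γ Γ≤))
    pr = proj₂ (proj₂ (ok zs zs≤ Γ Γ≤))
    as : List (List C)
    as = List.map (Vec.toList ∘ args) Γ
    ws : List C
    ws = zs ++ concat as
    as≤ : ∀ Γ′ {l} → l ∈ List.map (Vec.toList ∘ args {S = S}) Γ′ → length l ≤ ra
    as≤ (fact i us v r ∷ Γ′) (here refl) with useIx us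
    ... | j , refl = ≤-trans (≤-reflexive (Vecₚ.length-toList v)) (ar≤ j)
    as≤ (_ ∷ Γ′) (there l∈) = as≤ Γ′ l∈
    ws≤ : length ws ≤ nw
    ws≤ = ≤-trans (≤-reflexive (Listₚ.length-++ zs)) (+-mono-≤ zs≤
      (≤-trans (concat-length as ra (as≤ Γ))
        (*-monoˡ-≤ ra (≤-trans (≤-reflexive (Listₚ.length-map _ Γ)) Γ≤))))
    pv : Vec C V
    pv = p ∷ fit p nw (Vec.fromList ws)
    idx : C → Fin V
    idx z with z ≟ p
    ... | yes _ = zero
    ... | no  _ with Finₚ.any? (λ j → lookup pv j ≟ z)
    ...   | yes (j , _) = j
    ...   | no _        = zero
    idx-p : idx p ≡ zero
    idx-p with p ≟ p
    ... | yes _ = refl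
    ... | no ¬q = ⊥-elim (¬q refl)
    lookup-idx : ∀ {z} → z ∈ (p ∷ ws) → lookup pv (idx z) ≡ z
    lookup-idx {z} z∈ with z ≟ p
    ... | yes z≡p = sym z≡p
    ... | no z≢p with Finₚ.any? (λ j → lookup pv j ≟ z)
    ...   | yes (j , q) = q
    ...   | no ¬q = ⊥-elim (¬q (find z∈))
      where
      find : z ∈ (p ∷ ws) → ∃ λ j → lookup pv j ≡ z
      find (here q)  = ⊥-elim (z≢p q)
      find (there i) = let j , q = fit-∈ p i ws≤ in suc j , q
    arg∈ : ∀ {f} → f ∈ Γ → ∀ i → lookup (args f) i ∈ (p ∷ ws)
    arg∈ {f} f∈ i = there (∈-++⁺ʳ zs (∈-concat⁺′ (lookup∈toList (args f) i) (∈-map⁺ (Vec.toList ∘ args) f∈)))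
    factCode : Fact S → CQFact
    factCode f = just (proj₁ (useIx (use f))) , fit zero ra (map idx (args f))
    d₀ : CQFact
    d₀ = nothing , Vec.replicate ra zero
    -- The relations are read off the image of `h` in the model, since those of `S` need not be
    -- decidable; this can only make the query stronger.
    cq : CQ
    cq = tabulate (λ u → tabulate λ x → tabulate λ y → TA u (h (lookup pv x)) (h (lookup pv y)))
       , map (lab ∘ h) pv , fit d₀ nf (Vec.fromList (List.map factCode Γ))
    bit-eq : ∀ u x y → lookup (lookup (lookup (proj₁ cq) u) x) y ≡ TA u (h (lookup pv x)) (h (lookup pv y))
    bit-eq u x y = trans
      (cong (λ v → lookup (lookup v x) y)
        (Vecₚ.lookup∘tabulate (λ u → tabulate {n = V} λ x → tabulate {n = V} λ y → val u x y) u))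
      (trans (cong (λ v → lookup v y) (Vecₚ.lookup∘tabulate (λ x → tabulate {n = V} λ y → val u x y) x))
        (Vecₚ.lookup∘tabulate (val u x) y))
      where
      val : Fin k → Fin V → Fin V → Bool
      val u x y = TA u (h (lookup pv x)) (h (lookup pv y))
    satFact : ∀ (g : Vec A V) f →
      (SatF g (factCode f) → RA (rsym f) (map (λ z → lookup g (idx z)) (args f)) ≡ true)
      × (RA (rsym f) (map (λ z → lookup g (idx z)) (args f)) ≡ true → SatF g (factCode f))
    satFact g (fact i us v r) with useIx us
    ... | j , refl = (λ q → trans (cong (RA (used j)) (sym e)) q) , (λ q → trans (cong (RA (used j)) e) q)
      where
      e : map (lookup g) (fit zero (ar (used j)) (fit zero ra (map idx v))) ≡ map (λ z → lookup g (idx z)) v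
      e = trans (cong (map (lookup g)) (fit-fit zero (ar≤ j) (map idx v))) (sym (Vecₚ.map-∘ (lookup g) idx v))
    hpv : map h pv ≡ a ∷ map h (fit p nw (Vec.fromList ws))
    hpv = cong (_∷ map h (fit p nw (Vec.fromList ws))) hp
    satcq : SatCQ (map h pv) cq
    satcq = (λ u x y q → trans (cong₂ (TA u) (Vecₚ.lookup-map x h pv) (Vecₚ.lookup-map y h pv))
                          (trans (sym (bit-eq u x y)) q))
          , (λ x → trans (cong lab (Vecₚ.lookup-map x h pv)) (sym (Vecₚ.lookup-map x (lab ∘ h) pv)))
          , facts
      where
      facts : ∀ i → SatF (map h pv) (lookup (fit d₀ nf (Vec.fromList (List.map factCode Γ))) i)
      facts i with fit-lookup d₀ (List.map factCode Γ) {nf} i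
      ... | inj₁ q = subst (SatF (map h pv)) (sym q) tt
      ... | inj₂ q with ∈-map⁻ factCode q
      ...   | f , f∈ , q′ = subst (SatF (map h pv)) (sym q′) (proj₂ (satFact (map h pv) f)
                (trans (cong (RA (rsym f)) (map-cong-lookup (args f) (λ j →
                  trans (Vecₚ.lookup-map (idx (lookup (args f) j)) h pv) (cong h (lookup-idx (arg∈ f∈ j))))))
                  (R-pres pr f∈)))
    H′ : Holds a′ cq
    H′ = tp-Holds eq cq (_ , subst (λ v → SatCQ v cq) hpv satcq)
    f′ : Vec A V
    f′ = a′ ∷ proj₁ H′
    h′ : C → A
    h′ z = lookup f′ (idx z)
    h′p : h′ p ≡ a′
    h′p = cong (lookup f′) idx-p
    zs⊆ : ∀ {x} → x ∈ (p ∷ zs) → x ∈ (p ∷ ws)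
    zs⊆ (here q)  = here q
    zs⊆ (there i) = there (∈-++⁺ˡ i)
    t-pres : ∀ u {x y} → x ∈ (p ∷ zs) → y ∈ (p ∷ zs) → T S u x y → TA u (h′ x) (h′ y) ≡ true
    t-pres u {x} {y} x∈ y∈ t = proj₁ (proj₂ H′) u (idx x) (idx y) (trans (bit-eq u _ _)
      (trans (cong₂ (λ v w → TA u (h v) (h w)) (lookup-idx (zs⊆ x∈)) (lookup-idx (zs⊆ y∈)))
        (T-pres pr u x∈ y∈ t)))
    l-pres : ∀ {x} → x ∈ (p ∷ zs) → lab (h′ x) ≡ labS S x
    l-pres {x} x∈ = trans (proj₁ (proj₂ (proj₂ H′)) (idx x)) (trans (Vecₚ.lookup-map (idx x) (lab ∘ h) pv)
      (trans (cong (lab ∘ h) (lookup-idx (zs⊆ x∈))) (lab-pres pr x∈)))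
    r-pres : ∀ {f} → f ∈ Γ → RA (rsym f) (map h′ (args f)) ≡ true
    r-pres {f} f∈ with fit-∈ d₀ (∈-map⁺ factCode f∈) (≤-trans (≤-reflexive (Listₚ.length-map factCode Γ)) Γ≤)
    ... | j , q = proj₁ (satFact f′ f) (subst (SatF f′) q (proj₂ (proj₂ (proj₂ H′)) j))

  private
    -- Applied to a single element as a structure of its own, `transfer` shows that the type
    -- determines the label and the reflexive relations.
    point : A → Str ⊤
    point a = record { labS = λ _ → lab a ; R = λ _ _ → ⊥ ; T = λ u _ _ → TA u a a ≡ true
                     ; T-trans = λ {u} → λ p _ → p }

    point-Ok : ∀ {a a′} → tp a ≡ tp a′ → Σ (⊤ → A) λ h → h tt ≡ a′ × Pres (point a) (tt ∷ []) [] h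
    point-Ok {a} eq = transfer (λ _ _ → yes refl) {point a} eq
      (λ zs _ Γ _ → (λ _ → a) , refl , pres (λ u _ _ t → t) (λ _ → refl) (λ {f} _ → ⊥-elim (holds f)))
      [] z≤n [] z≤n

  tp-lab : ∀ {a a′} → tp a ≡ tp a′ → lab a′ ≡ lab a
  tp-lab eq = let h , hp , pr = point-Ok eq in trans (cong lab (sym hp)) (lab-pres pr (here refl))

  tp-refl : ∀ {a a′} → tp a ≡ tp a′ → ∀ u → TA u a a ≡ true → TA u a′ a′ ≡ true
  tp-refl eq u t = let h , hp , pr = point-Ok eq in
    subst (λ z → TA u z z ≡ true) hp (T-pres pr u (here refl) (here refl) t)

-- Lists of living relations, and elements maximal for their prefixes

lookup-unique : ∀ {X : Set} {xs : List X} → Unique xs → ∀ i j → List.lookup xs i ≡ List.lookup xs j → i ≡ j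
lookup-unique (_ ∷ _)  zero    zero    _  = refl
lookup-unique (p ∷ _)  zero    (suc j) eq = ⊥-elim (All.lookup p (∈-lookup j) eq)
lookup-unique (p ∷ _)  (suc i) zero    eq = ⊥-elim (All.lookup p (∈-lookup i) (sym eq))
lookup-unique (_ ∷ u)  (suc i) (suc j) eq = cong suc (lookup-unique u i j eq)

unique-length : ∀ {X : Set} {xs ys : List X} → Unique xs → (∀ x → x ∈ ys) → length xs ≤ length ys
unique-length {xs = xs} {ys} u all = Finₚ.injective⇒≤ {f = λ i → Any.index (all (List.lookup xs i))}
  (λ {i} {j} eq → lookup-unique u i j (trans (lookup-index (all (List.lookup xs i)))
    (trans (cong (List.lookup ys) eq) (sym (lookup-index (all (List.lookup xs j)))))))

All-take-≤ : ∀ {X : Set} {P : X → Set} {i j} (xs : List X) → i ≤ j → All P (take j xs) → All P (take i xs)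
All-take-≤ xs       z≤n     _        = []
All-take-≤ []       (s≤s l) _        = []
All-take-≤ (x ∷ xs) (s≤s l) (p ∷ ps) = p ∷ All-take-≤ xs l ps

take-≤-≡ : ∀ {X : Set} {i j} (xs ys : List X) → i ≤ j → take j xs ≡ take j ys → take i xs ≡ take i ys
take-≤-≡ xs ys z≤n eq = refl
take-≤-≡ [] [] (s≤s l) eq = refl
take-≤-≡ (x ∷ xs) (y ∷ ys) (s≤s l) eq = cong₂ _∷_ (Listₚ.∷-injectiveˡ eq) (take-≤-≡ xs ys l (Listₚ.∷-injectiveʳ eq))

∈-take-≤ : ∀ {X : Set} {x : X} {i j} (xs : List X) → i ≤ j → x ∈ take i xs → x ∈ take j xs
∈-take-≤ (x ∷ xs) (s≤s l) (here p)  = here p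
∈-take-≤ (x ∷ xs) (s≤s l) (there p) = there (∈-take-≤ xs l p)

module Position {X : Set} (_≟_ : DecidableEquality X) where

  position : X → List X → ℕ
  position w []       = 0
  position w (v ∷ vs) with w ≟ v
  ... | yes _ = 0
  ... | no  _ = suc (position w vs)

  position-< : ∀ {w xs} → w ∈ xs → position w xs < length xs
  position-< {w} {v ∷ vs} w∈ with w ≟ v
  ... | yes _ = s≤s z≤n
  position-< {w} {v ∷ vs} (here p)  | no ¬p = ⊥-elim (¬p p)
  position-< {w} {v ∷ vs} (there i) | no ¬p = s≤s (position-< i)

  position-∉take : ∀ {w} xs j → w ∈ xs → w ∉ take j xs → j ≤ position w xs
  position-∉take xs zero w∈ w∉ = z≤n
  position-∉take {w} (v ∷ vs) (suc j) w∈ w∉ with w ≟ v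
  ... | yes p = ⊥-elim (w∉ (here p))
  position-∉take {w} (v ∷ vs) (suc j) (here p)  w∉ | no ¬p = ⊥-elim (¬p p)
  position-∉take {w} (v ∷ vs) (suc j) (there i) w∉ | no ¬p = s≤s (position-∉take vs j i (w∉ ∘ there))

  -- Deletions before `w` move it towards the front, and additions come after it. If it does not
  -- move, nothing before it was deleted, so the prefix up to `w` is intact.
  position-filter : ∀ {P : X → Set} (P? : ∀ x → Dec (P x)) {w} (xs ys : List X) → w ∈ xs → P w →
    position w (filter P? xs ++ ys) ≤ position w xs ×
    (position w (filter P? xs ++ ys) ≡ position w xs →
      take (suc (position w xs)) (filter P? xs ++ ys) ≡ take (suc (position w xs)) xs)
  position-filter P? {w} (v ∷ vs) ys w∈ pw with w ≟ v
  position-filter P? {w} (v ∷ vs) ys w∈ pw | yes refl with P? v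
  ... | no ¬p = ⊥-elim (¬p pw)
  ... | yes _ with v ≟ v
  ...   | yes _ = z≤n , λ _ → refl
  ...   | no ¬q = ⊥-elim (¬q refl)
  position-filter P? {w} (v ∷ vs) ys (here p)  pw | no ¬p = ⊥-elim (¬p p)
  position-filter P? {w} (v ∷ vs) ys (there i) pw | no ¬p with P? v | position-filter P? vs ys i pw
  ... | no _  | le , _ = m≤n⇒m≤1+n le , λ eq → ⊥-elim (<-irrefl eq (s≤s le))
  ... | yes _ | le , tk with w ≟ v
  ...   | yes q = ⊥-elim (¬p q)
  ...   | no _  = s≤s le , λ eq → cong (v ∷_) (tk (suc-injective eq))

module Runs (𝔐 : Model) {Q : ℕ} (tp : Fin (Model.n 𝔐) → Vec Bool Q) where
  open Model 𝔐
  open Structures 𝔐 using (A)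

  -- (u , true) stands for the inverse of (u , false).
  W : Set
  W = Fin k × Bool

  _≟W_ : DecidableEquality W
  _≟W_ = Prodₚ.≡-dec Fin._≟_ Bool._≟_

  open Position _≟W_ public
  open import Data.List.Membership.DecPropositional _≟W_ public using (_∈?_)

  TW : W → A → A → Bool
  TW (u , false) a b = TA u a b
  TW (u , true)  a b = TA u b a

  TW-trans : ∀ w {a b c} → TW w a b ≡ true → TW w b c ≡ true → TW w a c ≡ true
  TW-trans (u , false) p q = TA-trans u p q
  TW-trans (u , true)  p q = TA-trans u q p

  TW? : ∀ w a b → Dec (TW w a b ≡ true)
  TW? w a b = TW w a b Bool.≟ true

  RV : List W → A → A → Set
  RV V a b = All (λ w → TW w a b ≡ true) V

  RV? : ∀ V a b → Dec (RV V a b)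
  RV? V a b = All.all? (λ w → TW? w a b) V

  RV-trans : ∀ {V a b c} → RV V a b → RV V b c → RV V a c
  RV-trans []       []       = []
  RV-trans {w ∷ V} (p ∷ ps) (q ∷ qs) = TW-trans w p q ∷ RV-trans ps qs

  _≟t_ : (x y : Vec Bool Q) → Dec (x ≡ y)
  _≟t_ = _≟ᵛ_

  IsMax : List W → A → Set
  IsMax V a = ∀ c → RV V a c → tp c ≡ tp a → RV V c a

  IsMax? : ∀ V a → Dec (IsMax V a)
  IsMax? V a = Finₚ.all? (λ c → RV? V a c →-dec ((tp c ≟t tp a) →-dec RV? V c a))

  private
    climb : List W → List A → A → A
    climb V []       b = b
    climb V (c ∷ cs) b with RV? V b c | tp c ≟t tp b
    ... | yes _ | yes _ = climb V cs c
    ... | _     | _     = climb V cs b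

    climb-tp : ∀ V cs b → tp (climb V cs b) ≡ tp b
    climb-tp V []       b = refl
    climb-tp V (c ∷ cs) b with RV? V b c | tp c ≟t tp b
    ... | yes _ | yes t = trans (climb-tp V cs c) t
    ... | yes _ | no _  = climb-tp V cs b
    ... | no _  | yes _ = climb-tp V cs b
    ... | no _  | no _  = climb-tp V cs b

    climb-up : ∀ V cs b → climb V cs b ≡ b ⊎ RV V b (climb V cs b)
    climb-up V []       b = inj₁ refl
    climb-up V (c ∷ cs) b with RV? V b c | tp c ≟t tp b
    ... | yes r | yes _ = inj₂ ([ (λ e → subst (RV V b) (sym e) r) , RV-trans r ]′ (climb-up V cs c))
    ... | yes _ | no _  = climb-up V cs b
    ... | no _  | yes _ = climb-up V cs b
    ... | no _  | no _  = climb-up V cs b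

    -- One pass suffices: an element above the final one was above the candidate at the time of its
    -- visit, so it was taken then, and the final element is equal to it or above it.
    climb-max : ∀ V cs b {c} → c ∈ cs → RV V (climb V cs b) c → tp c ≡ tp b → RV V c (climb V cs b)
    climb-max V (c ∷ cs) b (here refl) r t with RV? V b c | tp c ≟t tp b
    ... | yes _ | yes _ = [ (λ e → subst (λ z → RV V z (climb V cs c)) e r′) , id ]′ (climb-up V cs c)
      where
      r′ : RV V (climb V cs c) (climb V cs c)
      r′ = [ (λ e → subst (RV V (climb V cs c)) (sym e) r) , RV-trans r ]′ (climb-up V cs c)
    ... | yes _ | no ¬t = ⊥-elim (¬t t)
    ... | no ¬r | yes _ = ⊥-elim (¬r ([ (λ e → subst (λ z → RV V z c) e r) , (λ q → RV-trans q r) ]′ (climb-up V cs b)))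
    ... | no _ | no ¬t  = ⊥-elim (¬t t)
    climb-max V (c′ ∷ cs) b (there i) r t with RV? V b c′ | tp c′ ≟t tp b
    ... | yes _ | yes t′ = climb-max V cs c′ i r (trans t (sym t′))
    ... | yes _ | no _  = climb-max V cs b i r t
    ... | no _  | yes _ = climb-max V cs b i r t
    ... | no _  | no _  = climb-max V cs b i r t

  maximal : List W → A → A
  maximal V b with IsMax? V b
  ... | yes _ = b
  ... | no  _ = climb V (allFin n) b

  maximal-tp : ∀ V b → tp (maximal V b) ≡ tp b
  maximal-tp V b with IsMax? V b
  ... | yes _ = refl
  ... | no  _ = climb-tp V (allFin n) b

  maximal-up : ∀ V b → maximal V b ≡ b ⊎ RV V b (maximal V b)
  maximal-up V b with IsMax? V b
  ... | yes _ = inj₁ refl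
  ... | no  _ = climb-up V (allFin n) b

  maximal-max : ∀ V b → IsMax V (maximal V b)
  maximal-max V b with IsMax? V b
  ... | yes p = p
  ... | no  _ = λ c r t → climb-max V (allFin n) b (∈-allFin c) r (trans t (climb-tp V (allFin n) b))

  maximal-fix : ∀ V b → IsMax V b → maximal V b ≡ b
  maximal-fix V b p with IsMax? V b
  ... | yes _ = refl
  ... | no ¬p = ⊥-elim (¬p p)

  IsMax-up : ∀ {V a a′} → IsMax V a → a′ ≡ a ⊎ RV V a a′ → tp a′ ≡ tp a → IsMax V a′
  IsMax-up mx (inj₁ refl) t = mx
  IsMax-up mx (inj₂ r) t c r′ t′ = RV-trans (mx c (RV-trans r r′) (trans t′ t)) r

  -- The prefixes are treated by increasing length: a climb for a longer prefix is also one for each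
  -- shorter prefix, so by `IsMax-up` it keeps the maximality already gained.
  maximise : List W → ℕ → A → A
  maximise ω zero    b = b
  maximise ω (suc j) b = maximal (take (suc j) ω) (maximise ω j b)

  maximise-tp : ∀ ω j b → tp (maximise ω j b) ≡ tp b
  maximise-tp ω zero    b = refl
  maximise-tp ω (suc j) b = trans (maximal-tp _ _) (maximise-tp ω j b)

  maximise-up : ∀ ω i m b → maximise ω (m + i) b ≡ maximise ω i b ⊎
    RV (take (suc i) ω) (maximise ω i b) (maximise ω (m + i) b)
  maximise-up ω i zero    b = inj₁ refl
  maximise-up ω i (suc m) b with maximise-up ω i m b | maximal-up (take (suc (m + i)) ω) (maximise ω (m + i) b)
  ... | p | inj₁ e rewrite e = p
  ... | inj₁ e | inj₂ r = inj₂ (subst (λ z → RV (take (suc i) ω) z (maximise ω (suc m + i) b)) e (All-take-≤ ω (s≤s (m≤n+m i m)) r))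
  ... | inj₂ q | inj₂ r = inj₂ (RV-trans q (All-take-≤ ω (s≤s (m≤n+m i m)) r))

  maximise-max : ∀ ω {i j} b → i ≤ j → IsMax (take i ω) (maximise ω j b)
  maximise-max ω {zero}  b _ = λ _ _ _ → []
  maximise-max ω {suc i} {j} b i<j = subst (λ z → IsMax _ (maximise ω z b)) (m∸n+n≡m i<j)
    (IsMax-up (maximal-max (take (suc i) ω) (maximise ω i b))
      ([ inj₁ , (λ r → inj₂ (All-take-≤ ω (n≤1+n (suc i)) r)) ]′ (maximise-up ω (suc i) (j ∸ suc i) b))
      (trans (maximise-tp ω (j ∸ suc i + suc i) b) (sym (maximise-tp ω (suc i) b))))

  module _ (ω : List W) {J j : ℕ} (j≤J : j ≤ J) {a b : A}
    (ab : RV (take j ω) a b) (a₁a : RV (take j ω) (maximise ω J b) a) where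

    private
      a₁ = maximise ω J b

      above : ∀ i → i ≤ J → a₁ ≡ maximise ω i b ⊎ RV (take (suc i) ω) (maximise ω i b) a₁
      above i i≤J = subst (λ z → maximise ω z b ≡ _ ⊎ RV _ (maximise ω i b) (maximise ω z b)) (m∸n+n≡m i≤J)
        (maximise-up ω i (J ∸ i) b)

      still : ∀ i → i ≤ j → maximise ω i b ≡ b
      still zero    _   = refl
      still (suc i) i<j with still i (≤-trans (n≤1+n i) i<j) | maximal-up (take (suc i) ω) (maximise ω i b)
      ... | e | inj₁ e′ = trans e′ e
      ... | e | inj₂ r = trans (cong (maximal V) e) (maximal-fix V b maxb)
        where
        V = take (suc i) ω
        b₂ = maximise ω (suc i) b
        b₂a : RV V b₂ a
        b₂a = [ (λ q → subst (λ z → RV V z a) q (All-take-≤ ω i<j a₁a))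
              , (λ q → RV-trans (All-take-≤ ω (n≤1+n (suc i)) q) (All-take-≤ ω i<j a₁a)) ]′
              (above (suc i) (≤-trans i<j j≤J))
        b₂b : RV V b₂ b
        b₂b = RV-trans b₂a (All-take-≤ ω i<j ab)
        maxb : IsMax V b
        maxb c bc t = RV-trans (maximal-max V (maximise ω i b) c (RV-trans b₂b bc)
                        (trans t (sym (maximise-tp ω (suc i) b)))) b₂b

    -- For the prefix of length `j` the elements `a`, `b`, `a₁` form a cycle, so `b` shares a clique
    -- with the results of the initial `j` climbs. It is therefore already maximal, and these climbs
    -- do not move it; the remaining ones respect one more symbol.
    maximise-still : a₁ ≡ b ⊎ RV (take (suc j) ω) b a₁
    maximise-still = subst (λ z → a₁ ≡ z ⊎ RV (take (suc j) ω) z a₁) (still j ≤-refl) (above j j≤J)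

  opaque
    allW : List W
    allW = cartesianProduct (allFin k) (false ∷ true ∷ [])

    ∈-allW : ∀ w → w ∈ allW
    ∈-allW (u , false) = ∈-cartesianProduct⁺ (∈-allFin u) (here refl)
    ∈-allW (u , true)  = ∈-cartesianProduct⁺ (∈-allFin u) (there (here refl))

    unique-allW : Unique allW
    unique-allW = Uniqueₚ.cartesianProduct⁺ (Uniqueₚ.allFin⁺ k) (((λ ()) ∷ []) ∷ [] ∷ [])

    length-allW : length allW ≡ k * 2
    length-allW = trans (go (allFin k)) (cong (_* 2) (Listₚ.length-tabulate {n = k} id))
      where
      go : (xs : List (Fin k)) → length (cartesianProduct xs (false ∷ true ∷ [])) ≡ length xs * 2
      go []       = refl
      go (x ∷ xs) = cong (2 +_) (go xs)

  module _ (ω : List W) (a b : A) where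

    private
      P? : ∀ w → Dec (TW w a b ≡ true)
      P? w = TW? w a b

      N? : ∀ w → Dec (TW w a b ≡ true × ¬ (w ∈ ω))
      N? w = TW? w a b ×-dec ¬? (w ∈? ω)

    opaque
      alive : List W
      alive = filter P? ω ++ filter N? allW

      alive-unique : Unique ω → Unique alive
      alive-unique u = Uniqueₚ.++⁺ (Uniqueₚ.filter⁺ P? u) (Uniqueₚ.filter⁺ N? unique-allW)
        (λ { (p , q) → proj₂ (proj₂ (∈-filter⁻ N? {xs = allW} q)) (proj₁ (∈-filter⁻ P? {xs = ω} p)) })

      alive-all : RV alive a b
      alive-all = Allₚ.++⁺ (Allₚ.all-filter P? ω) (All.map proj₁ (Allₚ.all-filter N? allW))

      alive-∈ : ∀ {w} → TW w a b ≡ true → w ∈ alive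
      alive-∈ {w} t with w ∈? ω
      ... | yes p = ∈-++⁺ˡ (∈-filter⁺ P? p t)
      ... | no ¬p = ∈-++⁺ʳ (filter P? ω) (∈-filter⁺ N? (∈-allW w) (t , ¬p))

      alive-position : ∀ {w} → w ∈ ω → TW w a b ≡ true → position w alive ≤ position w ω ×
        (position w alive ≡ position w ω →
          take (suc (position w ω)) alive ≡ take (suc (position w ω)) ω)
      alive-position w∈ t = position-filter P? ω _ w∈ t

  -- The type of `a` itself is included, although `V` need not be reflexive at `a`: it is the type
  -- that a strict step loses.
  Up : List W → A → Vec Bool Q → Bool
  Up V a τ = does ((tp a ≟t τ) ⊎-dec Finₚ.any? (λ c → RV? V a c ×-dec (tp c ≟t τ)))

  Clique : List W → A → Vec Bool Q → Bool
  Clique V a τ = does (Finₚ.any? (λ c → RV? V a c ×-dec RV? V c a ×-dec (tp c ≟t τ)))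

  Clique-cong : ∀ {V a a′} → RV V a a′ → RV V a′ a → ∀ τ → Clique V a τ ≡ Clique V a′ τ
  Clique-cong {V} {a} {a′} p q τ = does-cong
    (Finₚ.any? (λ c → RV? V a c ×-dec RV? V c a ×-dec (tp c ≟t τ)))
    (Finₚ.any? (λ c → RV? V a′ c ×-dec RV? V c a′ ×-dec (tp c ≟t τ)))
    (λ { (c , r , s , t) → c , RV-trans q r , RV-trans s p , t })
    (λ { (c , r , s , t) → c , RV-trans p r , RV-trans s q , t })

  Up-mono : ∀ {V a a′} → RV V a a′ → ∀ τ → Up V a′ τ ≡ true → Up V a τ ≡ true
  Up-mono {V} {a} {a′} p τ u = dec-true ((tp a ≟t τ) ⊎-dec Finₚ.any? (λ c → RV? V a c ×-dec (tp c ≟t τ)))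
    (case does-true ((tp a′ ≟t τ) ⊎-dec Finₚ.any? (λ c → RV? V a′ c ×-dec (tp c ≟t τ))) u of λ
      { (inj₁ t) → inj₂ (a′ , p , t) ; (inj₂ (c , r , t)) → inj₂ (c , RV-trans p r , t) })

  -- The type of a maximal element is lost above a strict successor: this bounds the strict steps of a run.
  Up-strict : ∀ {V a a′} → IsMax V a → RV V a a′ → ¬ RV V a′ a → ones Q (Up V a′) < ones Q (Up V a)
  Up-strict {V} {a} {a′} mx p ¬q = ones-strict Q (Up-mono {V} p) (tp a)
    (dec-false ((tp a′ ≟t tp a) ⊎-dec Finₚ.any? (λ c → RV? V a′ c ×-dec (tp c ≟t tp a)))
      (λ { (inj₁ t) → ¬q (mx a′ p t)
         ; (inj₂ (c , r , t)) → ¬q (RV-trans r (mx c (RV-trans p r) t)) }))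
    (dec-true ((tp a ≟t tp a) ⊎-dec Finₚ.any? (λ c → RV? V a c ×-dec (tp c ≟t tp a))) (inj₁ refl))

-- Which of a relation and its inverse holds along the path from the ancestors, and which of the two runs is older.
data Status : Set where
  none fwd bwd fwd-older tied bwd-older : Status

update-status : Status → Bool → Bool → Status
update-status _         false false = none
update-status _         true  false = fwd
update-status _         false true  = bwd
update-status none      true  true  = tied
update-status fwd       true  true  = fwd-older
update-status bwd       true  true  = bwd-older
update-status fwd-older true  true  = fwd-older
update-status tied      true  true  = tied
update-status bwd-older true  true  = bwd-older

code-Status : Code Status 3
code-Status = code-retract (code-× code-Bool (code-× code-Bool code-Bool))
  (λ { none → false , false , false ; fwd → false , false , true ; bwd → false , true , false
     ; fwd-older → true , false , false ; tied → true , false , true ; bwd-older → true , true , false })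
  (λ { (false , false , false) → none ; (false , false , true) → fwd ; (false , true , _) → bwd
     ; (true , false , false) → fwd-older ; (true , false , true) → tied ; (true , true , _) → bwd-older })
  (λ { none → refl ; fwd → refl ; bwd → refl ; fwd-older → refl ; tied → refl ; bwd-older → refl })

-- In ℓ s d: the step from s to its child d keeps the clique of the symbols of level ℓ; Um ℓ u s: u is one of these symbols at s;
-- Tot ℓ s t: s and t lie in cliques of level ℓ that realise the same types;
-- cnt s u b ℓ: number of steps leaving level ℓ but not level ℓ + 1 in the current run of (u , b).
record Auto (𝔐 : Model) {Q : ℕ} (tp : Fin (Model.n 𝔐) → Vec Bool Q) : Set₁ where
  open Model 𝔐
  A : Set
  A = Fin n
  field
    S       : Set
    e₀      : ℕ
    code-S  : Code S e₀
    s₀      : S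
    D       : ℕ
    ch      : A → Fin D → A
    el      : S → A
    nxt     : S → Fin D → S
    nxt-tp  : ∀ s d → tp (el (nxt s d)) ≡ tp (ch (el s) d)
    J       : ℕ
    In      : ℕ → S → Fin D → Set
    In?     : ∀ ℓ s d → Dec (In ℓ s d)
    In-zero : ∀ {s d} → ¬ In 0 s d
    In-suc  : ∀ {ℓ s d} → In ℓ s d → In (suc ℓ) s d
    In-top  : ∀ s d → In (suc J) s d
    Um      : ℕ → Fin k → S → Set
    Um?     : ∀ ℓ u s → Dec (Um ℓ u s)
    Um-suc  : ∀ {ℓ u s} → Um (suc (suc ℓ)) u s → Um (suc ℓ) u s
    Tot     : ℕ → S → S → Set
    Tot?    : ∀ ℓ s t → Dec (Tot ℓ s t)
    Tot-zero  : ∀ {s t} → ¬ Tot 0 s t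
    Tot-sym   : ∀ {ℓ s t} → Tot ℓ s t → Tot ℓ t s
    Tot-trans : ∀ {ℓ s t r} → Tot ℓ s t → Tot ℓ t r → Tot ℓ s r
    Tot-suc   : ∀ {ℓ s t} → Tot (suc ℓ) s t → Tot (suc (suc ℓ)) s t
    Tot-Um    : ∀ {ℓ s t u} → Tot ℓ s t → Um ℓ u s → Um ℓ u t
    In-Tot    : ∀ {ℓ s d} → In ℓ s d → Tot ℓ s (nxt s d)
    In-edge   : ∀ {ℓ s d u} → In ℓ s d → Um ℓ u s →
      TA u (el s) (ch (el s) d) ≡ true × TA u (ch (el s) d) (el s) ≡ true
    hub     : ∀ ℓ → Σ (S → A) λ c → (∀ s → tp (c s) ≡ tp (el s)) ×
      (∀ {s t u} → Tot (suc ℓ) s t → Um (suc ℓ) u s → TA u (c s) (c t) ≡ true)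
    M       : ℕ
    cnt     : S → Fin k → Bool → ℕ → ℕ
    cnt≤M   : ∀ s u b ℓ → cnt s u b ℓ ≤ M
    cnt-nxt : ∀ {ℓ s d u} b → ℓ ≤ J → In (suc ℓ) s d → ¬ Um (suc ℓ) u s →
      cnt (nxt s d) u b ℓ ≡
        (if (if b then TA u (ch (el s) d) (el s) else TA u (el s) (ch (el s) d)) then cnt s u b ℓ else 0)
        + bit (not (does (In? ℓ s d)))
    st      : S → Fin k → Status
    st-nxt  : ∀ s d u → st (nxt s d) u ≡
      update-status (st s u) (TA u (el s) (ch (el s) d)) (TA u (ch (el s) d) (el s))

-- The automaton: canonical elements, counters and steps

table-cong : ∀ e {f g} → (∀ v → f v ≡ g v) → table e f ≡ table e g
table-cong zero    eq = cong (_∷ []) (eq [])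
table-cong (suc e) eq = cong₂ Vec._++_ (table-cong e (eq ∘ (false ∷_)))
  (cong (Vec._++ []) (table-cong e (eq ∘ (true ∷_))))

clamp : ∀ M → ℕ → Fin (suc M)
clamp M x = Fin.fromℕ< (s≤s (m⊓n≤n x M))

toℕ-clamp : ∀ {M x} → x ≤ M → toℕ (clamp M x) ≡ x
toℕ-clamp {M} x≤M = trans (Finₚ.toℕ-fromℕ< _) (m≤n⇒m⊓n≡m x≤M)

code-BoundedList : ∀ {k} m → Code (Vec (Maybe (Fin k) × Bool) m) (m * (k + 1))
code-BoundedList {k} m = code-Vec (code-× (code-MaybeFin k) code-Bool) m

toEntries : ∀ {k} m → List (Fin k × Bool) → Vec (Maybe (Fin k) × Bool) m
toEntries m l = fit (nothing , false) m (Vec.fromList (List.map (λ { (u , b) → just u , b }) l))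

fromEntries : ∀ {k m} → Vec (Maybe (Fin k) × Bool) m → List (Fin k × Bool)
fromEntries []                  = []
fromEntries ((just u , b) ∷ v)  = (u , b) ∷ fromEntries v
fromEntries ((nothing , _) ∷ v) = fromEntries v

fromEntries-toEntries : ∀ {k} m (l : List (Fin k × Bool)) → length l ≤ m → fromEntries (toEntries m l) ≡ l
fromEntries-toEntries zero    []      _       = refl
fromEntries-toEntries (suc m) []      _       = fromEntries-toEntries m [] z≤n
fromEntries-toEntries (suc m) (x ∷ l) (s≤s p) = cong (x ∷_) (fromEntries-toEntries m l p)

module BaseStates (𝔐 : Model) {Q : ℕ} (tp : Fin (Model.n 𝔐) → Vec Bool Q)
  (tp-refl : ∀ {a a′} → tp a ≡ tp a′ → ∀ u → Model.TA 𝔐 u a a ≡ true → Model.TA 𝔐 u a′ a′ ≡ true)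
  (D : ℕ) (ch : Fin (Model.n 𝔐) → Fin D → Fin (Model.n 𝔐)) where

  open Model 𝔐
  open Structures 𝔐 using (A)
  open Runs 𝔐 tp

  -- In `M` the product bounds the measure of a living run, with `suc N` for each position. The `2`
  -- pays for a step counted when the run breaks and one counted when it is born again.
  N J₀ M : ℕ
  N  = 2 ^ Q
  J₀ = length allW
  M  = suc J₀ * suc N + 2

  -- What the exchange of an element must respect: its type and, for every prefix, the types above
  -- it, the types in its clique, and whether it is maximal.
  Profile : Set
  Profile = Vec Bool Q × Vec (Vec Bool N × (Vec Bool N × Bool)) (suc J₀)

  opaque
   code-Profile : Code Profile (Q + suc J₀ * (N + (N + 1)))
   code-Profile = code-× code-Bits (code-Vec (code-× code-Bits (code-× code-Bits code-Bool)) (suc J₀))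

  opaque
    entry : List W → A → ℕ → Vec Bool N × (Vec Bool N × Bool)
    entry ω a i = table Q (Up (take i ω) a) , table Q (Clique (take i ω) a)
                , does (IsMax? (take i ω) a)

  opaque
    unfolding entry
    profile : List W → A → Profile
    profile ω a = tp a , tabulate (λ i → entry ω a (toℕ i))

    profile-tp : ∀ {ω a a′} → profile ω a ≡ profile ω a′ → tp a ≡ tp a′
    profile-tp eq = cong proj₁ eq

    profile-entry : ∀ {ω a a′ i} → profile ω a ≡ profile ω a′ → i ≤ J₀ → entry ω a i ≡ entry ω a′ i
    profile-entry {ω} {a} {a′} {i} eq i≤ = subst (λ z → entry ω a z ≡ entry ω a′ z) (Finₚ.toℕ-fromℕ< (s≤s i≤))
        (trans (sym (Vecₚ.lookup∘tabulate (λ i → entry ω a (toℕ i)) (Fin.fromℕ< (s≤s i≤))))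
          (trans (cong (λ p → lookup (proj₂ p) (Fin.fromℕ< (s≤s i≤))) eq)
            (Vecₚ.lookup∘tabulate (λ i → entry ω a′ (toℕ i)) (Fin.fromℕ< (s≤s i≤)))))

    profile-Up : ∀ {ω a a′ i} → profile ω a ≡ profile ω a′ → i ≤ J₀ →
      ∀ τ → Up (take i ω) a τ ≡ Up (take i ω) a′ τ
    profile-Up {ω} {a} {a′} {i} eq i≤ = table-injective Q {Up (take i ω) a} {Up (take i ω) a′}
      (cong proj₁ (profile-entry eq i≤))

    profile-Clique : ∀ {ω a a′ i} → profile ω a ≡ profile ω a′ → i ≤ J₀ →
      table Q (Clique (take i ω) a) ≡ table Q (Clique (take i ω) a′)
    profile-Clique eq i≤ = cong (proj₁ ∘ proj₂) (profile-entry eq i≤)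

    profile-max : ∀ {ω a a′ i} → profile ω a ≡ profile ω a′ → i ≤ J₀ →
      IsMax (take i ω) a → IsMax (take i ω) a′
    profile-max {ω} {a} {a′} {i} eq i≤ mx = does-true (IsMax? (take i ω) a′)
      (trans (sym (cong (proj₂ ∘ proj₂) (profile-entry eq i≤))) (dec-true (IsMax? (take i ω) a) mx))

  opaque
    find : List W → Profile → A
    find ω b with Finₚ.any? (λ a → code-≟ code-Profile (profile ω a) b)
    ... | yes (a , _) = a
    ... | no  _       = a₀

    profile-find : ∀ ω a → profile ω (find ω (profile ω a)) ≡ profile ω a
    profile-find ω a with Finₚ.any? (λ c → code-≟ code-Profile (profile ω c) (profile ω a))
    ... | yes (_ , p) = p
    ... | no ¬p       = ⊥-elim (¬p (a , refl))

  Counts : Set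
  Counts = Vec (Vec (Vec (Fin (suc M)) (suc J₀)) 2) k

  side : Bool → Fin 2
  side false = zero
  side true  = suc zero

  get : Counts → W → ℕ → ℕ
  get t (u , b) ℓ = toℕ (lookup (lookup (lookup t u) (side b)) (clamp J₀ ℓ))

  row : (W → ℕ → ℕ) → W → Vec (Fin (suc M)) (suc J₀)
  row f w = tabulate λ ℓ → clamp M (f w (toℕ ℓ))

  put : (W → ℕ → ℕ) → Counts
  put f = tabulate λ u → row f (u , false) ∷ row f (u , true) ∷ []

  get-row : ∀ f w {ℓ} → ℓ ≤ J₀ → f w ℓ ≤ M → toℕ (lookup (row f w) (clamp J₀ ℓ)) ≡ f w ℓ
  get-row f w {ℓ} ℓ≤ b = trans (cong toℕ (Vecₚ.lookup∘tabulate (λ ℓ → clamp M (f w (toℕ ℓ))) (clamp J₀ ℓ)))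
    (trans (cong (λ z → toℕ (clamp M (f w z))) (toℕ-clamp ℓ≤)) (toℕ-clamp b))

  get-put : ∀ f w {ℓ} → ℓ ≤ J₀ → f w ℓ ≤ M → get (put f) w ℓ ≡ f w ℓ
  get-put f (u , b) {ℓ} ℓ≤ le = trans
    (cong (λ v → toℕ (lookup (lookup v (side b)) (clamp J₀ ℓ)))
      (Vecₚ.lookup∘tabulate (λ u → row f (u , false) ∷ row f (u , true) ∷ []) u))
    (go b le)
    where
    go : ∀ b → f (u , b) ℓ ≤ M →
      toℕ (lookup (lookup (row f (u , false) ∷ row f (u , true) ∷ []) (side b)) (clamp J₀ ℓ)) ≡ f (u , b) ℓ
    go false = get-row f (u , false) ℓ≤
    go true  = get-row f (u , true) ℓ≤

  -- Bounds the number of steps of level ℓ still possible in the run of w; a dead run may still be born.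
  opaque
    measure : List W → A → W → ℕ → ℕ
    measure ω a w ℓ with w ∈? ω
    ... | yes _ = position w ω * suc N + ones Q (Up (take (suc (J₀ ∸ ℓ)) ω) a)
    ... | no  _ = suc (suc J₀ * suc N)

    measure-alive : ∀ {ω a w ℓ} → w ∈ ω →
      measure ω a w ℓ ≡ position w ω * suc N + ones Q (Up (take (suc (J₀ ∸ ℓ)) ω) a)
    measure-alive {ω} {a} {w} w∈ with w ∈? ω
    ... | yes _ = refl
    ... | no ¬p = ⊥-elim (¬p w∈)

    measure-dead : ∀ {ω a w ℓ} → ¬ (w ∈ ω) → measure ω a w ℓ ≡ suc (suc J₀ * suc N)
    measure-dead {ω} {a} {w} w∉ with w ∈? ω
    ... | yes p = ⊥-elim (w∉ p)
    ... | no _  = refl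

  -- By `canonical` the profile determines the element, so the code of a state does not depend on
  -- the size of the model. All conditions are decidable, hence they can be recovered from the
  -- irrelevant field of `Base`, and decoding can test them.
  record Inv (ω : List W) (a : A) (t : Counts) : Set where
    field
      canonical : find ω (profile ω a) ≡ a
      unique    : Unique ω
      maxima    : ∀ (i : Fin (suc J₀)) → IsMax (take (toℕ i) ω) a
      bounded   : ∀ u (ℓ : Fin (suc J₀)) → get t (u , false) (toℕ ℓ) + measure ω a (u , false) (toℕ ℓ) ≤ M
                                          × get t (u , true) (toℕ ℓ) + measure ω a (u , true) (toℕ ℓ) ≤ M

  Inv? : ∀ ω a t → Dec (Inv ω a t)
  Inv? ω a t = map′
    (λ { (p , q , r , s) → record { canonical = p ; unique = q ; maxima = r ; bounded = s } })
    (λ i → Inv.canonical i , Inv.unique i , Inv.maxima i , Inv.bounded i)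
    ((_ Fin.≟ _) ×-dec unique? ω ×-dec Finₚ.all? (λ i → IsMax? _ a)
      ×-dec Finₚ.all? (λ u → Finₚ.all? λ ℓ → (_ ≤? M) ×-dec (_ ≤? M)))
    where open import Data.List.Relation.Unary.Unique.DecPropositional _≟W_ using (unique?)

  record Base : Set where
    constructor base
    field
      ω    : List W
      el   : A
      sts  : Vec Status k
      cnts : Counts
      .inv : Inv ω el cnts

  open Base public

  invariant : ∀ s → Inv (ω s) (el s) (cnts s)
  invariant (base w a v t i) = recompute (Inv? w a t) i

  length-ω : ∀ s → length (ω s) ≤ J₀
  length-ω s = unique-length (Inv.unique (invariant s)) ∈-allW

  max-at : ∀ s {i} → i ≤ J₀ → IsMax (take i (ω s)) (el s)
  max-at s {i} i≤ = subst (λ z → IsMax (take z (ω s)) (el s)) (toℕ-clamp i≤) (Inv.maxima (invariant s) (clamp J₀ i))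

  bounded-at : ∀ s w {ℓ} → ℓ ≤ J₀ → get (cnts s) w ℓ + measure (ω s) (el s) w ℓ ≤ M
  bounded-at s (u , false) {ℓ} ℓ≤ = subst (λ z → get (cnts s) (u , false) z + measure (ω s) (el s) (u , false) z ≤ M)
    (toℕ-clamp ℓ≤) (proj₁ (Inv.bounded (invariant s) u (clamp J₀ ℓ)))
  bounded-at s (u , true) {ℓ} ℓ≤ = subst (λ z → get (cnts s) (u , true) z + measure (ω s) (el s) (u , true) z ≤ M)
    (toℕ-clamp ℓ≤) (proj₂ (Inv.bounded (invariant s) u (clamp J₀ ℓ)))

  mkInv : ∀ {ω a t} → find ω (profile ω a) ≡ a → Unique ω → (∀ {i} → i ≤ J₀ → IsMax (take i ω) a) →
    (∀ w {ℓ} → ℓ ≤ J₀ → get t w ℓ + measure ω a w ℓ ≤ M) → Inv ω a t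
  mkInv c u m b = record { canonical = c ; unique = u ; maxima = λ i → m (≤-pred (Finₚ.toℕ<n i))
    ; bounded = λ u ℓ → b (u , false) (≤-pred (Finₚ.toℕ<n ℓ)) , b (u , true) (≤-pred (Finₚ.toℕ<n ℓ)) }

  mx : ℕ
  mx = suc J₀ * suc N

  alive-measure : ∀ {ω a w ℓ} → length ω ≤ J₀ → w ∈ ω → measure ω a w ℓ ≤ mx
  alive-measure {ω} {a} {w} {ℓ} len w∈ = ≤-trans (≤-reflexive (measure-alive w∈)) (begin
    position w ω * suc N + ones Q (Up (take (suc (J₀ ∸ ℓ)) ω) a)
      ≤⟨ +-mono-≤ (*-monoˡ-≤ (suc N) (<⇒≤ (≤-trans (position-< w∈) len))) (≤-trans (ones-≤ Q _) (n≤1+n N)) ⟩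
    J₀ * suc N + suc N ≡⟨ +-comm (J₀ * suc N) (suc N) ⟩
    mx ∎)
    where open ≤-Reasoning

  any-measure : ∀ {ω a w ℓ} → length ω ≤ J₀ → measure ω a w ℓ ≤ suc mx
  any-measure {ω} {a} {w} {ℓ} len with w ∈? ω
  ... | yes p = m≤n⇒m≤1+n (alive-measure len p)
  ... | no ¬p = ≤-reflexive (measure-dead ¬p)

  M≡ : M ≡ suc (suc mx)
  M≡ = +-comm mx 2

  initial : Base
  initial = base [] a (Vec.replicate k none) (put (λ _ _ → 0)) (mkInv
      (cong (find []) (profile-find [] a₀))
      [] (λ {i} _ → λ _ _ _ → subst (λ z → RV z _ _) (sym (Listₚ.take-[] i)) [])
      (λ w {ℓ} ℓ≤ → subst (λ z → z + measure [] a w ℓ ≤ M) (sym (get-put (λ _ _ → 0) w ℓ≤ z≤n))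
        (≤-trans (any-measure {[]} {a} {w} {ℓ} z≤n) (≤-trans (n≤1+n (suc mx)) (≤-reflexive (sym M≡))))))
    where
    a = find [] (profile [] a₀)

  Um′ : Fin k → List W → Set
  Um′ u V = (u , false) ∈ V ⊎ (u , true) ∈ V

  Um′? : ∀ u V → Dec (Um′ u V)
  Um′? u V = ((u , false) ∈? V) ⊎-dec ((u , true) ∈? V)

  w∈Um : ∀ {u b V} → (u , b) ∈ V → Um′ u V
  w∈Um {b = false} = inj₁
  w∈Um {b = true}  = inj₂

  module Step (s : Base) (d : Fin D) where
    a b a₁ a′ : A
    a = el s
    b = ch a d

    ω′ : List W
    ω′ = alive (ω s) a b

    a₁ = maximise ω′ J₀ b
    a′ = find ω′ (profile ω′ a₁)

    -- The comparison is with `a₁`, not with the new element `a′`: the latter shares only the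
    -- profile of `a₁` and may lie anywhere in the model.
    P : ℕ → Set
    P j = take j ω′ ≡ take j (ω s) × RV (take j (ω s)) a₁ a × RV (take j (ω s)) a a₁

    P? : ∀ j → Dec (P j)
    P? j = Listₚ.≡-dec _≟W_ _ _ ×-dec RV? _ _ _ ×-dec RV? _ _ _

    P-≤ : ∀ {i j} → i ≤ j → P j → P i
    P-≤ i≤j (e , p , q) = take-≤-≡ ω′ (ω s) i≤j e , All-take-≤ (ω s) i≤j p , All-take-≤ (ω s) i≤j q

    prof : profile ω′ a′ ≡ profile ω′ a₁
    prof = profile-find ω′ a₁

    a′-tp : tp a′ ≡ tp b
    a′-tp = trans (profile-tp prof) (maximise-tp ω′ J₀ b)

    ab : ∀ {j} → take j ω′ ≡ take j (ω s) → RV (take j (ω s)) a b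
    ab {j} e = subst (λ V → RV V a b) e (Allₚ.take⁺ j (alive-all (ω s) a b))

    next : ∀ {j} → j ≤ J₀ → P j → a₁ ≡ b ⊎ RV (take (suc j) ω′) b a₁
    next {j} j≤ (e , a₁a , _) = maximise-still ω′ j≤ (subst (λ V → RV V a b) (sym e) (ab e))
      (subst (λ V → RV V a₁ a) (sym e) a₁a)

    ba : ∀ {j} → j ≤ J₀ → P j → RV (take j (ω s)) b a
    ba {j} j≤ p@(e , a₁a , _) with next j≤ p
    ... | inj₁ q = subst (λ z → RV _ z a) q a₁a
    ... | inj₂ r = RV-trans (subst (λ V → RV V b a₁) e (All-take-≤ ω′ (n≤1+n j) r)) a₁a

    stay : ℕ → Set
    stay zero    = ⊥
    stay (suc ℓ) = P (J₀ ∸ ℓ)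

    stay? : ∀ ℓ → Dec (stay ℓ)
    stay? zero    = no id
    stay? (suc ℓ) = P? (J₀ ∸ ℓ)

    -- Only steps inside level `suc ℓ` and symbols outside its prefix matter for `cnt-nxt`; in all
    -- other cases the counter is reset, which keeps it bounded.
    new-count : ∀ w ℓ → Dec (P (J₀ ∸ ℓ)) → Dec (Um′ (proj₁ w) (take (J₀ ∸ ℓ) (ω s))) → Bool → ℕ
    new-count w ℓ (no _)  _       _ = 0
    new-count w ℓ (yes _) (yes _) _ = 0
    new-count w ℓ (yes _) (no _)  t = (if t then get (cnts s) w ℓ else 0) + bit (not (does (stay? ℓ)))

    new-count-live : ∀ w ℓ p? um? t → P (J₀ ∸ ℓ) → ¬ Um′ (proj₁ w) (take (J₀ ∸ ℓ) (ω s)) →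
      new-count w ℓ p? um? t ≡ (if t then get (cnts s) w ℓ else 0) + bit (not (does (stay? ℓ)))
    new-count-live w ℓ (yes _) (no _)   t p ¬um = refl
    new-count-live w ℓ (yes _) (yes um) t p ¬um = ⊥-elim (¬um um)
    new-count-live w ℓ (no ¬p) _        t p ¬um = ⊥-elim (¬p p)

    count : W → ℕ → ℕ
    count w ℓ = new-count w ℓ (P? (J₀ ∸ ℓ)) (Um′? (proj₁ w) (take (J₀ ∸ ℓ) (ω s))) (TW w a b)

    ω′-unique : Unique ω′
    ω′-unique = alive-unique (ω s) a b (Inv.unique (invariant s))

    ω′-length : length ω′ ≤ J₀
    ω′-length = unique-length ω′-unique ∈-allW

    bit≤1 : ∀ x → bit x ≤ 1
    bit≤1 true  = ≤-refl
    bit≤1 false = z≤n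

    drop-measure : ∀ w {ℓ} → ℓ ≤ J₀ → P (J₀ ∸ ℓ) → ¬ Um′ (proj₁ w) (take (J₀ ∸ ℓ) (ω s)) →
      w ∈ ω s → TW w a b ≡ true → bit (not (does (stay? ℓ))) + measure ω′ a′ w ℓ ≤ measure (ω s) a w ℓ
    drop-measure w {ℓ} ℓ≤ p ¬um w∈ t = subst₂ (λ x y → bit (not (does (stay? ℓ))) + x ≤ y)
      (sym (measure-alive (alive-∈ (ω s) a b t))) (sym (measure-alive w∈)) main
      where
      open ≤-Reasoning
      pos = position w (ω s)
      pos′ = position w ω′
      ap = alive-position (ω s) a b w∈ t
      w∉ : ¬ (w ∈ take (J₀ ∸ ℓ) (ω s))
      w∉ = ¬um ∘ w∈Um
      r  = ones Q (Up (take (suc (J₀ ∸ ℓ)) (ω s)) a)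
      r′ = ones Q (Up (take (suc (J₀ ∸ ℓ)) ω′) a′)
      -- An older symbol has died. The gain of `suc N` pays for an arbitrary new set of types and
      -- for the step itself.
      moved : pos′ < pos → ∀ x → x ≤ 1 → x + (pos′ * suc N + r′) ≤ pos * suc N + r
      moved lt x x≤ = begin
        x + (pos′ * suc N + r′)   ≤⟨ +-mono-≤ x≤ (+-monoʳ-≤ (pos′ * suc N) (ones-≤ Q _)) ⟩
        1 + (pos′ * suc N + N)    ≡⟨ sym (+-suc (pos′ * suc N) N) ⟩
        pos′ * suc N + suc N      ≡⟨ +-comm (pos′ * suc N) (suc N) ⟩
        suc pos′ * suc N          ≤⟨ *-monoˡ-≤ (suc N) lt ⟩
        pos * suc N               ≤⟨ m≤m+n _ r ⟩
        pos * suc N + r ∎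
      main : bit (not (does (stay? ℓ))) + (pos′ * suc N + r′) ≤ pos * suc N + r
      main with m≤n⇒m<n∨m≡n (proj₁ ap)
      ... | inj₁ lt = moved lt (bit (not (does (stay? ℓ)))) (bit≤1 (not (does (stay? ℓ))))
      ... | inj₂ eq = same ℓ refl (stay? ℓ)
        where
        same : ∀ ℓ′ → ℓ′ ≡ ℓ → (dec : Dec (stay ℓ′)) → bit (not (does dec)) + (pos′ * suc N + r′) ≤ pos * suc N + r
        -- At level zero the prefix is the whole list, so no living symbol lies outside it.
        same zero refl _ = ⊥-elim (w∉ (subst (w ∈_) (sym (Listₚ.take-all J₀ (ω s) (length-ω s))) w∈))
        same (suc ℓ″) refl dec = go dec
          where
          sj : suc (J₀ ∸ suc ℓ″) ≡ J₀ ∸ ℓ″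
          sj = sym (+-∸-assoc 1 ℓ≤)
          j≤ : suc (J₀ ∸ suc ℓ″) ≤ J₀
          j≤ = ≤-trans (≤-reflexive sj) (m∸n≤m J₀ ℓ″)
          tk : take (suc (J₀ ∸ suc ℓ″)) ω′ ≡ take (suc (J₀ ∸ suc ℓ″)) (ω s)
          tk = take-≤-≡ ω′ (ω s) (s≤s (position-∉take (ω s) _ w∈ w∉)) (proj₂ ap eq)
          V = take (suc (J₀ ∸ suc ℓ″)) (ω s)
          r′≡ : r′ ≡ ones Q (Up V a₁)
          r′≡ = trans (ones-cong Q (profile-Up prof j≤)) (cong (λ z → ones Q (Up z a₁)) tk)
          go : (dec : Dec (P (J₀ ∸ ℓ″))) → bit (not (does dec)) + (pos′ * suc N + r′) ≤ pos * suc N + r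
          go (yes q) = +-mono-≤ (*-monoˡ-≤ (suc N) (proj₁ ap)) (≤-trans (≤-reflexive r′≡)
            (ones-mono Q (Up-mono {V} (proj₂ (proj₂ (subst P (sym sj) q))))))
          -- The step follows the prefix longer by one symbol upwards without staying in its clique:
          -- it is strict, and a type is lost.
          go (no ¬q) = ≤-trans (≤-reflexive (sym (+-suc (pos′ * suc N) r′)))
            (+-mono-≤ (*-monoˡ-≤ (suc N) (proj₁ ap)) (≤-trans (s≤s (≤-reflexive r′≡))
              (Up-strict (max-at s j≤) aa₁ (λ a₁a → ¬q (subst P sj (tk , a₁a , aa₁))))))
            where
            aa₁ : RV V a a₁
            aa₁ with next (≤-trans (n≤1+n _) j≤) p
            ... | inj₁ e = subst (RV V a) (sym e) (ab tk)
            ... | inj₂ q = RV-trans (ab tk) (subst (λ z → RV z b a₁) tk q)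

    new-count-bound : ∀ w {ℓ} → ℓ ≤ J₀ → ∀ p? um? t → TW w a b ≡ t → Dec (w ∈ ω s) →
      new-count w ℓ p? um? t + measure ω′ a′ w ℓ ≤ M
    new-count-bound w {ℓ} ℓ≤ (no _) _ _ _ _ =
      ≤-trans (any-measure ω′-length) (≤-trans (n≤1+n (suc mx)) (≤-reflexive (sym M≡)))
    new-count-bound w {ℓ} ℓ≤ (yes _) (yes _) _ _ _ =
      ≤-trans (any-measure ω′-length) (≤-trans (n≤1+n (suc mx)) (≤-reflexive (sym M≡)))
    new-count-bound w {ℓ} ℓ≤ (yes p) (no ¬um) false eq _ =
      ≤-trans (+-mono-≤ (bit≤1 (not (does (stay? ℓ)))) (any-measure ω′-length)) (≤-reflexive (sym M≡))
    new-count-bound w {ℓ} ℓ≤ (yes p) (no ¬um) true eq (yes w∈) = begin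
      (get (cnts s) w ℓ + bit (not (does (stay? ℓ)))) + measure ω′ a′ w ℓ
        ≡⟨ +-assoc (get (cnts s) w ℓ) (bit (not (does (stay? ℓ)))) (measure ω′ a′ w ℓ) ⟩
      get (cnts s) w ℓ + (bit (not (does (stay? ℓ))) + measure ω′ a′ w ℓ)
        ≤⟨ +-monoʳ-≤ (get (cnts s) w ℓ) (drop-measure w ℓ≤ p ¬um w∈ eq) ⟩
      get (cnts s) w ℓ + measure (ω s) a w ℓ
        ≤⟨ bounded-at s w ℓ≤ ⟩
      M ∎
      where open ≤-Reasoning
    new-count-bound w {ℓ} ℓ≤ (yes p) (no ¬um) true eq (no w∉) =
      ≤-trans (+-mono-≤ (+-mono-≤ get≤1 (bit≤1 (not (does (stay? ℓ)))))
        (alive-measure ω′-length (alive-∈ (ω s) a b eq))) (≤-reflexive (sym M≡))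
      where
      get≤1 : get (cnts s) w ℓ ≤ 1
      get≤1 = +-cancelʳ-≤ (suc mx) (get (cnts s) w ℓ) 1
        (≤-trans (≤-reflexive (cong (get (cnts s) w ℓ +_) (sym (measure-dead {ω s} {a} {w} {ℓ} w∉))))
          (≤-trans (bounded-at s w ℓ≤) (≤-reflexive M≡)))

    count-bound : ∀ w {ℓ} → ℓ ≤ J₀ → count w ℓ + measure ω′ a′ w ℓ ≤ M
    count-bound w {ℓ} ℓ≤ = new-count-bound w ℓ≤ (P? (J₀ ∸ ℓ)) (Um′? (proj₁ w) (take (J₀ ∸ ℓ) (ω s)))
      (TW w a b) refl (w ∈? ω s)

    count≤M : ∀ w {ℓ} → ℓ ≤ J₀ → count w ℓ ≤ M
    count≤M w ℓ≤ = ≤-trans (m≤m+n _ _) (count-bound w ℓ≤)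

    step : Base
    step = base ω′ a′ (tabulate λ u → update-status (lookup (sts s) u) (TA u a b) (TA u b a)) (put count)
      (mkInv (cong (find ω′) prof) ω′-unique
        (λ i≤ → profile-max (sym prof) i≤ (maximise-max ω′ b i≤))
        (λ w {ℓ} ℓ≤ → subst (λ z → z + measure ω′ a′ w ℓ ≤ M) (sym (get-put count w ℓ≤ (count≤M w ℓ≤))) (count-bound w ℓ≤)))

  open Step public using (step)

  -- All shorter prefixes are compared as well, so that the relation passes to the next level.
  -- Reflexivity puts each element into its own clique, so its type is among those realised there.
  Tot : ℕ → Base → Base → Set
  Tot zero    s t = ⊥
  Tot (suc ℓ) s t = take (J₀ ∸ ℓ) (ω s) ≡ take (J₀ ∸ ℓ) (ω t)
    × RV (take (J₀ ∸ ℓ) (ω s)) (el s) (el s) × RV (take (J₀ ∸ ℓ) (ω t)) (el t) (el t)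
    × (∀ (i : Fin (suc (J₀ ∸ ℓ))) → table Q (Clique (take (toℕ i) (ω s)) (el s)) ≡ table Q (Clique (take (toℕ i) (ω t)) (el t)))

  Tot? : ∀ ℓ s t → Dec (Tot ℓ s t)
  Tot? zero    s t = no id
  Tot? (suc ℓ) s t = Listₚ.≡-dec _≟W_ _ _ ×-dec RV? _ _ _ ×-dec RV? _ _ _ ×-dec Finₚ.all? (λ i → _ ≟ᵛ _)

  Um : ℕ → Fin k → Base → Set
  Um zero    u s = ⊥
  Um (suc ℓ) u s = Um′ u (take (J₀ ∸ ℓ) (ω s))

  Um? : ∀ ℓ u s → Dec (Um ℓ u s)
  Um? zero    u s = no id
  Um? (suc ℓ) u s = Um′? u _

  Um-suc : ∀ {ℓ u s} → Um (suc (suc ℓ)) u s → Um (suc ℓ) u s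
  Um-suc {ℓ} {u} {s} = [ inj₁ ∘ up , inj₂ ∘ up ]′
    where
    up : ∀ {w} → w ∈ take (J₀ ∸ suc ℓ) (ω s) → w ∈ take (J₀ ∸ ℓ) (ω s)
    up = ∈-take-≤ (ω s) (∸-monoʳ-≤ J₀ (n≤1+n ℓ))

  Tot-sym : ∀ {ℓ s t} → Tot ℓ s t → Tot ℓ t s
  Tot-sym {suc ℓ} (e , p , q , c) = sym e , q , p , λ i → sym (c i)

  Tot-trans : ∀ {ℓ s t r} → Tot ℓ s t → Tot ℓ t r → Tot ℓ s r
  Tot-trans {suc ℓ} (e , p , _ , c) (e′ , _ , q , c′) = trans e e′ , p , q , λ i → trans (c i) (c′ i)

  clique-at : ∀ {ℓ s t i} → Tot (suc ℓ) s t → i ≤ J₀ ∸ ℓ →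
    table Q (Clique (take i (ω s)) (el s)) ≡ table Q (Clique (take i (ω t)) (el t))
  clique-at {ℓ} {s} {t} {i} (_ , _ , _ , c) i≤ = subst
    (λ z → table Q (Clique (take z (ω s)) (el s)) ≡ table Q (Clique (take z (ω t)) (el t)))
    (toℕ-clamp i≤) (c (clamp (J₀ ∸ ℓ) i))

  Tot-suc : ∀ {ℓ s t} → Tot (suc ℓ) s t → Tot (suc (suc ℓ)) s t
  Tot-suc {ℓ} {s} {t} T@(e , p , q , c) = take-≤-≡ (ω s) (ω t) le e , All-take-≤ (ω s) le p , All-take-≤ (ω t) le q ,
    λ i → clique-at {ℓ} {s} {t} T (≤-trans (≤-pred (Finₚ.toℕ<n i)) le)
    where
    le : J₀ ∸ suc ℓ ≤ J₀ ∸ ℓ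
    le = ∸-monoʳ-≤ J₀ (n≤1+n ℓ)

  Tot-Um : ∀ {ℓ s t u} → Tot ℓ s t → Um ℓ u s → Um ℓ u t
  Tot-Um {suc ℓ} {u = u} (e , _) = subst (Um′ u) e

  RV-refl-tp : ∀ {V a a′} → tp a ≡ tp a′ → RV V a a → RV V a′ a′
  RV-refl-tp t = All.map (λ { {u , false} → tp-refl t u ; {u , true} → tp-refl t u })

  stay-Tot : ∀ {ℓ s d} → Step.stay s d ℓ → Tot ℓ s (step s d)
  stay-Tot {suc ℓ} {s} {d} p@(e , a₁a , aa₁) = sym e , RV-trans aa₁ a₁a ,
    RV-refl-tp (profile-tp (sym prof)) (subst (λ V → RV V a₁ a₁) (sym e) (RV-trans a₁a aa₁)) ,
    λ i → let i≤ = ≤-pred (Finₚ.toℕ<n i)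
              (eᵢ , pᵢ , qᵢ) = P-≤ i≤ p in
      trans (table-cong Q (Clique-cong qᵢ pᵢ))
        (trans (cong (λ V → table Q (Clique V a₁)) (sym eᵢ))
          (profile-Clique (sym prof) (≤-trans i≤ (m∸n≤m J₀ ℓ))))
    where open Step s d

  RV-Um : ∀ {V a b u} → RV V a b → RV V b a → Um′ u V → TA u a b ≡ true
  RV-Um p q (inj₁ i) = All.lookup p i
  RV-Um p q (inj₂ i) = All.lookup q i

  stay-edge : ∀ {ℓ s d u} → Step.stay s d ℓ → Um ℓ u s →
    TA u (el s) (ch (el s) d) ≡ true × TA u (ch (el s) d) (el s) ≡ true
  stay-edge {suc ℓ} {s} {d} p um = RV-Um ab′ ba′ um , RV-Um ba′ ab′ um
    where
    open Step s d
    ab′ = ab (proj₁ p)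
    ba′ = ba (m∸n≤m J₀ ℓ) p

  module Hub (ℓ : ℕ) where
    V : Base → List W
    V s = take (J₀ ∸ ℓ) (ω s)

    centre : List W → Vec Bool N → A
    centre X c with Finₚ.any? (λ x → table Q (Clique X x) ≟ᵛ c)
    ... | yes (x , _) = x
    ... | no  _       = a₀

    centre-spec : ∀ X a → table Q (Clique X (centre X (table Q (Clique X a)))) ≡ table Q (Clique X a)
    centre-spec X a with Finₚ.any? (λ x → table Q (Clique X x) ≟ᵛ table Q (Clique X a))
    ... | yes (_ , p) = p
    ... | no ¬p       = ⊥-elim (¬p (a , refl))

    -- The choice depends only on the prefix and on the table of realised types. Totally related
    -- states thus share one clique of the model, and each of them finds an element of its own type
    -- in it.
    c₀ : Base → A
    c₀ s = centre (V s) (table Q (Clique (V s) (el s)))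

    place : (s : Base) → Dec (∃ λ c → RV (V s) (c₀ s) c × RV (V s) c (c₀ s) × tp c ≡ tp (el s)) → A
    place s (yes (c , _)) = c
    place s (no _)        = el s

    place? : (s : Base) → Dec (∃ λ c → RV (V s) (c₀ s) c × RV (V s) c (c₀ s) × tp c ≡ tp (el s))
    place? s = Finₚ.any? (λ c → RV? _ _ _ ×-dec RV? _ _ _ ×-dec (_ ≟t _))

    place-tp : ∀ s d → tp (place s d) ≡ tp (el s)
    place-tp s (yes (_ , _ , _ , t)) = t
    place-tp s (no _) = refl

    place-RV : ∀ s → RV (V s) (el s) (el s) → ∀ d → RV (V s) (c₀ s) (place s d) × RV (V s) (place s d) (c₀ s)
    place-RV s r (yes (_ , p , q , _)) = p , q
    place-RV s r (no ¬p) = ⊥-elim (¬p (does-true (place? s)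
      (trans (table-injective Q {Clique (V s) (c₀ s)} {Clique (V s) (el s)} (centre-spec (V s) (el s)) (tp (el s)))
        (dec-true (Finₚ.any? (λ c → RV? (V s) (el s) c ×-dec RV? (V s) c (el s) ×-dec (tp c ≟t tp (el s))))
          (el s , r , r , refl)))))

    hub : Σ (Base → A) λ c → (∀ s → tp (c s) ≡ tp (el s)) ×
      (∀ {s t u} → Tot (suc ℓ) s t → Um (suc ℓ) u s → TA u (c s) (c t) ≡ true)
    hub = (λ s → place s (place? s)) , (λ s → place-tp s (place? s)) , prf
      where
      prf : ∀ {s t u} → Tot (suc ℓ) s t → Um (suc ℓ) u s → TA u (place s (place? s)) (place t (place? t)) ≡ true
      prf {s} {t} T@(e , p , q , c) um =
        let cs , sc = place-RV s p (place? s)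
            ct , tc = place-RV t q (place? t)
            same : c₀ s ≡ c₀ t
            same = cong₂ centre e (clique-at {ℓ} {s} {t} T ≤-refl)
            ct′ = subst₂ (λ X z → RV X z _) (sym e) (sym same) ct
            tc′ = subst₂ (λ X z → RV X _ z) (sym e) (sym same) tc
        in RV-Um (RV-trans sc ct′) (RV-trans tc′ cs) um

  Raw : Set
  Raw = Vec (Maybe (Fin k) × Bool) J₀ × Profile × Vec Status k × Counts

  e₀ : ℕ
  e₀ = J₀ * (k + 1) + ((Q + suc J₀ * (N + (N + 1))) + (k * 3 + k * (2 * (suc J₀ * M))))

  code-Raw : Code Raw e₀
  code-Raw = code-× (code-BoundedList J₀) (code-× code-Profile
    (code-× (code-Vec code-Status k) (code-Vec (code-Vec (code-Vec (code-Fin M) (suc J₀)) 2) k)))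

  code-Base : Code Base e₀
  code-Base = code-retract code-Raw to from from-to
    where
    to : Base → Raw
    to s = toEntries J₀ (ω s) , profile (ω s) (el s) , sts s , cnts s
    build : (w : List W) (a : A) (v : Vec Status k) (t : Counts) → Dec (Inv w a t) → Base
    build w a v t (yes i) = base w a v t i
    build w a v t (no _)  = initial
    from : Raw → Base
    from (v , p , ss , t) = build (fromEntries v) (find (fromEntries v) p) ss t (Inv? _ _ _)
    build-self : ∀ s (i : Dec (Inv (ω s) (el s) (cnts s))) → build (ω s) (el s) (sts s) (cnts s) i ≡ s
    build-self s (yes _) = refl
    build-self s (no ¬i) = ⊥-elim (¬i (invariant s))
    from-to : ∀ s → from (to s) ≡ s
    from-to s = trans (go (fromEntries-toEntries J₀ (ω s) (length-ω s)) (Inv.canonical (invariant s))) (build-self s (Inv? _ _ _))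
      where
      go : ∀ {w a} → w ≡ ω s → find (ω s) (profile (ω s) (el s)) ≡ a →
        build w (find w (profile (ω s) (el s))) (sts s) (cnts s) (Inv? _ _ _) ≡ build (ω s) a (sts s) (cnts s) (Inv? _ _ _)
      go refl refl = refl

  auto : Auto 𝔐 tp
  auto = record
    { S = Base ; e₀ = e₀ ; code-S = code-Base ; s₀ = initial ; D = D ; ch = ch ; el = el ; nxt = step
    ; nxt-tp = λ s d → Step.a′-tp s d
    ; J = J₀
    ; In = λ ℓ s d → Step.stay s d ℓ
    ; In? = λ ℓ s d → Step.stay? s d ℓ
    ; In-zero = id
    ; In-suc = λ {ℓ} {s} {d} → In-suc ℓ {s} {d}
    ; In-top = λ s d → subst (Step.P s d) (sym (n∸n≡0 J₀)) (refl , [] , [])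
    ; Um = Um ; Um? = Um? ; Um-suc = λ {ℓ} {u} {s} → Um-suc {ℓ} {u} {s}
    ; Tot = Tot ; Tot? = Tot? ; Tot-zero = id
    ; Tot-sym = λ {ℓ} {s} {t} → Tot-sym {ℓ} {s} {t}
    ; Tot-trans = λ {ℓ} {s} {t} {r} → Tot-trans {ℓ} {s} {t} {r}
    ; Tot-suc = λ {ℓ} {s} {t} → Tot-suc {ℓ} {s} {t}
    ; Tot-Um = λ {ℓ} {s} {t} {u} → Tot-Um {ℓ} {s} {t} {u}
    ; In-Tot = λ {ℓ} {s} {d} → stay-Tot {ℓ} {s} {d}
    ; In-edge = λ {ℓ} {s} {d} {u} → stay-edge {ℓ} {s} {d} {u}
    ; hub = Hub.hub
    ; M = M
    ; cnt = λ s u b → get (cnts s) (u , b)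
    ; cnt≤M = λ s u b ℓ → ≤-pred (Finₚ.toℕ<n (lookup (lookup (lookup (cnts s) u) (side b)) (clamp J₀ ℓ)))
    ; cnt-nxt = λ {ℓ} {s} {d} {u} b → cnt-step {ℓ} {s} {d} {u} b
    ; st = λ s u → lookup (sts s) u
    ; st-nxt = λ s d u → Vecₚ.lookup∘tabulate _ u
    }
    where
    In-suc : ∀ ℓ {s d} → Step.stay s d ℓ → Step.stay s d (suc ℓ)
    In-suc (suc ℓ) {s} {d} = Step.P-≤ s d (∸-monoʳ-≤ J₀ (n≤1+n ℓ))
    cnt-step : ∀ {ℓ s d u} b → ℓ ≤ J₀ → Step.stay s d (suc ℓ) → ¬ Um (suc ℓ) u s →
      get (cnts (step s d)) (u , b) ℓ ≡
        (if (if b then TA u (ch (el s) d) (el s) else TA u (el s) (ch (el s) d)) then get (cnts s) (u , b) ℓ else 0)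
        + bit (not (does (Step.stay? s d ℓ)))
    cnt-step {ℓ} {s} {d} {u} β ℓ≤ p ¬um = trans (get-put count (u , β) ℓ≤ (count≤M (u , β) ℓ≤)) (go β)
      where
      open Step s d
      go : ∀ b′ → count (u , b′) ℓ ≡ (if (if b′ then TA u (ch (el s) d) (el s) else TA u (el s) (ch (el s) d))
             then get (cnts s) (u , b′) ℓ else 0) + bit (not (does (stay? ℓ)))
      go true  = new-count-live (u , true)  ℓ (P? (J₀ ∸ ℓ)) (Um′? u _) _ p ¬um
      go false = new-count-live (u , false) ℓ (P? (J₀ ∸ ℓ)) (Um′? u _) _ p ¬um

-- Cyclic colours, levels, and the colours needed by a path

iter : ∀ {X : Set} → (X → X) → ℕ → X → X
iter f zero    x = x
iter f (suc n) x = iter f n (f x)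

dropLast : ∀ {X : Set} {m} → Vec X (suc m) → Vec X m
dropLast {m = zero}  _       = []
dropLast {m = suc m} (x ∷ v) = x ∷ dropLast v

module Cyclic (L₀ : ℕ) where

  private
    step? : (i : ℕ) → Dec (i < L₀) → Fin (suc L₀)
    step? i (yes p) = Fin.fromℕ< (s≤s p)
    step? i (no _)  = zero

  next prev : Fin (suc L₀) → Fin (suc L₀)
  next i = step? (toℕ i) (suc (toℕ i) ≤? L₀)
  prev zero    = Fin.fromℕ L₀
  prev (suc i) = Fin.inject₁ i

  private
    last : ∀ (i : Fin (suc L₀)) → ¬ (toℕ i < L₀) → toℕ i ≡ L₀
    last i ¬p = ≤-antisym (≤-pred (Finₚ.toℕ<n i)) (≮⇒≥ ¬p)

  prev-next : ∀ i → prev (next i) ≡ i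
  prev-next i with suc (toℕ i) ≤? L₀
  ... | yes p = Finₚ.toℕ-injective (trans (Finₚ.toℕ-inject₁ (Fin.fromℕ< p)) (Finₚ.toℕ-fromℕ< p))
  ... | no ¬p = Finₚ.toℕ-injective (trans (Finₚ.toℕ-fromℕ L₀) (sym (last i ¬p)))

  next-prev : ∀ i → next (prev i) ≡ i
  next-prev zero with suc (toℕ (Fin.fromℕ L₀)) ≤? L₀
  ... | yes p = ⊥-elim (<-irrefl (Finₚ.toℕ-fromℕ L₀) p)
  ... | no _  = refl
  next-prev (suc i) with suc (toℕ (Fin.inject₁ i)) ≤? L₀
  ... | yes p = Finₚ.toℕ-injective (trans (Finₚ.toℕ-fromℕ< (s≤s p)) (cong suc (Finₚ.toℕ-inject₁ i)))
  ... | no ¬p = ⊥-elim (¬p (subst (λ z → suc z ≤ L₀) (sym (Finₚ.toℕ-inject₁ i)) (Finₚ.toℕ<n i)))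

  range : ℕ → Fin (suc L₀) → List (Fin (suc L₀))
  range zero    o = o ∷ []
  range (suc m) o = o ∷ range m (next o)

  length-range : ∀ m o → length (range m o) ≡ suc m
  length-range zero    o = refl
  length-range (suc m) o = cong suc (length-range m (next o))

  iter-prev-suc : ∀ c i → iter prev (suc c) i ≡ prev (iter prev c i)
  iter-prev-suc zero    i = refl
  iter-prev-suc (suc c) i = iter-prev-suc c (prev i)

  ∈-range : ∀ {c m} i → c ≤ m → i ∈ range m (iter prev c i)
  ∈-range {zero}  {zero}  i _ = here refl
  ∈-range {zero}  {suc m} i _ = here refl
  ∈-range {suc c} {suc m} i (s≤s c≤m) = there (subst (λ o → i ∈ range m o)
    (sym (trans (cong next (iter-prev-suc c i)) (next-prev _))) (∈-range i c≤m))

  -- distance from the colour following κ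
  private
    dist? : (κ i : ℕ) → Dec (i ≤ κ) → ℕ
    dist? κ i (yes _) = i + (L₀ ∸ κ)
    dist? κ i (no _)  = i ∸ suc κ

  distance : Fin (suc L₀) → Fin (suc L₀) → ℕ
  distance κ i = dist? (toℕ κ) (toℕ i) (toℕ i ≤? toℕ κ)

  distance-< : ∀ κ i → distance κ i < suc L₀
  distance-< κ i with toℕ i ≤? toℕ κ
  ... | yes p = s≤s (≤-trans (+-monoˡ-≤ (L₀ ∸ toℕ κ) p)
                  (≤-reflexive (m+[n∸m]≡n (≤-pred (Finₚ.toℕ<n κ)))))
  ... | no _ = s≤s (≤-trans (m∸n≤m (toℕ i) (suc (toℕ κ))) (≤-pred (Finₚ.toℕ<n i)))

  distance-next : ∀ κ i → ¬ (i ≡ κ) → distance κ (next i) ≡ suc (distance κ i)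
  distance-next κ i i≢κ with suc (toℕ i) ≤? L₀
  ... | yes p rewrite Finₚ.toℕ-fromℕ< p with toℕ i ≤? toℕ κ | suc (toℕ i) ≤? toℕ κ
  ...   | yes q | yes r = refl
  ...   | yes q | no ¬r = ⊥-elim (i≢κ (Finₚ.toℕ-injective (≤-antisym q (≮⇒≥ ¬r))))
  ...   | no ¬q | yes r = ⊥-elim (¬q (<⇒≤ r))
  ...   | no ¬q | no ¬r = +-∸-assoc 1 (≰⇒> ¬q)
  distance-next κ i i≢κ | no ¬p with toℕ i ≤? toℕ κ
  ...   | yes q = ⊥-elim (i≢κ (Finₚ.toℕ-injective (≤-antisym q
                    (≤-trans (≤-pred (Finₚ.toℕ<n κ)) (≤-reflexive (sym (last i ¬p)))))))
  ...   | no ¬q = trans (+-∸-assoc 1 (≤-trans (≰⇒> ¬q) (≤-reflexive (last i ¬p))))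
                    (cong (λ z → suc (z ∸ suc (toℕ κ))) (sym (last i ¬p)))

module Levels (𝔐 : Model) {Q : ℕ} (tp : Fin (Model.n 𝔐) → Vec Bool Q) (𝔸 : Auto 𝔐 tp) (L₀ : ℕ) where

  open Model 𝔐
  open Structures 𝔐
  open Auto 𝔸 hiding (A)
  open Cyclic L₀

  L : ℕ
  L = suc L₀

  -- The colour of the current component of level `ℓ`, the last `L` exits (place and direction,
  -- newest at the head), and the place inside that component. Nothing forces the three to be
  -- consistent; `walk` will read only a consistent part of the history.
  X : ℕ → Set
  X zero    = S
  X (suc ℓ) = Fin L × Vec (Maybe (X ℓ × Fin D)) L × X ℓ

  base : ∀ ℓ → X ℓ → S
  base zero    s           = s
  base (suc ℓ) (_ , _ , x) = base ℓ x

  root : ∀ ℓ → S → X ℓ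
  root zero    s = s
  root (suc ℓ) s = zero , Vec.replicate L nothing , root ℓ s

  base-root : ∀ ℓ s → base ℓ (root ℓ s) ≡ s
  base-root zero    s = refl
  base-root (suc ℓ) s = base-root ℓ s

  -- meaningful only for steps that stay inside level ℓ
  child : ∀ ℓ → X ℓ → Fin D → X ℓ
  child′ : ∀ ℓ (x : X (suc ℓ)) d → Dec (In ℓ (base (suc ℓ) x) d) → X (suc ℓ)
  child zero    x d = x
  child (suc ℓ) x d = child′ ℓ x d (In? ℓ (base (suc ℓ) x) d)
  child′ ℓ (i , h , x) d (yes _) = i , h , child ℓ x d
  child′ ℓ (i , h , x) d (no _)  = next i , just (x , d) ∷ dropLast h , root ℓ (nxt (base ℓ x) d)

  base-child : ∀ ℓ x d → In ℓ (base ℓ x) d → base ℓ (child ℓ x d) ≡ nxt (base ℓ x) d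
  base-child zero    x d p = ⊥-elim (In-zero p)
  base-child (suc ℓ) y@(i , h , x) d p = go (In? ℓ (base ℓ x) d)
    where
    go : ∀ q → base (suc ℓ) (child′ ℓ y d q) ≡ nxt (base ℓ x) d
    go (yes q) = base-child ℓ x d q
    go (no _)  = base-root ℓ _

  -- The right summand holds leaves: children along steps that leave the level, to be identified at
  -- a higher level with the roots of further components.
  Y : ℕ → Set
  Y ℓ = X ℓ ⊎ (X ℓ × Fin D)

  -- The facts of a piece are those of a centre and its actual children in the model. The state
  -- reached by an inner step carries another element, which agrees with the child only in type.
  val : S → Maybe (Fin D) → A
  val s nothing  = el s
  val s (just d) = ch (el s) d

  mem′ : ∀ ℓ (x : X ℓ) d → Dec (In ℓ (base ℓ x) d) → Y ℓ
  mem′ ℓ x d (yes _) = inj₁ (child ℓ x d)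
  mem′ ℓ x d (no _)  = inj₂ (x , d)

  mem : ∀ ℓ → X ℓ → Maybe (Fin D) → Y ℓ
  mem ℓ x nothing  = inj₁ x
  mem ℓ x (just d) = mem′ ℓ x d (In? ℓ (base ℓ x) d)

  tl : ∀ ℓ → Y ℓ → A
  tl ℓ (inj₁ x)       = el (base ℓ x)
  tl ℓ (inj₂ (x , d)) = ch (el (base ℓ x)) d

  -- `P` restricts the centres of the pieces only; total edges survive every cut.
  module Core (ℓ : ℕ) (P : X ℓ → Set) where

    Piece : Fin k → Y ℓ → Y ℓ → Set
    Piece u y y′ = Σ (X ℓ) λ x → Σ (Maybe (Fin D)) λ m → Σ (Maybe (Fin D)) λ m′ →
      P x × TA u (val (base ℓ x) m) (val (base ℓ x) m′) ≡ true × y ≡ mem ℓ x m × y′ ≡ mem ℓ x m′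

    Total : Fin k → Y ℓ → Y ℓ → Set
    Total u y y′ = Σ (X ℓ) λ x → Σ (X ℓ) λ x′ →
      Tot ℓ (base ℓ x) (base ℓ x′) × Um ℓ u (base ℓ x) × y ≡ inj₁ x × y′ ≡ inj₁ x′

    Edge : Fin k → Y ℓ → Y ℓ → Set
    Edge u y y′ = Piece u y y′ ⊎ Total u y y′

    Atom : (i : Fin nb) → Vec (Y ℓ) (ar i) → Set
    Atom i v = Σ (X ℓ) λ x → Σ (Vec (Maybe (Fin D)) (ar i)) λ ms →
      P x × RA i (map (val (base ℓ x)) ms) ≡ true × v ≡ map (mem ℓ x) ms

    core : Str (Y ℓ)
    core = record { labS = lab ∘ tl ℓ ; R = Atom ; T = λ u → Path (Edge u) ; T-trans = path-trans }

  open Core public using (core)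

  All⊤ : ∀ ℓ → X ℓ → Set
  All⊤ ℓ _ = ⊤

  path-map : ∀ {X : Set} {E E′ : X → X → Set} → (∀ {x y} → E x y → E′ x y) → ∀ {x y} → Path E x y → Path E′ x y
  path-map f (one e) = one (f e)
  path-map f (e ◅ p) = f e ◅ path-map f p

  mem-zero : ∀ x d q → mem′ zero x d q ≡ inj₂ (x , d)
  mem-zero x d (yes q) = ⊥-elim (In-zero q)
  mem-zero x d (no _)  = refl

  tl-mem-zero : ∀ x m → tl 0 (mem 0 x m) ≡ val x m
  tl-mem-zero x nothing  = refl
  tl-mem-zero x (just d) = cong (tl 0) (mem-zero x d (In? 0 x d))

  module Span (ℓ : ℕ) (ℓ≤J : ℓ ≤ J) (u : Fin k) where

    col : X (suc ℓ) → Fin L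
    col (i , _) = i

    bs : X (suc ℓ) → S
    bs = base (suc ℓ)

    open Core (suc ℓ) (All⊤ (suc ℓ)) using (Piece; Total; Edge)

    Coloured : List (Fin L) → Y (suc ℓ) → Y (suc ℓ) → Set
    Coloured cs = Path (Core.Edge (suc ℓ) (λ x → col x ∈ cs) u)

    U : X (suc ℓ) → Set
    U x = Um (suc ℓ) u (bs x)

    centre : Y (suc ℓ) → X (suc ℓ)
    centre (inj₁ x)       = x
    centre (inj₂ (x , _)) = x

    child-Tot : ∀ x d → In (suc ℓ) (bs x) d → Tot (suc ℓ) (bs x) (bs (child (suc ℓ) x d))
    child-Tot x d p = subst (Tot (suc ℓ) (bs x)) (sym (base-child (suc ℓ) x d p)) (In-Tot p)

    U-mem : ∀ x m → U x → U (centre (mem (suc ℓ) x m))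
    U-mem x nothing  um = um
    U-mem x (just d) um with In? (suc ℓ) (bs x) d
    ... | yes p = Tot-Um (child-Tot x d p) um
    ... | no _  = um

    U-mem⁻ : ∀ x m → U (centre (mem (suc ℓ) x m)) → U x
    U-mem⁻ x nothing  um = um
    U-mem⁻ x (just d) um with In? (suc ℓ) (bs x) d
    ... | yes p = Tot-Um (Tot-sym (child-Tot x d p)) um
    ... | no _  = um

    -- For a symbol of level suc ℓ the states of a path are totally related, so only its first and last centres matter.
    module Inside where

      PC : Y (suc ℓ) → Y (suc ℓ) → Set
      PC = Piece u

      Pre Post : Y (suc ℓ) → X (suc ℓ) → Set
      Pre  y t = y ≡ inj₁ t ⊎ PC y (inj₁ t)
      Post y t = y ≡ inj₁ t ⊎ PC (inj₁ t) y

      data NF (y y′ : Y (suc ℓ)) : Set where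
        single : PC y y′ → NF y y′
        triple : ∀ t t′ → Pre y t → Tot (suc ℓ) (bs t) (bs t′) → Post y′ t′ → NF y y′

      state-view : ∀ x m {t} → inj₁ t ≡ mem (suc ℓ) x m → (m ≡ nothing × t ≡ x) ⊎ Tot (suc ℓ) (bs x) (bs t)
      state-view x nothing refl = inj₁ (refl , refl)
      state-view x (just d) eq with In? (suc ℓ) (bs x) d
      state-view x (just d) refl | yes p = inj₂ (child-Tot x d p)

      leaf-view : ∀ x m {x′ d} → inj₂ (x′ , d) ≡ mem (suc ℓ) x m → x ≡ x′ × m ≡ just d
      leaf-view x (just d) eq with In? (suc ℓ) (bs x) d
      leaf-view x (just d) refl | no _ = refl , refl

      -- A leaf determines its centre, so pieces meeting there compose. At a state either both
      -- pieces are centred there, or one reaches it by an inner step, and then the state is total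
      -- with itself.
      join : ∀ y {y₀ y′} → PC y₀ y → PC y y′ → PC y₀ y′ ⊎ Σ (X (suc ℓ)) λ t → y ≡ inj₁ t × Tot (suc ℓ) (bs t) (bs t)
      join (inj₂ (x , d)) (c , m , m₁ , _ , t₁ , e₁ , e₂) (c′ , m₁′ , m′ , _ , t₂ , e₃ , e₄)
        with leaf-view c m₁ e₂ | leaf-view c′ m₁′ e₃
      ... | refl , refl | refl , refl = inj₁ (c , m , m′ , _ , TA-trans u t₁ t₂ , e₁ , e₄)
      join (inj₁ t) (c , m , m₁ , _ , t₁ , e₁ , e₂) (c′ , m₁′ , m′ , _ , t₂ , e₃ , e₄)
        with state-view c m₁ e₂ | state-view c′ m₁′ e₃
      ... | inj₁ (refl , refl) | inj₁ (refl , refl) = inj₁ (c , m , m′ , _ , TA-trans u t₁ t₂ , e₁ , e₄)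
      ... | inj₂ T | _ = inj₂ (t , refl , Tot-trans (Tot-sym T) T)
      ... | inj₁ _ | inj₂ T = inj₂ (t , refl , Tot-trans (Tot-sym T) T)

      states : ∀ {t t′} → PC (inj₁ t) (inj₁ t′) → t ≡ t′ ⊎ Tot (suc ℓ) (bs t) (bs t′)
      states (c , m , m′ , _ , _ , e , e′) with state-view c m e | state-view c m′ e′
      ... | inj₁ (_ , refl) | inj₁ (_ , refl) = inj₁ refl
      ... | inj₁ (_ , refl) | inj₂ T = inj₂ T
      ... | inj₂ T | inj₁ (_ , refl) = inj₂ (Tot-sym T)
      ... | inj₂ T | inj₂ T′ = inj₂ (Tot-trans (Tot-sym T) T′)

      cons : ∀ {y y₁ y′} → Edge u y y₁ → NF y₁ y′ → NF y y′
      cons {y₁ = y₁} (inj₁ p) (single q) with join y₁ p q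
      ... | inj₁ r = single r
      ... | inj₂ (t , refl , T) = triple t t (inj₂ p) T (inj₂ q)
      cons (inj₁ p) (triple t t′ (inj₁ refl) T o) = triple t t′ (inj₂ p) T o
      cons {y₁ = y₁} (inj₁ p) (triple t t′ (inj₂ q) T o) with join y₁ p q
      ... | inj₁ r = triple t t′ (inj₂ r) T o
      ... | inj₂ (t₁ , refl , _) with states q
      ...   | inj₁ refl = triple t₁ t′ (inj₂ p) T o
      ...   | inj₂ T′ = triple t₁ t′ (inj₂ p) (Tot-trans T′ T) o
      cons (inj₂ (x , x′ , T , _ , refl , refl)) (single q) = triple x x′ (inj₁ refl) T (inj₂ q)
      cons (inj₂ (x , x′ , T , _ , refl , refl)) (triple t t′ (inj₁ refl) T′ o) = triple x t′ (inj₁ refl) (Tot-trans T T′) o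
      cons (inj₂ (x , x′ , T , _ , refl , refl)) (triple t t′ (inj₂ q) T′ o) with states q
      ... | inj₁ refl = triple x t′ (inj₁ refl) (Tot-trans T T′) o
      ... | inj₂ T″ = triple x t′ (inj₁ refl) (Tot-trans T (Tot-trans T″ T′)) o

      normal : ∀ {y y′} → Path (Edge u) y y′ → NF y y′
      normal (one (inj₁ p)) = single p
      normal (one (inj₂ (x , x′ , T , _ , e , e′))) = triple x x′ (inj₁ e) T (inj₁ e′)
      normal (e ◅ p) = cons e (normal p)

      pc-colour : ∀ {cs y y′} (p : PC y y′) → col (proj₁ p) ∈ cs → Core.Edge (suc ℓ) (λ x → col x ∈ cs) u y y′
      pc-colour (x , m , m′ , _ , r) i = inj₁ (x , m , m′ , i , r)

      preU : ∀ {y t} → Pre y t → U (centre y) → U t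
      preU (inj₁ refl) um = um
      preU (inj₂ (x , m , m′ , _ , _ , refl , e)) um = subst (U ∘ centre) (sym e) (U-mem x m′ (U-mem⁻ x m um))

      spanned : ∀ {y y′} → U (centre y) → NF y y′ → Σ (List (Fin L)) λ cs → length cs ≤ 2 × Coloured cs y y′
      spanned um (single p) = col (proj₁ p) ∷ [] , s≤s z≤n , one (pc-colour p (here refl))
      spanned {y} {y′} um (triple t t′ pre T post) = before pre (after post)
        where
        tot : ∀ {cs} → Core.Edge (suc ℓ) (λ x → col x ∈ cs) u (inj₁ t) (inj₁ t′)
        tot = inj₂ (t , t′ , T , preU pre um , refl , refl)
        After : Set
        After = Σ (List (Fin L)) λ cs → length cs ≤ 1 × (∀ {cs′} → (∀ {c} → c ∈ cs → c ∈ cs′) → Coloured cs′ (inj₁ t) y′)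
        after : Post y′ t′ → After
        after (inj₁ refl) = [] , z≤n , λ _ → one tot
        after (inj₂ q) = col (proj₁ q) ∷ [] , s≤s z≤n , λ f → tot ◅ one (pc-colour q (f (here refl)))
        before : Pre y t → After → Σ (List (Fin L)) λ cs → length cs ≤ 2 × Coloured cs y y′
        before (inj₁ refl) (cs , len , f) = cs , m≤n⇒m≤1+n len , f id
        before (inj₂ q) (cs , len , f) = col (proj₁ q) ∷ cs , s≤s len , pc-colour q (here refl) ◅ f there

    -- For the other symbols the colour at which the current run started is invariant. A path first goes up along
    -- a backward run (A), may turn at a sibling (W), and then goes down along a forward run (B); since histories are
    -- truncated it may move back and forth, but the status shows that it never returns to an earlier regime.
    module Outside where

      fw bw : X (suc ℓ) → Fin D → Bool
      fw x d = TA u (el (bs x)) (ch (el (bs x)) d)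
      bw x d = TA u (ch (el (bs x)) d) (el (bs x))

      dir : Bool → X (suc ℓ) → Fin D → Bool
      dir b x d = if b then bw x d else fw x d

      status : X (suc ℓ) → Maybe (Fin D) → Status
      status x nothing  = st (bs x) u
      status x (just d) = update-status (st (bs x) u) (fw x d) (bw x d)

      own : Bool → X (suc ℓ) → Fin L
      own b x = iter prev (cnt (bs x) u b ℓ) (col x)

      -- For a child at which the run breaks this is the colour of the parent: the counter of the
      -- child includes the breaking step if that step changes the colour.
      origin : Bool → X (suc ℓ) → Maybe (Fin D) → Fin L
      origin b x nothing  = own b x
      origin b x (just d) = if dir b x d then own b x else col x

      node-status : Y (suc ℓ) → Status
      node-status (inj₁ x)       = status x nothing
      node-status (inj₂ (x , d)) = status x (just d)

      node-origin : Bool → Y (suc ℓ) → Fin L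
      node-origin b (inj₁ x)       = origin b x nothing
      node-origin b (inj₂ (x , d)) = origin b x (just d)

      status-mem : ∀ x m → node-status (mem (suc ℓ) x m) ≡ status x m
      status-mem x nothing = refl
      status-mem x (just d) with In? (suc ℓ) (bs x) d
      ... | yes p = trans (cong (λ s → st s u) (base-child (suc ℓ) x d p)) (st-nxt (bs x) d u)
      ... | no _ = refl

      -- A state can be the child of several centres, because histories are truncated. Counter and
      -- colour advance together, so all these centres see the origin that the state itself carries.
      origin-mem : ∀ b x m → ¬ U x → node-origin b (mem (suc ℓ) x m) ≡ origin b x m
      origin-mem b x nothing ¬um = refl
      origin-mem b x@(i , h , x₀) (just d) ¬um with In? (suc ℓ) (bs x) d
      ... | no _ = refl
      ... | yes p = trans (cong (λ c → iter prev c (col (child (suc ℓ) x d)))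
                      (trans (cong (λ s → cnt s u b ℓ) (base-child (suc ℓ) x d p)) (cnt-nxt b ℓ≤J p ¬um)))
                    (go (In? ℓ (bs x) d) (dir b x d))
        where
        go : ∀ q t → iter prev ((if t then cnt (bs x) u b ℓ else 0) + bit (not (does q))) (col (child′ ℓ x d q))
               ≡ (if t then own b x else i)
        go (yes _) true  rewrite +-identityʳ (cnt (bs x) u b ℓ) = refl
        go (yes _) false = refl
        go (no _)  true  rewrite +-comm (cnt (bs x) u b ℓ) 1 | prev-next i = refl
        go (no _)  false = prev-next i

      colour-origin : ∀ b x m → col x ∈ range M (origin b x m)
      colour-origin b x nothing = ∈-range (col x) (cnt≤M (bs x) u b ℓ)
      colour-origin b x (just d) with dir b x d
      ... | true  = ∈-range (col x) (cnt≤M (bs x) u b ℓ)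
      ... | false = ∈-range {0} (col x) z≤n

      -- In a strong status the forward run lives and is strictly older than any backward run; in a
      -- weak one no backward run is strictly older than the forward run.
      data Strong : Status → Set where
        fwd       : Strong fwd
        fwd-older : Strong fwd-older

      data Weak : Status → Set where
        none      : Weak none
        fwd       : Weak fwd
        fwd-older : Weak fwd-older
        tied      : Weak tied

      module _ (s : Status) where

        downB : ∀ g → Strong s → Strong (update-status s true g)
        downB false _         = fwd
        downB true  fwd       = fwd-older
        downB true  fwd-older = fwd-older

        downW : Weak s → Weak (update-status s true true)
        downW none      = tied
        downW fwd       = fwd-older
        downW fwd-older = fwd-older
        downW tied      = tied

      -- Moving up needs the backward relation on the step to the child. A forward run that is still
      -- strictly older must hold on this step and have started above it.
      upB : ∀ s f → Strong (update-status s f true) → f ≡ true × Strong s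
      upB s         false ()
      upB fwd       true _ = refl , fwd
      upB fwd-older true _ = refl , fwd-older
      upB none      true ()
      upB bwd       true ()
      upB tied      true ()
      upB bwd-older true ()

      upW : ∀ s f → Weak (update-status s f true) → Weak s
      upW s         false ()
      upW none      true _ = none
      upW fwd       true _ = fwd
      upW fwd-older true _ = fwd-older
      upW tied      true _ = tied
      upW bwd       true ()
      upW bwd-older true ()

      strong-fw : ∀ s f g → Strong (update-status s f g) → f ≡ true
      strong-fw s true  g     _ = refl
      strong-fw s false false ()
      strong-fw s false true  ()

      weak-fw : ∀ s f → Weak (update-status s f true) → f ≡ true
      weak-fw s true  _ = refl
      weak-fw s false ()

      sibling : ∀ x d d′ → TA u (ch (el (bs x)) d) (ch (el (bs x)) d′) ≡ true →
        fw x d ≡ true → fw x d′ ≡ true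
      sibling x d d′ t f = TA-trans u f t

      sibling⁻ : ∀ x d d′ → TA u (ch (el (bs x)) d) (ch (el (bs x)) d′) ≡ true →
        bw x d′ ≡ true → bw x d ≡ true
      sibling⁻ x d d′ t g = TA-trans u t g

      stepB : ∀ x m m′ → TA u (val (bs x) m) (val (bs x) m′) ≡ true → Strong (status x m) →
        Strong (status x m′) × origin false x m ≡ origin false x m′
      stepB x nothing nothing t s = s , refl
      stepB x nothing (just d) t s rewrite t = downB _ (bw x d) s , refl
      stepB x (just d) nothing t s with fw x d | bw x d | upB (st (bs x) u) (fw x d)
      stepB x (just d) nothing refl s | _ | true | up with up s
      ... | refl , s′ = s′ , refl
      stepB x (just d) (just d′) t s
        with fw x d | bw x d | fw x d′ | bw x d′ | sibling x d d′ t | sibling⁻ x d d′ t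
           | strong-fw (st (bs x) u) (fw x d) (bw x d)
      ... | f | g | f′ | g′ | sib | sib⁻ | sf with sf s
      ...   | refl with sib refl
      ...     | refl = go g g′ sib⁻ s , refl
        where
        go : ∀ g g′ → (g′ ≡ true → g ≡ true) → Strong (update-status (st (bs x) u) true g) →
          Strong (update-status (st (bs x) u) true g′)
        go g false _ _ = fwd
        go g true  i s with i refl
        ... | refl = s

      stepW : ∀ x m m′ → TA u (val (bs x) m) (val (bs x) m′) ≡ true → Weak (status x m) →
        (Weak (status x m′) × origin true x m ≡ origin true x m′) ⊎ Strong (status x m′)
      stepW x nothing nothing t s = inj₁ (s , refl)
      stepW x nothing (just d) t s rewrite t with bw x d
      ... | true  = inj₁ (downW _ s , refl)
      ... | false = inj₂ fwd
      stepW x (just d) nothing t s rewrite t = inj₁ (upW _ (fw x d) s , refl)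
      stepW x (just d) (just d′) t s = go (fw x d) (bw x d) (fw x d′) (bw x d′) (sibling x d d′ t) (sibling⁻ x d d′ t) s
        where
        σ = st (bs x) u
        go : ∀ f g f′ g′ → (f ≡ true → f′ ≡ true) → (g′ ≡ true → g ≡ true) → Weak (update-status σ f g) →
          (Weak (update-status σ f′ g′) × (if g then own true x else col x) ≡ (if g′ then own true x else col x))
          ⊎ Strong (update-status σ f′ g′)
        go f g f′ true i j s with j refl
        ... | refl with weak-fw σ f s
        ...   | refl with i refl
        ...     | refl = inj₁ (s , refl)
        go f g true false i j s = inj₂ fwd
        go f false false false i j s = inj₁ (none , refl)
        go true true false false i j s with i refl
        ... | ()
        go false true false false i j ()

      -- Moving up preserves the backward run. The origin can change only on reaching a child for
      -- which the backward relation fails, and the status there is `fwd` or `none`.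
      stepA : ∀ x m m′ → TA u (val (bs x) m) (val (bs x) m′) ≡ true →
        origin true x m ≡ origin true x m′ ⊎ Strong (status x m′) ⊎ Weak (status x m′)
      stepA x nothing nothing t = inj₁ refl
      stepA x nothing (just d) t rewrite t with bw x d
      ... | true  = inj₁ refl
      ... | false = inj₂ (inj₁ fwd)
      stepA x (just d) nothing t rewrite t = inj₁ refl
      stepA x (just d) (just d′) t = go (bw x d) (fw x d′) (bw x d′) (sibling⁻ x d d′ t)
        where
        σ = st (bs x) u
        go : ∀ g f′ g′ → (g′ ≡ true → g ≡ true) →
          (if g then own true x else col x) ≡ (if g′ then own true x else col x)
          ⊎ Strong (update-status σ f′ g′) ⊎ Weak (update-status σ f′ g′)
        go g f′ true j with j refl
        ... | refl = inj₁ refl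
        go g true  false j = inj₂ (inj₁ fwd)
        go g false false j = inj₂ (inj₂ none)

      not-total : ∀ {y y′} → ¬ U (centre y) → ¬ Total u y y′
      not-total ¬um (x , x′ , _ , um , refl , _) = ¬um um

      module _ {y y′} (pc : Piece u y y′) (¬um : ¬ U (centre y)) where

        private
          x : X (suc ℓ)
          x = proj₁ pc
          m m′ : Maybe (Fin D)
          m  = proj₁ (proj₂ pc)
          m′ = proj₁ (proj₂ (proj₂ pc))
          t : TA u (val (bs x) m) (val (bs x) m′) ≡ true
          t = proj₁ (proj₂ (proj₂ (proj₂ (proj₂ pc))))
          e : y ≡ mem (suc ℓ) x m
          e = proj₁ (proj₂ (proj₂ (proj₂ (proj₂ (proj₂ pc)))))
          e′ : y′ ≡ mem (suc ℓ) x m′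
          e′ = proj₂ (proj₂ (proj₂ (proj₂ (proj₂ (proj₂ pc)))))

        ¬ux : ¬ U x
        ¬ux um = ¬um (subst (U ∘ centre) (sym e) (U-mem x m um))

        ¬uy′ : ¬ U (centre y′)
        ¬uy′ um = ¬ux (U-mem⁻ x m′ (subst (U ∘ centre) e′ um))

        st≡ : node-status y ≡ status x m
        st≡ = trans (cong node-status e) (status-mem x m)

        st≡′ : node-status y′ ≡ status x m′
        st≡′ = trans (cong node-status e′) (status-mem x m′)

        or≡ : ∀ b → node-origin b y ≡ origin b x m
        or≡ b = trans (cong (node-origin b) e) (origin-mem b x m ¬ux)

        or≡′ : ∀ b → node-origin b y′ ≡ origin b x m′
        or≡′ b = trans (cong (node-origin b) e′) (origin-mem b x m′ ¬ux)

        edge : ∀ b {cs} → (∀ {c} → c ∈ range M (node-origin b y) → c ∈ cs) →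
          Core.Edge (suc ℓ) (λ x → col x ∈ cs) u y y′
        edge b f = inj₁ (x , m , m′ , f (subst (λ o → col x ∈ range M o) (sym (or≡ b)) (colour-origin b x m)) , t , e , e′)

        goB : Strong (node-status y) → Strong (node-status y′) × node-origin false y ≡ node-origin false y′
        goB s = let s′ , o = stepB x m m′ t (subst Strong st≡ s) in
          subst Strong (sym st≡′) s′ , trans (or≡ false) (trans o (sym (or≡′ false)))

        goW : Weak (node-status y) → (Weak (node-status y′) × node-origin true y ≡ node-origin true y′) ⊎ Strong (node-status y′)
        goW s with stepW x m m′ t (subst Weak st≡ s)
        ... | inj₁ (s′ , o) = inj₁ (subst Weak (sym st≡′) s′ , trans (or≡ true) (trans o (sym (or≡′ true))))
        ... | inj₂ s′ = inj₂ (subst Strong (sym st≡′) s′)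

        goA : node-origin true y ≡ node-origin true y′ ⊎ Strong (node-status y′) ⊎ Weak (node-status y′)
        goA with stepA x m m′ t
        ... | inj₁ o = inj₁ (trans (or≡ true) (trans o (sym (or≡′ true))))
        ... | inj₂ (inj₁ s′) = inj₂ (inj₁ (subst Strong (sym st≡′) s′))
        ... | inj₂ (inj₂ s′) = inj₂ (inj₂ (subst Weak (sym st≡′) s′))

      Sub : List (Fin L) → List (Fin L) → Set
      Sub cs cs′ = ∀ {c} → c ∈ cs → c ∈ cs′

      regimeB : ∀ {y y′} cs → Path (Edge u) y y′ → ¬ U (centre y) → Strong (node-status y) →
        Sub (range M (node-origin false y)) cs → Coloured cs y y′
      regimeB cs (one (inj₂ t)) ¬um _ _ = ⊥-elim (not-total ¬um t)
      regimeB cs (one (inj₁ pc)) ¬um s f = one (edge pc ¬um false f)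
      regimeB cs (inj₂ t ◅ p) ¬um _ _ = ⊥-elim (not-total ¬um t)
      regimeB cs (inj₁ pc ◅ p) ¬um s f =
        let s′ , o = goB pc ¬um s in
        edge pc ¬um false f ◅ regimeB cs p (¬uy′ pc ¬um) s′ (subst (λ z → Sub (range M z) cs) o f)

      regimeW : ∀ {y y′} cs → Path (Edge u) y y′ → ¬ U (centre y) → Weak (node-status y) →
        Sub (range M (node-origin true y)) cs → Σ (Fin L) λ o → Coloured (range M o ++ cs) y y′
      regimeW cs (one (inj₂ t)) ¬um _ _ = ⊥-elim (not-total ¬um t)
      regimeW {y} cs (one (inj₁ pc)) ¬um s f =
        -- The path ends before the last regime; `zero` is an arbitrary origin for it.
        zero , one (edge pc ¬um true (∈-++⁺ʳ (range M zero) ∘ f))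
      regimeW cs (inj₂ t ◅ p) ¬um _ _ = ⊥-elim (not-total ¬um t)
      regimeW cs (inj₁ pc ◅ p) ¬um s f with goW pc ¬um s
      ... | inj₁ (s′ , o) =
        let q , r = regimeW cs p (¬uy′ pc ¬um) s′ (subst (λ z → Sub (range M z) cs) o f)
        in q , edge pc ¬um true (∈-++⁺ʳ (range M q) ∘ f) ◅ r
      ... | inj₂ s′ = _ , edge pc ¬um true (∈-++⁺ʳ (range M _) ∘ f) ◅ regimeB _ p (¬uy′ pc ¬um) s′ ∈-++⁺ˡ

      regimeA : ∀ {y y′} cs → Path (Edge u) y y′ → ¬ U (centre y) → Sub (range M (node-origin true y)) cs →
        Σ (Fin L) λ o → Σ (Fin L) λ o′ → Coloured (range M o ++ (range M o′ ++ cs)) y y′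
      regimeA cs (one (inj₂ t)) ¬um _ = ⊥-elim (not-total ¬um t)
      regimeA {y} cs (one (inj₁ pc)) ¬um f =
        zero , zero , one (edge pc ¬um true (∈-++⁺ʳ (range M zero) ∘ ∈-++⁺ʳ (range M zero) ∘ f))
      regimeA cs (inj₂ t ◅ p) ¬um _ = ⊥-elim (not-total ¬um t)
      regimeA {y} cs (inj₁ pc ◅ p) ¬um f with goA pc ¬um
      ... | inj₁ o =
        let q , q′ , r = regimeA cs p (¬uy′ pc ¬um) (subst (λ z → Sub (range M z) cs) o f)
        in q , q′ , edge pc ¬um true (∈-++⁺ʳ (range M q) ∘ ∈-++⁺ʳ (range M q′) ∘ f) ◅ r
      ... | inj₂ (inj₁ s′) = zero , _ , edge pc ¬um true (∈-++⁺ʳ (range M zero) ∘ ∈-++⁺ʳ (range M _) ∘ f)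
              ◅ regimeB _ p (¬uy′ pc ¬um) s′ (∈-++⁺ʳ (range M zero) ∘ ∈-++⁺ˡ)
      ... | inj₂ (inj₂ s′) =
        let o , r = regimeW (range M _ ++ cs) p (¬uy′ pc ¬um) s′ ∈-++⁺ˡ
        in o , _ , edge pc ¬um true (∈-++⁺ʳ (range M o) ∘ ∈-++⁺ʳ (range M _) ∘ f) ◅ r

    -- One range of `suc M` colours for each of the three regimes.
    spread : ℕ
    spread = suc M + (suc M + suc M)

    span : ∀ {y y′} → Path (Edge u) y y′ → Σ (List (Fin L)) λ cs → length cs ≤ spread × Coloured cs y y′
    span {y} p with Um? (suc ℓ) u (bs (centre y))
    ... | yes um = let cs , len , q = Inside.spanned um (Inside.normal p) in
      cs , ≤-trans len (+-mono-≤ {1} (s≤s z≤n) (≤-trans (s≤s z≤n) (m≤m+n (suc M) (suc M)))) , q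
    ... | no ¬um =
      let o₁ = Outside.node-origin true y
          o , o′ , q = Outside.regimeA (range M o₁) p ¬um id
      in _ , ≤-reflexive (trans (Listₚ.length-++ (range M o))
               (cong₂ _+_ (length-range M o) (trans (Listₚ.length-++ (range M o′))
                 (cong₂ _+_ (length-range M o′) (length-range M o₁))))) , q

-- Soundness of bounded queries, by induction over the levels

first : ∀ {X : Set} → X → List X → X
first d []      = d
first d (x ∷ _) = x

filter-ext : ∀ {X : Set} {P P′ : X → Set} (P? : ∀ x → Dec (P x)) (P′? : ∀ x → Dec (P′ x)) →
  (∀ {x} → P x → P′ x) → (∀ {x} → P′ x → P x) → ∀ xs → filter P? xs ≡ filter P′? xs
filter-ext P? P′? f g []       = refl
filter-ext P? P′? f g (x ∷ xs) with P? x | P′? x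
... | yes _ | yes _ = cong (x ∷_) (filter-ext P? P′? f g xs)
... | yes p | no ¬p = ⊥-elim (¬p (f p))
... | no ¬p | yes p = ⊥-elim (¬p (g p))
... | no _  | no _  = filter-ext P? P′? f g xs

concatMap-length : ∀ {X Z : Set} (f : X → List Z) r → (∀ x → length (f x) ≤ r) →
  ∀ xs → length (concatMap f xs) ≤ length xs * r
concatMap-length f r b []       = z≤n
concatMap-length f r b (x ∷ xs) = ≤-trans (≤-reflexive (Listₚ.length-++ (f x)))
  (+-mono-≤ (b x) (concatMap-length f r b xs))

∈-concatMap : ∀ {X Z : Set} (f : X → List Z) {x z xs} → x ∈ xs → z ∈ f x → z ∈ concatMap f xs
∈-concatMap f {xs = x ∷ xs} (here refl) z∈ = ∈-++⁺ˡ z∈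
∈-concatMap f {xs = x ∷ xs} (there i)   z∈ = ∈-++⁺ʳ (f x) (∈-concatMap f i z∈)

∃Maybe? : ∀ {n} {P : Maybe (Fin n) → Set} → (∀ m → Dec (P m)) → Dec (∃ P)
∃Maybe? P? = map′
  (λ { (inj₁ p) → nothing , p ; (inj₂ (d , p)) → just d , p })
  (λ { (nothing , p) → inj₁ p ; (just d , p) → inj₂ (d , p) })
  (P? nothing ⊎-dec Finₚ.any? (λ d → P? (just d)))

-- An amalgam wants one carrier for all its parts. Points added to a part are isolated and labelled
-- like `a₀`, to which every answer sends them.
module Extension (𝔐 : Model) {C C′ : Set} (ι : C → C′) (ρ : C′ → Maybe C) (ρι : ∀ c → ρ (ι c) ≡ just c)
  (S : Structures.Str 𝔐 C) where
  open Model 𝔐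
  open Structures 𝔐

  private
    ι-inj : ∀ {c c′} → ι c ≡ ι c′ → c ≡ c′
    ι-inj {c} {c′} eq with trans (sym (ρι c)) (trans (cong ρ eq) (ρι c′))
    ... | refl = refl

  extend : Str C′
  extend = record
    { labS = λ c → Maybe.maybe (labS S) (lab a₀) (ρ c)
    ; R = λ i v → Σ (Vec C (ar i)) λ w → R S i w × v ≡ map ι w
    ; T = λ u x y → Σ C λ c → Σ C λ c′ → x ≡ ι c × y ≡ ι c′ × T S u c c′
    ; T-trans = λ { (c , c₁ , refl , refl , t) (c₂ , c₃ , e , refl , t′) →
        c , c₃ , refl , refl , T-trans S t (subst (λ z → T S _ z _) (sym (ι-inj e)) t′) }
    }

  Ok-extend : ∀ {p a} → Ok S p a → Ok extend (ι p) a
  Ok-extend {p} {a} ok zs zs≤ Γ Γ≤ = h′ , trans (h′ι p) (proj₁ (proj₂ res)) , pres tp lp rp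
    where
    pull : Fact extend → Fact S
    pull (fact i us v (w , r , _)) = fact i us w r
    res = ok (mapMaybe ρ zs) (≤-trans (Listₚ.length-mapMaybe ρ zs) zs≤)
             (List.map pull Γ) (≤-trans (≤-reflexive (Listₚ.length-map pull Γ)) Γ≤)
    h = proj₁ res
    pr = proj₂ (proj₂ res)
    h′ : C′ → A
    h′ c = Maybe.maybe h a₀ (ρ c)
    h′ι : ∀ c → h′ (ι c) ≡ h c
    h′ι c = cong (Maybe.maybe h a₀) (ρι c)
    mem : ∀ {x c} → x ∈ (ι p ∷ zs) → ρ x ≡ just c → c ∈ (p ∷ mapMaybe ρ zs)
    mem (here refl) e with trans (sym (ρι p)) e
    ... | refl = here refl
    mem (there i) e = there (∈-mapMaybe ρ i e)
    tp : ∀ u {x y} → x ∈ (ι p ∷ zs) → y ∈ (ι p ∷ zs) → T extend u x y → TA u (h′ x) (h′ y) ≡ true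
    tp u x∈ y∈ (c , c′ , refl , refl , t) = subst₂ (λ v w → TA u v w ≡ true) (sym (h′ι c)) (sym (h′ι c′))
      (T-pres pr u (mem x∈ (ρι c)) (mem y∈ (ρι c′)) t)
    lp : ∀ {x} → x ∈ (ι p ∷ zs) → lab (h′ x) ≡ labS extend x
    lp {x} x∈ with ρ x in e
    ... | just c  = lab-pres pr (mem x∈ e)
    ... | nothing = refl
    rp : ∀ {f} → f ∈ Γ → RA (rsym f) (map h′ (args f)) ≡ true
    rp {f@(fact i us v (w , r , refl))} f∈ = trans
      (cong (RA i) (trans (sym (Vecₚ.map-∘ h′ ι w)) (Vecₚ.map-cong h′ι w))) (R-pres pr (∈-map⁺ pull f∈))

module Ladder (𝔐 : Model) {Q : ℕ} (tp : Fin (Model.n 𝔐) → Vec Bool Q)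
  (transfer : ∀ {C : Set} → DecidableEquality C → {S : Structures.Str 𝔐 C} → ∀ {p a a′} → tp a ≡ tp a′ →
    Structures.Ok 𝔐 S p a → Structures.Ok 𝔐 S p a′)
  (𝔸 : Auto 𝔐 tp) (L₀ : ℕ) where

  open Model 𝔐
  open Structures 𝔐
  open Auto 𝔸 hiding (A)
  open Cyclic L₀
  open Levels 𝔐 tp 𝔸 L₀

  eX : ℕ → ℕ
  eX zero    = e₀
  eX (suc ℓ) = L₀ + (L * (eX ℓ + D) + eX ℓ)

  opaque
    code-X : ∀ ℓ → Code (X ℓ) (eX ℓ)
    code-X zero    = code-S
    code-X (suc ℓ) = code-× (code-Fin L₀) (code-× (code-Vec entry L) (code-X ℓ))
      where
      entry : Code (Maybe (X ℓ × Fin D)) (eX ℓ + D)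
      entry = code-retract (code-× (code-X ℓ) (code-MaybeFin D))
        (λ { nothing → root ℓ s₀ , nothing ; (just (x , d)) → x , just d })
        (λ { (x , nothing) → nothing ; (x , just d) → just (x , d) })
        (λ { nothing → refl ; (just _) → refl })

  X-≟ : ∀ ℓ → DecidableEquality (X ℓ)
  X-≟ ℓ = code-≟ (code-X ℓ)

  Y-≟ : ∀ ℓ → DecidableEquality (Y ℓ)
  Y-≟ ℓ = Sumₚ.≡-dec (X-≟ ℓ) (Prodₚ.≡-dec (X-≟ ℓ) Fin._≟_)

  allY : ∀ ℓ → List (Y ℓ)
  allY ℓ = List.map inj₁ (allCode (code-X ℓ)) ++
           List.map inj₂ (cartesianProduct (allCode (code-X ℓ)) (allFin D))

  ∈-allY : ∀ ℓ y → y ∈ allY ℓ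
  ∈-allY ℓ (inj₁ x) = ∈-++⁺ˡ (∈-map⁺ inj₁ (∈-allCode (code-X ℓ) x))
  ∈-allY ℓ (inj₂ (x , d)) = ∈-++⁺ʳ (List.map inj₁ (allCode (code-X ℓ)))
    (∈-map⁺ inj₂ (∈-cartesianProduct⁺ (∈-allCode (code-X ℓ) x) (∈-allFin d)))

  opaque
    edge? : ∀ ℓ u y y′ → Dec (Core.Edge ℓ (All⊤ ℓ) u y y′)
    edge? ℓ u y y′ =
      ∃code? (code-X ℓ) (λ x → ∃Maybe? λ m → ∃Maybe? λ m′ →
        yes tt ×-dec (_ Bool.≟ true) ×-dec Y-≟ ℓ y (mem ℓ x m) ×-dec Y-≟ ℓ y′ (mem ℓ x m′))
      ⊎-dec ∃code? (code-X ℓ) (λ x → ∃code? (code-X ℓ) λ x′ →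
        Tot? ℓ _ _ ×-dec Um? ℓ u _ ×-dec Y-≟ ℓ y (inj₁ x) ×-dec Y-≟ ℓ y′ (inj₁ x′))

    atom? : ∀ ℓ i v → Dec (Core.Atom ℓ (All⊤ ℓ) i v)
    atom? ℓ i v = ∃code? (code-X ℓ) (λ x → ∃VecMaybe? (ar i) λ ms →
      yes tt ×-dec (_ Bool.≟ true) ×-dec Vecₚ.≡-dec (Y-≟ ℓ) v (map (mem ℓ x) ms))
      where
      ∃VecMaybe? : ∀ m {P : Vec (Maybe (Fin D)) m → Set} → (∀ v → Dec (P v)) → Dec (∃ P)
      ∃VecMaybe? zero    P? = map′ (λ p → [] , p) (λ { ([] , p) → p }) (P? [])
      ∃VecMaybe? (suc m) P? = map′ (λ { (x , v , p) → (x ∷ v) , p }) (λ { (x ∷ v , p) → x , v , p })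
        (∃Maybe? (λ x → ∃VecMaybe? m (λ v → P? (x ∷ v))))

    path? : ∀ ℓ u y y′ → Dec (Path (Core.Edge ℓ (All⊤ ℓ) u) y y′)
    path? ℓ u = Warshall.path? (edge? ℓ u) (allY ℓ) (∈-allY ℓ)

  full : ∀ ℓ → Str (Y ℓ × A)
  full ℓ = withModel (core ℓ (All⊤ ℓ)) (tl ℓ)

  anchor : ∀ ℓ → S → Y ℓ
  anchor ℓ s = inj₁ (root ℓ s)

  -- Roots suffice, since blocks are attached at their roots. The copies of the model in `full` give
  -- the induction its strength: each of them may stand for a further block.
  Faithful : ℕ → Set
  Faithful ℓ = ∀ s → Ok (full ℓ) (anchor ℓ s , tl ℓ (anchor ℓ s)) (tl ℓ (anchor ℓ s))

  -- At level zero no step is inner and no states are totally related, so `tl` is a homomorphism.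
  faithful-zero : Faithful 0
  faithful-zero s = Ok-exact (core 0 (All⊤ 0)) (tl 0)
    (λ { {i} (x , ms , _ , r , refl) → trans (cong (RA i)
       (trans (sym (Vecₚ.map-∘ (tl 0) (mem 0 x) ms)) (Vecₚ.map-cong (tl-mem-zero x) ms))) r })
    (λ {u} → path-fold (tl 0) {λ x y → TA u x y ≡ true} (TA-trans u)
      (λ { (inj₁ (x , m , m′ , _ , t , refl , refl)) →
             subst₂ (λ v w → TA u v w ≡ true) (sym (tl-mem-zero x m)) (sym (tl-mem-zero x m′)) t
         ; (inj₂ (_ , _ , T , _)) → ⊥-elim (Tot-zero T) }))
    (anchor 0 s)

  module Up (ℓ : ℕ) (ℓ≤J : ℓ ≤ J) (IH : Faithful ℓ) where

    K : Str (Y ℓ)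
    K = core ℓ (All⊤ ℓ)

    E : Set
    E = X ℓ × Fin D

    bs : X ℓ → S
    bs = base ℓ

    Adv : S → Fin D → Set
    Adv s d = In (suc ℓ) s d × ¬ In ℓ s d

    Adv? : ∀ s d → Dec (Adv s d)
    Adv? s d = In? (suc ℓ) s d ×-dec ¬? (In? ℓ s d)

    hangs′ : ∀ s d → Dec (Adv s d) → Maybe S
    hangs′ s d (yes _) = just (nxt s d)
    hangs′ s d (no _)  = nothing

    hangs : Y ℓ → Maybe S
    hangs (inj₁ _)       = nothing
    hangs (inj₂ (x , d)) = hangs′ (bs x) d (Adv? (bs x) d)

    hangs-adv : ∀ x d → Adv (bs x) d → hangs (inj₂ (x , d)) ≡ just (nxt (bs x) d)
    hangs-adv x d p with Adv? (bs x) d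
    ... | yes _ = refl
    ... | no ¬p = ⊥-elim (¬p p)

    hangs-not : ∀ x d → ¬ Adv (bs x) d → hangs (inj₂ (x , d)) ≡ nothing
    hangs-not x d ¬p with Adv? (bs x) d
    ... | yes p = ⊥-elim (¬p p)
    ... | no _  = refl

    hangs-tp : ∀ y {s} → hangs y ≡ just s → tp (el s) ≡ tp (tl ℓ y)
    hangs-tp (inj₂ (x , d)) eq with Adv? (bs x) d
    hangs-tp (inj₂ (x , d)) refl | yes _ = nxt-tp (bs x) d

    C : ℕ → Set
    C zero    = Y ℓ × A
    C (suc q) = Y ℓ × (A ⊎ C q)

    C-≟ : ∀ q → DecidableEquality (C q)
    C-≟ zero    = Prodₚ.≡-dec (Y-≟ ℓ) Fin._≟_
    C-≟ (suc q) = Prodₚ.≡-dec (Y-≟ ℓ) (Sumₚ.≡-dec Fin._≟_ (C-≟ q))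

    rootZ : ∀ q → S → C q
    rootZ zero    s = anchor ℓ s , tl ℓ (anchor ℓ s)
    rootZ (suc q) s = anchor ℓ s , inj₁ (tl ℓ (anchor ℓ s))

    left? : ∀ {B B′ : Set} → B ⊎ B′ → Maybe B
    left? (inj₁ b) = just b
    left? (inj₂ _) = nothing

    right? : ∀ {B B′ : Set} → B ⊎ B′ → Maybe B′
    right? (inj₁ _) = nothing
    right? (inj₂ b) = just b

    module InL (q : ℕ) = Extension 𝔐 {A} {A ⊎ C q} inj₁ left? (λ _ → refl) modelStr
    module InR (q : ℕ) (Z : Str (C q)) = Extension 𝔐 {C q} {A ⊎ C q} inj₂ right? (λ _ → refl) Z

    branch : ∀ q → Str (C q) → Maybe S → Str (A ⊎ C q)
    branch q Z nothing  = InL.extend q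
    branch q Z (just _) = InR.extend q Z

    point′ : ∀ q → A → Maybe S → A ⊎ C q
    point′ q a nothing  = inj₁ a
    point′ q a (just s) = inj₂ (rootZ q s)

    point : ∀ q → Y ℓ → A ⊎ C q
    point q y = point′ q (tl ℓ y) (hangs y)

    -- Blocks of level ℓ unfolded into a tree of depth q: the child block hangs at the leaf of an advancing step.
    Z : ∀ q → Str (C q)
    Z zero    = withModel K (tl ℓ)
    Z (suc q) = amalgam K (λ y → branch q (Z q) (hangs y)) (point q)

    Ok-model : ∀ a → Ok modelStr a a
    Ok-model a zs _ Γ _ = id , refl , pres (λ u _ _ t → t) (λ _ → refl)
      (λ {f} _ → trans (cong (RA (rsym f)) (Vecₚ.map-id (args f))) (holds f))

    -- A child block is sound at the element of its root, hence by `transfer` at that of the leaf,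
    -- which has the same type. By `collapse` the blocks become copies of the model, and the
    -- hypothesis on one block remains.
    Ok-Z : ∀ q s → Ok (Z q) (rootZ q s) (tl ℓ (anchor ℓ s))
    Ok-Z zero    s = IH s
    Ok-Z (suc q) s = collapse (Y-≟ ℓ) K _ (point q) (tl ℓ) (λ y → part y (hangs y) refl) (anchor ℓ s) (IH s)
      where
      part : ∀ y m → hangs y ≡ m → Ok (branch q (Z q) m) (point′ q (tl ℓ y) m) (tl ℓ y)
      part y nothing  eq = InL.Ok-extend q (Ok-model (tl ℓ y))
      part y (just t) eq = transfer (Sumₚ.≡-dec Fin._≟_ (C-≟ q))
        (trans (cong (tp ∘ el) (base-root ℓ t)) (hangs-tp y eq)) (InR.Ok-extend q (Z q) (Ok-Z q t))

    -- `β` lists the leaves passed on the way from the root of the tree to the block of `y`.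
    node : ∀ q → List E → Y ℓ → C q
    node zero    β       y = y , tl ℓ y
    node (suc q) []      y = y , point q y
    node (suc q) (e ∷ β) y = inj₂ e , inj₂ (node q β y)

    hung : ∀ q → List E → Y ℓ → A → C q
    hung zero    β       y a = y , a
    hung (suc q) []      y a = y , inj₁ a
    hung (suc q) (e ∷ β) y a = inj₂ e , inj₂ (hung q β y a)

    Valid : List E → Set
    Valid = All (λ e → Adv (bs (proj₁ e)) (proj₂ e))

    node-hung : ∀ q β y → hangs y ≡ nothing → node q β y ≡ hung q β y (tl ℓ y)
    node-hung zero    β       y eq = refl
    node-hung (suc q) []      y eq = cong (λ m → y , point′ q (tl ℓ y) m) eq
    node-hung (suc q) (e ∷ β) y eq = cong (λ c → inj₂ e , inj₂ c) (node-hung q β y eq)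

    node-root : ∀ q s → node q [] (anchor ℓ s) ≡ rootZ q s
    node-root zero    s = refl
    node-root (suc q) s = refl

    -- The bound on `β` ensures that a further block does hang at the leaf. The walks that are
    -- extended have length at most `L₀`, so trees of depth `L` are deep enough.
    glue : ∀ q β x d → Adv (bs x) d → length β < q →
      node q (β ++ (x , d) ∷ []) (anchor ℓ (nxt (bs x) d)) ≡ node q β (inj₂ (x , d))
    glue (suc q) [] x d p _ = cong (inj₂ (x , d) ,_)
      (trans (cong inj₂ (node-root q (nxt (bs x) d))) (cong (point′ q (tl ℓ (inj₂ (x , d)))) (sym (hangs-adv x d p))))
    glue (suc q) (e ∷ β) x d p (s≤s lt) = cong (λ c → inj₂ e , inj₂ c) (glue q β x d p lt)

    branch-T : ∀ q e {u c c′} → Adv (bs (proj₁ e)) (proj₂ e) → T (Z q) u c c′ →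
      T (branch q (Z q) (hangs (inj₂ e))) u (inj₂ c) (inj₂ c′)
    branch-T q e {u} {c} {c′} p t = subst (λ m → T (branch q (Z q) m) u (inj₂ c) (inj₂ c′))
      (sym (hangs-adv _ _ p)) (c , c′ , refl , refl , t)

    branch-R : ∀ q e {i v} → Adv (bs (proj₁ e)) (proj₂ e) → R (Z q) i v →
      R (branch q (Z q) (hangs (inj₂ e))) i (map inj₂ v)
    branch-R q e {i} {v} p r = subst (λ m → R (branch q (Z q) m) i (map inj₂ v))
      (sym (hangs-adv _ _ p)) (v , r , refl)

    node-T : ∀ q β {u y y′} → Valid β → T K u y y′ → T (Z q) u (node q β y) (node q β y′)
    node-T zero    β       _        t = acr (inj₁ refl) t (inj₁ refl)
    node-T (suc q) []      _        t = acr (inj₁ refl) t (inj₁ refl)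
    node-T (suc q) (e ∷ β) (p ∷ ps) t = inn (branch-T q e p (node-T q β ps t))

    Z-inn : ∀ q e {i v} → Adv (bs (proj₁ e)) (proj₂ e) → ∀ {B : Set} (f : B → C q) (w : Vec B (ar i)) → v ≡ map f w →
      R (Z q) i v → R (Z (suc q)) i (map (λ b → inj₂ e , inj₂ (f b)) w)
    Z-inn q e {i} p f w refl r = subst (R (Z (suc q)) i)
      (trans (cong (map (inj₂ e ,_)) (sym (Vecₚ.map-∘ inj₂ f w))) (sym (Vecₚ.map-∘ (inj₂ e ,_) (inj₂ ∘ f) w)))
      (inn (inj₂ e) (map inj₂ (map f w)) (branch-R q e p r))

    node-R : ∀ q β {i v} → Valid β → R K i v → R (Z q) i (map (node q β) v)
    node-R zero    β       {v = v} _ r = cor v r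
    node-R (suc q) []      {v = v} _ r = cor v r
    node-R (suc q) (e ∷ β) {v = v} (p ∷ ps) r = Z-inn q e p (node q β) v refl (node-R q β ps r)

    hung-T : ∀ q β y {u a a′} → Valid β → hangs y ≡ nothing → TA u a a′ ≡ true → T (Z q) u (hung q β y a) (hung q β y a′)
    hung-T zero    β       y _ _ t = inn t
    hung-T (suc q) []      y {u} {a} {a′} _ eq t = inn (subst (λ m → T (branch q (Z q) m) u (inj₁ a) (inj₁ a′))
      (sym eq) (a , a′ , refl , refl , t))
    hung-T (suc q) (e ∷ β) y (p ∷ ps) eq t = inn (branch-T q e p (hung-T q β y ps eq t))

    hung-R : ∀ q β y {i v} → Valid β → hangs y ≡ nothing → RA i v ≡ true → R (Z q) i (map (hung q β y) v)
    hung-R zero    β       y {v = v} _ _ r = inn y v r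
    hung-R (suc q) []      y {i} {v} _ eq r = subst (R (Z (suc q)) i) (sym (Vecₚ.map-∘ (y ,_) inj₁ v))
      (inn y (map inj₁ v) (subst (λ m → R (branch q (Z q) m) i (map inj₁ v)) (sym eq) (v , r , refl)))
    hung-R (suc q) (e ∷ β) y {v = v} (p ∷ ps) eq r = Z-inn q e p (hung q β y) v refl (hung-R q β y ps eq r)

    hung-lab : ∀ q β y a → Valid β → hangs y ≡ nothing → labS (Z q) (hung q β y a) ≡ lab a
    hung-lab zero    β       y a _ _ = refl
    hung-lab (suc q) []      y a _ eq = cong (λ m → labS (branch q (Z q) m) (inj₁ a)) eq
    hung-lab (suc q) (e ∷ β) y a (p ∷ ps) eq = trans
      (cong (λ m → labS (branch q (Z q) m) (inj₂ (hung q β y a))) (hangs-adv _ _ p)) (hung-lab q β y a ps eq)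

    _≃_ : S → S → Set
    s ≃ t = s ≡ t ⊎ Tot ℓ s t

    ≃-sym : ∀ {s t} → s ≃ t → t ≃ s
    ≃-sym (inj₁ refl) = inj₁ refl
    ≃-sym (inj₂ T)    = inj₂ (Tot-sym T)

    ≃-trans : ∀ {s t r} → s ≃ t → t ≃ r → s ≃ r
    ≃-trans (inj₁ refl) q           = q
    ≃-trans (inj₂ T)    (inj₁ refl) = inj₂ T
    ≃-trans (inj₂ T)    (inj₂ T′)   = inj₂ (Tot-trans T T′)

    _≃?_ : ∀ s t → Dec (s ≃ t)
    s ≃? t = code-≟ code-S s t ⊎-dec Tot? ℓ s t

    Tot↑ : ∀ {s t} → Tot ℓ s t → Tot (suc ℓ) s t
    Tot↑ = go ℓ
      where
      go : ∀ ℓ {s t} → Tot ℓ s t → Tot (suc ℓ) s t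
      go zero    T = ⊥-elim (Tot-zero T)
      go (suc _) T = Tot-suc T

    Um↓ : ∀ {s t u} → Tot ℓ s t → Um (suc ℓ) u s → Um ℓ u s
    Um↓ = go ℓ
      where
      go : ∀ ℓ {s t u} → Tot ℓ s t → Um (suc ℓ) u s → Um ℓ u s
      go zero    T _ = ⊥-elim (Tot-zero T)
      go (suc _) _ m = Um-suc m

    ≃-Tot : ∀ {s t} → s ≃ t → Tot (suc ℓ) s s → Tot (suc ℓ) s t
    ≃-Tot (inj₁ refl) T = T
    ≃-Tot (inj₂ T)    _ = Tot↑ T

    nrm′ : (x : X ℓ) → Dec (Tot ℓ (bs x) (bs x)) → X ℓ
    nrm′ x (yes _) = x
    nrm′ x (no _)  = root ℓ (bs x)

    -- states alone in their class of level ℓ are replaced by the root of their block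
    nrm : X ℓ → X ℓ
    nrm x = nrm′ x (Tot? ℓ (bs x) (bs x))

    base-nrm : ∀ x → bs (nrm x) ≡ bs x
    base-nrm x with Tot? ℓ (bs x) (bs x)
    ... | yes _ = refl
    ... | no _  = base-root ℓ (bs x)

    nrm-root : ∀ s → nrm (root ℓ s) ≡ root ℓ s
    nrm-root s with Tot? ℓ (bs (root ℓ s)) (bs (root ℓ s))
    ... | yes _ = refl
    ... | no _  = cong (root ℓ) (base-root ℓ s)

    nrm-fix : ∀ x → Tot ℓ (bs x) (bs x) → nrm x ≡ x
    nrm-fix x T with Tot? ℓ (bs x) (bs x)
    ... | yes _ = refl
    ... | no ¬T = ⊥-elim (¬T T)

    Link : E → X ℓ → Set
    Link (x , d) x′ = Adv (bs x) d × (bs x′ ≃ nxt (bs x) d)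

    Link? : ∀ e x → Dec (Link e x)
    Link? (x , d) x′ = Adv? (bs x) d ×-dec (bs x′ ≃? nxt (bs x) d)

    -- the part of the recorded history, of length at most p, that is consistent with the current state,
    -- oldest entry first, together with the state at which it starts
    walk  : ∀ {m} → ℕ → Vec (Maybe E) m → X ℓ → List E × X ℓ
    walk′ : ∀ {m} → ℕ → Vec (Maybe E) m → (e : E) (x : X ℓ) → Dec (Link e x) → List E × X ℓ
    walk zero    h            x = [] , x
    walk (suc p) []           x = [] , x
    walk (suc p) (nothing ∷ h) x = [] , x
    walk (suc p) (just e ∷ h) x = walk′ p h e x (Link? e x)
    walk′ p h (x′ , d) x (yes _) = proj₁ (walk p h x′) ++ (nrm x′ , d) ∷ [] , proj₂ (walk p h x′)
    walk′ p h e        x (no _)  = [] , x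

    walk-length : ∀ {m} p (h : Vec (Maybe E) m) x → length (proj₁ (walk p h x)) ≤ p
    walk-length zero    h             x = z≤n
    walk-length (suc p) []            x = z≤n
    walk-length (suc p) (nothing ∷ h) x = z≤n
    walk-length (suc p) (just e ∷ h)  x with Link? e x
    ... | yes _ = ≤-trans (≤-reflexive (trans (Listₚ.length-++ (proj₁ (walk p h (proj₁ e)))) (+-comm _ 1)))
                    (s≤s (walk-length p h (proj₁ e)))
    ... | no _  = z≤n

    walk-valid : ∀ {m} p (h : Vec (Maybe E) m) x → Valid (proj₁ (walk p h x))
    walk-valid zero    h             x = []
    walk-valid (suc p) []            x = []
    walk-valid (suc p) (nothing ∷ h) x = []
    walk-valid (suc p) (just e ∷ h)  x with Link? e x
    ... | yes (a , _) = Allₚ.++⁺ (walk-valid p h (proj₁ e))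
                          (subst (λ s → Adv s (proj₂ e)) (sym (base-nrm (proj₁ e))) a ∷ [])
    ... | no _  = []

    walk-dropLast : ∀ {m} p (h : Vec (Maybe E) (suc m)) x → p ≤ m → walk p (dropLast h) x ≡ walk p h x
    walk-dropLast zero    h x _ = refl
    walk-dropLast {suc m} (suc p) (nothing ∷ h) x (s≤s le) = refl
    walk-dropLast {suc m} (suc p) (just e ∷ h) x (s≤s le) with Link? e x
    ... | yes _ rewrite walk-dropLast p h (proj₁ e) le = refl
    ... | no _  = refl

    -- The trees are indexed by representatives of the classes, because an inner step may change the
    -- state at which a walk starts, but not its class. `s*` represents its own class, so the anchor
    -- of the query becomes the root of the tree of `s*`.
    module Class (s* : S) where

      canon : S → S
      canon s = first s (filter (_≃? s) (allCode code-S))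

      cl′ : ∀ s → Dec (s ≃ s*) → S
      cl′ s (yes _) = s*
      cl′ s (no _)  = canon s

      cl : S → S
      cl s = cl′ s (s ≃? s*)

      first-All : ∀ {P : S → Set} {d} → P d → ∀ {l} → All P l → P (first d l)
      first-All p []      = p
      first-All p (q ∷ _) = q

      cl-≃ : ∀ s → cl s ≃ s
      cl-≃ s with s ≃? s*
      ... | yes p = ≃-sym p
      ... | no _  = first-All {_≃ s} (inj₁ refl) (Allₚ.all-filter (_≃? s) (allCode code-S))

      first-∈ : ∀ {d d′ x : S} {l} → x ∈ l → first d l ≡ first d′ l
      first-∈ {l = _ ∷ _} _ = refl

      canon-cong : ∀ {s t} → s ≃ t → canon s ≡ canon t
      canon-cong {s} {t} p = trans
        (first-∈ (∈-filter⁺ (_≃? s) (∈-allCode code-S s) (inj₁ refl)))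
        (cong (first t) (filter-ext (_≃? s) (_≃? t) (λ q → ≃-trans q p) (λ q → ≃-trans q (≃-sym p)) (allCode code-S)))

      cl-cong : ∀ {s t} → s ≃ t → cl s ≡ cl t
      cl-cong {s} {t} p with s ≃? s* | t ≃? s*
      ... | yes _ | yes _ = refl
      ... | yes q | no ¬r = ⊥-elim (¬r (≃-trans (≃-sym p) q))
      ... | no ¬q | yes r = ⊥-elim (¬q (≃-trans p r))
      ... | no _  | no _  = canon-cong p

      cl-self : cl s* ≡ s*
      cl-self with s* ≃? s*
      ... | yes _ = refl
      ... | no ¬p = ⊥-elim (¬p (inj₁ refl))

      walk-inner : ∀ {m} p (h : Vec (Maybe E) m) {x x′} → bs x ≃ bs x′ →
        proj₁ (walk p h x) ≡ proj₁ (walk p h x′) × cl (bs (proj₂ (walk p h x))) ≡ cl (bs (proj₂ (walk p h x′)))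
      walk-inner zero    h             q = refl , cl-cong q
      walk-inner (suc p) []            q = refl , cl-cong q
      walk-inner (suc p) (nothing ∷ h) q = refl , cl-cong q
      walk-inner (suc p) (just e ∷ h) {x} {x′} q with Link? e x | Link? e x′
      ... | yes _ | yes _ = refl , refl
      ... | yes (a , l) | no ¬l = ⊥-elim (¬l (a , ≃-trans (≃-sym q) l))
      ... | no ¬l | yes (a , l) = ⊥-elim (¬l (a , ≃-trans q l))
      ... | no _ | no _ = refl , cl-cong q

      hubCore : Str S
      hubCore = record { labS = lab ∘ el ; R = λ _ _ → ⊥ ; T = λ u s t → Tot (suc ℓ) s t × Um (suc ℓ) u s
                       ; T-trans = λ { (T , m) (T′ , _) → Tot-trans T T′ , m } }

      -- The trees are joined along a clique of level suc ℓ, which is mapped into a clique of the model.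
      Hub : Str (S × C L)
      Hub = amalgam hubCore (λ _ → Z L) (rootZ L)

      Ok-Hub : ∀ s → Ok Hub (s , rootZ L s) (proj₁ (hub ℓ) s)
      Ok-Hub s = collapse (code-≟ code-S) hubCore (λ _ → Z L) (rootZ L) c
        (λ t → transfer (C-≟ L) (trans (cong (tp ∘ el) (base-root ℓ t)) (sym (proj₁ (proj₂ (hub ℓ)) t))) (Ok-Z L t)) s
        (Ok-exact hubCore c (λ ()) (λ { (T , m) → proj₂ (proj₂ (hub ℓ)) T m }) s)
        where c = proj₁ (hub ℓ)

      Lk² : Fin k → C L → C L → Set
      Lk² u z z′ = Lk (Z L) u z z′ × Lk (Z L) u z′ z

      Lk²-trans : ∀ {u z z′ z″} → Lk² u z z′ → Lk² u z′ z″ → Lk² u z z″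
      Lk²-trans (p , q) (p′ , q′) = Lk-trans (Z L) p p′ , Lk-trans (Z L) q′ q

      -- If `bs x` is not total with itself, `nrm` has already moved `x` to the root; otherwise
      -- total edges lead to the root and back.
      block : ∀ {u} β {x s} → Valid β → bs x ≃ s → Um (suc ℓ) u (bs x) →
        Lk² u (node L β (inj₁ (nrm x))) (node L β (anchor ℓ s))
      block {u} β {x} {s} v p um with Tot? ℓ (bs x) (bs x)
      block {u} β {x} {s} v (inj₁ refl) um | no _ = inj₁ refl , inj₁ refl
      block {u} β {x} {s} v (inj₂ T) um | no ¬T = ⊥-elim (¬T (Tot-trans T (Tot-sym T)))
      block {u} β {x} {s} v p um | yes T₀ =
          inj₂ (node-T L β v (one (inj₂ (x , root ℓ s , T₁ , Um↓ T₁ um , refl , refl))))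
        , inj₂ (node-T L β v (one (inj₂ (root ℓ s , x , Tot-sym T₁ , Tot-Um T₁ (Um↓ T₁ um) , refl , refl))))
        where
        T₁ : Tot ℓ (bs x) (bs (root ℓ s))
        T₁ = subst (Tot ℓ (bs x)) (sym (base-root ℓ s)) ([ (λ e → subst (Tot ℓ (bs x)) e T₀) , id ]′ p)

      mem-leaf : ∀ x d → ¬ In ℓ (bs x) d → mem ℓ x (just d) ≡ inj₂ (x , d)
      mem-leaf x d ¬p with In? ℓ (bs x) d
      ... | yes p = ⊥-elim (¬p p)
      ... | no _  = refl

      leaf-link : ∀ {u} β x d → Valid β → Adv (bs x) d → Um (suc ℓ) u (bs x) →
        Lk² u (node L β (inj₂ (x , d))) (node L β (inj₁ x))
      leaf-link β x d v (p , ¬q) um =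
          inj₂ (node-T L β v (one (inj₁ (x , just d , nothing , tt , proj₂ (In-edge p um) , sym (mem-leaf x d ¬q) , refl))))
        , inj₂ (node-T L β v (one (inj₁ (x , nothing , just d , tt , proj₁ (In-edge p um) , refl , sym (mem-leaf x d ¬q)))))

      -- The walk is retraced to the root of the tree: within a block by `block`, across a leaf by
      -- `In-edge`, which holds in both directions. A total edge of level `suc ℓ` can therefore be
      -- simulated through the roots, where `hubCore` relates them.
      connect : ∀ {u m} p (h : Vec (Maybe E) m) x → p ≤ L₀ → Um (suc ℓ) u (bs x) → Tot (suc ℓ) (bs x) (bs x) →
        Tot (suc ℓ) (bs x) (cl (bs (proj₂ (walk p h x)))) ×
        Lk² u (node L (proj₁ (walk p h x)) (inj₁ (nrm x))) (rootZ L (cl (bs (proj₂ (walk p h x)))))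
      connect {u} p h x p≤ um T = go p h p≤
        where
        top : Tot (suc ℓ) (bs x) (cl (bs x)) × Lk² u (node L [] (inj₁ (nrm x))) (rootZ L (cl (bs x)))
        top = ≃-Tot (≃-sym (cl-≃ (bs x))) T , block [] [] (≃-sym (cl-≃ (bs x))) um
        go : ∀ {m} p (h : Vec (Maybe E) m) → p ≤ L₀ → Tot (suc ℓ) (bs x) (cl (bs (proj₂ (walk p h x)))) ×
          Lk² u (node L (proj₁ (walk p h x)) (inj₁ (nrm x))) (rootZ L (cl (bs (proj₂ (walk p h x)))))
        go zero    h             _ = top
        go (suc p) []            _ = top
        go (suc p) (nothing ∷ h) _ = top
        go (suc p) (just e@(x′ , d) ∷ h) p< with Link? e x
        ... | no _ = top
        ... | yes (a , l) = Tot-trans (≃-Tot l T) (Tot-trans (Tot-sym step) T′) ,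
          Lk²-trans (block (β ++ (nrm x′ , d) ∷ []) (Allₚ.++⁺ v (a′ ∷ [])) l um)
            (Lk²-trans (subst (λ z → Lk² u z (node L β (inj₂ (nrm x′ , d)))) (sym glued) (inj₁ refl , inj₁ refl))
              (Lk²-trans (leaf-link β (nrm x′) d v a′ (subst (Um (suc ℓ) u) (sym (base-nrm x′)) um′)) lk′))
          where
          β = proj₁ (walk p h x′)
          v = walk-valid p h x′
          a′ : Adv (bs (nrm x′)) d
          a′ = subst (λ s → Adv s d) (sym (base-nrm x′)) a
          step : Tot (suc ℓ) (bs x′) (nxt (bs x′) d)
          step = In-Tot (proj₁ a)
          um′ : Um (suc ℓ) u (bs x′)
          um′ = Tot-Um (Tot-sym step) (Tot-Um (≃-Tot l T) um)
          rec = connect p h x′ (≤-trans (n≤1+n p) p<) um′ (Tot-trans step (Tot-sym step))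
          T′ = proj₁ rec
          lk′ = proj₂ rec
          glued : node L (β ++ (nrm x′ , d) ∷ []) (anchor ℓ (nxt (bs x′) d)) ≡ node L β (inj₂ (nrm x′ , d))
          glued = trans (cong (λ s → node L (β ++ (nrm x′ , d) ∷ []) (anchor ℓ (nxt s d))) (sym (base-nrm x′)))
            (glue L β (nrm x′) d a′ (s≤s (≤-trans (walk-length p h x′) (≤-trans (n≤1+n p) p<))))

      child-inner : ∀ i h x d → In ℓ (bs x) d → child (suc ℓ) (i , h , x) d ≡ (i , h , child ℓ x d)
      child-inner i h x d p with In? ℓ (bs x) d
      ... | yes _ = refl
      ... | no ¬p = ⊥-elim (¬p p)

      child-adv : ∀ i h x d → ¬ In ℓ (bs x) d →
        child (suc ℓ) (i , h , x) d ≡ (next i , just (x , d) ∷ dropLast h , root ℓ (nxt (bs x) d))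
      child-adv i h x d ¬p with In? ℓ (bs x) d
      ... | yes p = ⊥-elim (¬p p)
      ... | no _  = refl

      mem-inner : ∀ x d → In ℓ (bs x) d → mem ℓ x (just d) ≡ inj₁ (child ℓ x d)
      mem-inner x d p with In? ℓ (bs x) d
      ... | yes _ = refl
      ... | no ¬p = ⊥-elim (¬p p)

      walk-link : ∀ {m} p (h : Vec (Maybe E) m) x′ d x → Link (x′ , d) x →
        walk (suc p) (just (x′ , d) ∷ h) x ≡ (proj₁ (walk p h x′) ++ (nrm x′ , d) ∷ [] , proj₂ (walk p h x′))
      walk-link p h x′ d x l with Link? (x′ , d) x
      ... | yes _ = refl
      ... | no ¬l = ⊥-elim (¬l l)

      walk-fresh : ∀ p {m} x → walk p (Vec.replicate (suc m) nothing) x ≡ ([] , x)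
      walk-fresh zero    x = refl
      walk-fresh (suc p) x = refl

      module Cut (κ : Fin L) where

        P : X (suc ℓ) → Set
        P (i , _) = ¬ (i ≡ κ)

        Mκ : Str (Y (suc ℓ) × A)
        Mκ = withModel (core (suc ℓ) P) (tl (suc ℓ))

        way : X (suc ℓ) → List E × X ℓ
        way (i , h , x) = walk (distance κ i) h x

        distance-≤ : ∀ i → distance κ i ≤ L₀
        distance-≤ i = ≤-pred (distance-< κ i)

        cls : X (suc ℓ) → S
        cls x = cl (bs (proj₂ (way x)))

        valid : ∀ x → Valid (proj₁ (way x))
        valid (i , h , x) = walk-valid (distance κ i) h x

        centre : Y (suc ℓ) → X (suc ℓ)
        centre (inj₁ x)       = x
        centre (inj₂ (x , _)) = x

        target′ : ∀ (x : X ℓ) d → Dec (In (suc ℓ) (bs x) d) → Y ℓ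
        target′ x d (yes _) = inj₁ (nrm x)
        target′ x d (no _)  = inj₂ (nrm x , d)

        -- a leaf whose step stays inside level suc ℓ is never used; it is sent to its centre
        target : Y (suc ℓ) → Y ℓ
        target (inj₁ (_ , _ , x))       = inj₁ (nrm x)
        target (inj₂ ((_ , _ , x) , d)) = target′ x d (In? (suc ℓ) (bs x) d)

        target-hangs : ∀ y → hangs (target y) ≡ nothing
        target-hangs (inj₁ _) = refl
        target-hangs (inj₂ ((_ , _ , x) , d)) with In? (suc ℓ) (bs x) d
        ... | yes _ = refl
        ... | no ¬p = hangs-not (nrm x) d (λ a → ¬p (subst (λ s → In (suc ℓ) s d) (base-nrm x) (proj₁ a)))

        -- If no centre of colour κ is used, truncating histories at κ maps the cyclic structure into a tree.
        F : Y (suc ℓ) × A → S × C L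
        F (y , a) = cls (centre y) , hung L (proj₁ (way (centre y))) (target y) a

        fnode : Y (suc ℓ) → S × C L
        fnode y = F (y , tl (suc ℓ) y)

        at : (x : X (suc ℓ)) → Y ℓ → S × C L
        at x y = cls x , node L (proj₁ (way x)) y

        state-node : ∀ i h x → fnode (inj₁ (i , h , x)) ≡ at (i , h , x) (inj₁ (nrm x))
        state-node i h x = cong (cls (i , h , x) ,_) (trans
          (cong (λ s → hung L (proj₁ (way (i , h , x))) (inj₁ (nrm x)) (el s)) (sym (base-nrm x)))
          (sym (node-hung L _ (inj₁ (nrm x)) refl)))

        leaf-node : ∀ i h x d → ¬ In (suc ℓ) (bs x) d → fnode (inj₂ ((i , h , x) , d)) ≡ at (i , h , x) (inj₂ (nrm x , d))
        leaf-node i h x d ¬p with In? (suc ℓ) (bs x) d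
        ... | yes p = ⊥-elim (¬p p)
        ... | no _ = cong (cls (i , h , x) ,_) (trans
          (cong (λ s → hung L (proj₁ (way (i , h , x))) (inj₂ (nrm x , d)) (ch (el s) d)) (sym (base-nrm x)))
          (sym (node-hung L _ (inj₂ (nrm x , d))
            (hangs-not (nrm x) d (λ a → ¬p (subst (λ s → In (suc ℓ) s d) (base-nrm x) (proj₁ a)))))))

        -- An inner step changes neither the walk nor the class. An advancing step increases the
        -- distance from `κ` by one, so exactly its own new history entry is read in addition, and
        -- `glue` identifies the leaf with the new root. At colour `κ` the distance would fall back
        -- to zero instead.
        member : ∀ i h x m → ¬ (i ≡ κ) → fnode (mem (suc ℓ) (i , h , x) m) ≡ at (i , h , x) (mem ℓ (nrm x) m)
        member i h x nothing  _   = state-node i h x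
        member i h x (just d) i≢κ = go (In? (suc ℓ) (bs x) d) (In? ℓ (bs x) d)
          where
          x̂ = (i , h , x)
          go : (p? : Dec (In (suc ℓ) (bs x) d)) → Dec (In ℓ (bs x) d) →
            fnode (mem′ (suc ℓ) x̂ d p?) ≡ at x̂ (mem ℓ (nrm x) (just d))
          go (no ¬p) _ = trans (leaf-node i h x d ¬p)
            (cong (at x̂) (sym (mem-leaf (nrm x) d (λ q → ¬p (In-suc (subst (λ s → In ℓ s d) (base-nrm x) q))))))
          go (yes p) (yes q) = trans (cong (fnode ∘ inj₁) (child-inner i h x d q))
            (trans (state-node i h (child ℓ x d)) (cong₂ _,_ (sym (proj₂ inner))
              (cong₂ (node L) (sym (proj₁ inner)) (trans (cong inj₁ (nrm-fix _ T₂))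
                (sym (trans (cong (λ z → mem ℓ z (just d)) (nrm-fix x T₀)) (mem-inner x d q)))))))
            where
            T₁ : Tot ℓ (bs x) (bs (child ℓ x d))
            T₁ = subst (Tot ℓ (bs x)) (sym (base-child ℓ x d q)) (In-Tot q)
            T₀ : Tot ℓ (bs x) (bs x)
            T₀ = Tot-trans T₁ (Tot-sym T₁)
            T₂ : Tot ℓ (bs (child ℓ x d)) (bs (child ℓ x d))
            T₂ = Tot-trans (Tot-sym T₁) T₁
            inner = walk-inner (distance κ i) h {x} {child ℓ x d} (inj₂ T₁)
          go (yes p) (no ¬q) = trans (cong (fnode ∘ inj₁) (child-adv i h x d ¬q))
            (trans (state-node (next i) (just (x , d) ∷ dropLast h) (root ℓ s′))
              (cong₂ _,_ (cong (cl ∘ bs ∘ proj₂) way≡)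
                (trans (cong₂ (λ w z → node L (proj₁ w) (inj₁ z)) way≡ (nrm-root s′))
                  (trans (cong (λ s → node L (β ++ (nrm x , d) ∷ []) (anchor ℓ (nxt s d))) (sym (base-nrm x)))
                    (trans (glue L β (nrm x) d a′ (s≤s (≤-trans (walk-length (distance κ i) h x) (distance-≤ i))))
                      (cong (node L β) (sym (mem-leaf (nrm x) d (proj₂ a′)))))))))
            where
            s′ = nxt (bs x) d
            β = proj₁ (way x̂)
            a′ : Adv (bs (nrm x)) d
            a′ = subst (λ s → Adv s d) (sym (base-nrm x)) (p , ¬q)
            way≡ : way (next i , just (x , d) ∷ dropLast h , root ℓ s′) ≡
              (β ++ (nrm x , d) ∷ [] , proj₂ (way x̂))
            way≡ = trans (cong (λ z → walk z (just (x , d) ∷ dropLast h) (root ℓ s′)) (distance-next κ i i≢κ))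
              (trans (walk-link (distance κ i) (dropLast h) x d (root ℓ s′) ((p , ¬q) , inj₁ (base-root ℓ s′)))
                (cong (λ w → proj₁ w ++ (nrm x , d) ∷ [] , proj₂ w)
                  (walk-dropLast (distance κ i) h x (distance-≤ i))))

        edge-F : ∀ {u y y′} → Core.Edge (suc ℓ) P u y y′ → T Hub u (fnode y) (fnode y′)
        edge-F {u} (inj₁ ((i , h , x) , m , m′ , i≢κ , t , refl , refl)) =
          subst₂ (T Hub u) (sym (member i h x m i≢κ)) (sym (member i h x m′ i≢κ))
            (inn (node-T L _ (valid (i , h , x)) (one (inj₁ (nrm x , m , m′ , tt ,
              subst (λ s → TA u (val s m) (val s m′) ≡ true) (sym (base-nrm x)) t , refl , refl)))))
        edge-F {u} (inj₂ (x₁@(i , h , x) , x₂@(i′ , h′ , x′) , T₁ , um , refl , refl)) =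
          subst₂ (T Hub u) (sym (state-node i h x)) (sym (state-node i′ h′ x′))
            (acr (proj₁ (proj₂ c₁)) (Tot-trans (Tot-sym (proj₁ c₁)) (Tot-trans T₁ (proj₁ c₂)) , Tot-Um (proj₁ c₁) um)
              (proj₂ (proj₂ c₂)))
          where
          c₁ = connect (distance κ i) h x (distance-≤ i) um (Tot-trans T₁ (Tot-sym T₁))
          c₂ = connect (distance κ i′) h′ x′ (distance-≤ i′) (Tot-Um T₁ um) (Tot-trans (Tot-sym T₁) T₁)

        inside-F : ∀ {u} y {a a′} → TA u a a′ ≡ true → T Hub u (F (y , a)) (F (y , a′))
        inside-F y t = inn (hung-T L _ (target y) (valid (centre y)) (target-hangs y) t)

        link-F : ∀ {u} y {a a′} → Lk modelStr u a a′ → Lk Hub u (F (y , a)) (F (y , a′))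
        link-F y (inj₁ refl) = inj₁ refl
        link-F y (inj₂ t)    = inj₂ (inside-F y t)

        T-F : ∀ {u z z′} → T Mκ u z z′ → T Hub u (F z) (F z′)
        T-F (inn {y} t) = inside-F y t
        T-F {u} (acr {y} {c} {y′} {c′} p t q) = T-Lk Hub (Lk-T Hub (link-F y p)
          (path-fold fnode {T Hub u} (T-trans Hub) edge-F t)) (link-F y′ q)

        R-F : ∀ {i v} → R Mκ i v → R Hub i (map F v)
        R-F {i} (inn y v r) = subst (R Hub i)
          (trans (sym (Vecₚ.map-∘ (cls (centre y) ,_) (hung L _ (target y)) v)) (Vecₚ.map-∘ F (y ,_) v))
          (inn (cls (centre y)) _ (hung-R L _ (target y) (valid (centre y)) (target-hangs y) r))
        R-F {j} (cor _ ((i , h , x) , ms , i≢κ , r , refl)) = subst (R Hub j)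
          (trans (sym (Vecₚ.map-∘ (cls x̂ ,_) (node L (proj₁ (way x̂))) _))
            (trans (sym (Vecₚ.map-∘ (at x̂) (mem ℓ (nrm x)) ms))
              (trans (Vecₚ.map-cong (λ m → sym (member i h x m i≢κ)) ms)
                (trans (Vecₚ.map-∘ fnode (mem (suc ℓ) x̂) ms) (Vecₚ.map-∘ F (λ y → y , tl (suc ℓ) y) _)))))
          (inn (cls x̂) _ (node-R L _ (valid x̂) (nrm x , ms , tt ,
            subst (λ s → RA j (map (val s) ms) ≡ true) (sym (base-nrm x)) r , refl)))
          where x̂ = (i , h , x)

        Ok-cut : Ok Mκ (anchor (suc ℓ) s* , tl (suc ℓ) (anchor (suc ℓ) s*)) (proj₁ (hub ℓ) s*)
        Ok-cut = Ok-hom F (λ { {y , a} → hung-lab L _ (target y) a (valid (centre y)) (target-hangs y) }) R-F T-F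
          (subst (λ z → Ok Hub z (proj₁ (hub ℓ) s*)) (sym F-anchor) (Ok-Hub s*))
          where
          w≡ : way (root (suc ℓ) s*) ≡ ([] , root ℓ s*)
          w≡ = walk-fresh (distance κ zero) (root ℓ s*)
          F-anchor : fnode (anchor (suc ℓ) s*) ≡ (s* , rootZ L s*)
          F-anchor = trans (state-node zero (Vec.replicate L nothing) (root ℓ s*))
            (cong₂ _,_ (trans (cong (cl ∘ bs ∘ proj₂) w≡) (trans (cong cl (base-root ℓ s*)) cl-self))
              (trans (cong₂ (λ w z → node L (proj₁ w) (inj₁ z)) w≡ (nrm-root s*)) (node-root L s*)))

    spread : ℕ
    spread = suc M + (suc M + suc M)

    -- The path is supplied by the decision procedure, so the colours depend on the end points
    -- alone; `κ` must be fixed before any particular proof of a relation is given.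
    colours : Fin k → Y (suc ℓ) → Y (suc ℓ) → List (Fin L)
    colours u y y′ with path? (suc ℓ) u y y′
    ... | yes p = proj₁ (Span.span ℓ ℓ≤J u p)
    ... | no _  = []

    colours-length : ∀ u y y′ → length (colours u y y′) ≤ spread
    colours-length u y y′ with path? (suc ℓ) u y y′
    ... | yes p = proj₁ (proj₂ (Span.span ℓ ℓ≤J u p))
    ... | no _  = z≤n

    colours-path : ∀ u y y′ → Path (Core.Edge (suc ℓ) (All⊤ (suc ℓ)) u) y y′ →
      Path (Core.Edge (suc ℓ) (λ x → proj₁ x ∈ colours u y y′) u) y y′
    colours-path u y y′ q with path? (suc ℓ) u y y′
    ... | yes p = proj₂ (proj₂ (Span.span ℓ ℓ≤J u p))
    ... | no ¬p = ⊥-elim (¬p q)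

    fact-colours : Fact (full (suc ℓ)) → List (Fin L)
    fact-colours (fact _ _ _ (inn _ _ _))       = []
    fact-colours (fact _ _ _ (cor _ (x , _)))   = proj₁ x ∷ []

    fact-colours-length : ∀ f → length (fact-colours f) ≤ 1
    fact-colours-length (fact _ _ _ (inn _ _ _)) = z≤n
    fact-colours-length (fact _ _ _ (cor _ _))   = ≤-refl

    module Query (s : S) (zs : List (Y (suc ℓ) × A)) (zs≤ : length zs ≤ nv)
      (Γ : List (Fact (full (suc ℓ)))) (Γ≤ : length Γ ≤ nf)
      (big : k * (suc nv * (suc nv * spread)) + nf * 1 ≤ L₀) where

      p : Y (suc ℓ) × A
      p = anchor (suc ℓ) s , tl (suc ℓ) (anchor (suc ℓ) s)

      rows : Fin k → Y (suc ℓ) × A → List (Fin L)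
      rows u z = concatMap (λ z′ → colours u (proj₁ z) (proj₁ z′)) (p ∷ zs)

      pairs : Fin k → List (Fin L)
      pairs u = concatMap (rows u) (p ∷ zs)

      -- At most `spread` colours for each symbol and each ordered pair of the `suc nv` points, and
      -- at most one for each base fact: this is the count in `big`.
      forbidden : List (Fin L)
      forbidden = concatMap pairs (allFin k) ++ concatMap fact-colours Γ

      forbidden-length : length forbidden ≤ L₀
      forbidden-length = ≤-trans (≤-reflexive (Listₚ.length-++ (concatMap pairs (allFin k))))
        (≤-trans (+-mono-≤
          (≤-trans (concatMap-length pairs _ (λ u →
              ≤-trans (concatMap-length (rows u) _ (λ z →
                ≤-trans (concatMap-length (λ z′ → colours u (proj₁ z) (proj₁ z′)) spread (λ z′ → colours-length u (proj₁ z) (proj₁ z′)) (p ∷ zs))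
                  (*-monoˡ-≤ spread (s≤s zs≤))) (p ∷ zs))
                (*-monoˡ-≤ (suc nv * spread) (s≤s zs≤))) (allFin k))
            (≤-reflexive (cong (_* (suc nv * (suc nv * spread))) (Listₚ.length-tabulate {n = k} id))))
          (≤-trans (concatMap-length fact-colours 1 fact-colours-length Γ) (*-monoˡ-≤ 1 Γ≤)))
          big)

      κ : Fin L
      κ = proj₁ (missing L forbidden (s≤s forbidden-length))

      κ∉ : ¬ (κ ∈ forbidden)
      κ∉ = proj₂ (missing L forbidden (s≤s forbidden-length))

      open Class s
      open Cut κ

      path-κ : ∀ u {z z′} → z ∈ (p ∷ zs) → z′ ∈ (p ∷ zs) →
        Path (Core.Edge (suc ℓ) (All⊤ (suc ℓ)) u) (proj₁ z) (proj₁ z′) →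
        Path (Core.Edge (suc ℓ) P u) (proj₁ z) (proj₁ z′)
      path-κ u {z} {z′} z∈ z′∈ q = path-map avoid (colours-path u (proj₁ z) (proj₁ z′) q)
        where
        avoid : ∀ {y y′} → Core.Edge (suc ℓ) (λ x → proj₁ x ∈ colours u (proj₁ z) (proj₁ z′)) u y y′ →
          Core.Edge (suc ℓ) P u y y′
        avoid (inj₁ (x , m , m′ , c∈ , r)) = inj₁ (x , m , m′ , (λ eq → κ∉ (∈-++⁺ˡ
          (∈-concatMap pairs (∈-allFin u) (∈-concatMap (rows u) z∈ (∈-concatMap _ z′∈
            (subst (_∈ colours u (proj₁ z) (proj₁ z′)) eq c∈)))))) , r)
        avoid (inj₂ t) = inj₂ t

      T-κ : ∀ u {z z′} → z ∈ (p ∷ zs) → z′ ∈ (p ∷ zs) → T (full (suc ℓ)) u z z′ → T Mκ u z z′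
      T-κ u z∈ z′∈ (inn t) = inn t
      T-κ u z∈ z′∈ (acr l t r) = acr l (path-κ u z∈ z′∈ t) r

      R-κ : ∀ (f : Fact (full (suc ℓ))) → (∀ {c} → c ∈ fact-colours f → ¬ (c ≡ κ)) → R Mκ (rsym f) (args f)
      R-κ (fact i us _ (inn y v r)) av = inn y v r
      R-κ (fact i us _ (cor v (x , ms , _ , r))) av = cor v (x , ms , av (here refl) , r)

      Good : Fact (full (suc ℓ)) → Set
      Good f = R Mκ (rsym f) (args f)

      good : All Good Γ
      good = All.tabulate (λ {f} f∈ → R-κ f (λ c∈ eq → κ∉ (∈-++⁺ʳ (concatMap pairs (allFin k))
        (∈-concatMap fact-colours f∈ (subst (_∈ fact-colours f) eq c∈)))))

      cutFacts : ∀ {Γ} → All Good Γ → List (Fact Mκ)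
      cutFacts = All.reduce (λ {f} r → fact (rsym f) (use f) (args f) r)

      cutFacts-length : ∀ {Γ} (g : All Good Γ) → length (cutFacts g) ≡ length Γ
      cutFacts-length []      = refl
      cutFacts-length (_ ∷ g) = cong suc (cutFacts-length g)

      cutFacts-∈ : ∀ {Γ f} (g : All Good Γ) → f ∈ Γ → Σ (Good f) λ r → fact (rsym f) (use f) (args f) r ∈ cutFacts g
      cutFacts-∈ (r ∷ _) (here refl) = r , here refl
      cutFacts-∈ (_ ∷ g) (there i) = let r , j = cutFacts-∈ g i in r , there j

      answer : Σ (Y (suc ℓ) × A → A) λ h → h p ≡ proj₁ (hub ℓ) s × Pres (full (suc ℓ)) (p ∷ zs) Γ h
      answer =
        let h , hp , pr = Ok-cut zs zs≤ (cutFacts good) (≤-trans (≤-reflexive (cutFacts-length good)) Γ≤)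
        in h , hp , pres (λ u z∈ z′∈ t → T-pres pr u z∈ z′∈ (T-κ u z∈ z′∈ t))
             (lab-pres pr) (λ f∈ → R-pres pr (proj₂ (cutFacts-∈ good f∈)))

    faithful-suc : k * (suc nv * (suc nv * spread)) + nf * 1 ≤ L₀ → Faithful (suc ℓ)
    faithful-suc big s = transfer (Prodₚ.≡-dec (Y-≟ (suc ℓ)) Fin._≟_)
      (trans (proj₁ (proj₂ (hub ℓ)) s) (sym (cong (tp ∘ el) (base-root ℓ s))))
      (λ zs zs≤ Γ Γ≤ → Query.answer s zs zs≤ Γ Γ≤ big)

  module _ (big : k * (suc nv * (suc nv * (suc M + (suc M + suc M)))) + nf * 1 ≤ L₀) where

    faithful : ∀ ℓ → ℓ ≤ suc J → Faithful ℓ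
    faithful zero    _  = faithful-zero
    faithful (suc ℓ) le = Up.faithful-suc ℓ (≤-pred le) (faithful ℓ (≤-trans (n≤1+n ℓ) le)) big

-- The finite structure

-- Two opposite kinds of local homomorphism: `local` carries bounded queries into the model,
-- `witness` carries an element with its chosen witnesses into the cover. Preservation of labels
-- makes both compatible with negated subformulas.
record Cover (𝔐 : Model) {D : ℕ} (ch : Fin (Model.n 𝔐) → Fin D → Fin (Model.n 𝔐)) (N : ℕ) : Set where
  open Model 𝔐
  Near : Fin n → Fin n → Set
  Near a c = c ≡ a ⊎ ∃ λ d → c ≡ ch a d
  field
    proj    : Fin N → Fin n
    RB      : (i : Fin nb) → Vec (Fin N) (ar i) → Bool
    TB      : Fin k → Fin N → Fin N → Bool
    b₀      : Fin N
    TB-trans : ∀ u {x y z} → TB u x y ≡ true → TB u y z ≡ true → TB u x z ≡ true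
    local   : ∀ zs → length zs ≤ nv →
      (Γ : List (Σ (Fin nb) λ i → Use i × Vec (Fin N) (ar i))) → length Γ ≤ nf →
      (∀ {f} → f ∈ Γ → RB (proj₁ f) (proj₂ (proj₂ f)) ≡ true) →
      Σ (Fin N → Fin n) λ h →
        (∀ u {x y} → x ∈ zs → y ∈ zs → TB u x y ≡ true → TA u (h x) (h y) ≡ true)
        × (∀ {x} → x ∈ zs → lab (h x) ≡ lab (proj x))
        × (∀ {f} → f ∈ Γ → RA (proj₁ f) (map h (proj₂ (proj₂ f))) ≡ true)
    witness : ∀ b → Σ (Fin n → Fin N) λ g → g (proj b) ≡ b
        × (∀ {c} → Near (proj b) c → lab (proj (g c)) ≡ lab c)
        × (∀ u {c c′} → Near (proj b) c → Near (proj b) c′ → TA u c c′ ≡ true → TB u (g c) (g c′) ≡ true)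
        × (∀ i v → (∀ j → Near (proj b) (lookup v j)) → RA i v ≡ true → RB i (map g v) ≡ true)

module MakeCover (𝔐 : Model) {Q : ℕ} (tp : Fin (Model.n 𝔐) → Vec Bool Q)
  (transfer : ∀ {C : Set} → DecidableEquality C → {S : Structures.Str 𝔐 C} → ∀ {p a a′} → tp a ≡ tp a′ →
    Structures.Ok 𝔐 S p a → Structures.Ok 𝔐 S p a′)
  (tp-lab : ∀ {a a′} → tp a ≡ tp a′ → Model.lab 𝔐 a′ ≡ Model.lab 𝔐 a)
  (𝔸 : Auto 𝔐 tp) (L₀ : ℕ)
  (big : Model.k 𝔐 * (suc (Model.nv 𝔐) * (suc (Model.nv 𝔐) * (suc (Auto.M 𝔸) + (suc (Auto.M 𝔸) + suc (Auto.M 𝔸)))))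
         + Model.nf 𝔐 * 1 ≤ L₀) where

  open Model 𝔐
  open Structures 𝔐
  open Auto 𝔸 hiding (A)
  open Levels 𝔐 tp 𝔸 L₀
  open Ladder 𝔐 tp transfer 𝔸 L₀

  -- At level `suc J` every step is inner by `In-top`: there are no edges to leaves, and the states
  -- alone form the structure.
  top e N : ℕ
  top = suc J
  e   = eX top
  N   = 2 ^ e

  private
    X̂ : Set
    X̂ = X top

    bs : X̂ → S
    bs = base top

  dc : Fin N → X̂
  dc i = dec (code-X top) (fin→bits e i)

  ec : X̂ → Fin N
  ec x = bits→fin e (enc (code-X top) x)

  dc-ec : ∀ x → dc (ec x) ≡ x
  dc-ec x = trans (cong (dec (code-X top)) (fin→bits→fin e _)) (dec-enc (code-X top) x)

  nd : Fin N → Y top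
  nd i = inj₁ (dc i)

  proj : Fin N → A
  proj i = el (bs (dc i))

  RB : (i : Fin nb) → Vec (Fin N) (ar i) → Bool
  RB i v = does (atom? top i (map nd v))

  TB : Fin k → Fin N → Fin N → Bool
  TB u x y = does (path? top u (nd x) (nd y))

  local : ∀ zs → length zs ≤ nv →
    (Γ : List (Σ (Fin nb) λ i → Use i × Vec (Fin N) (ar i))) → length Γ ≤ nf →
    (∀ {f} → f ∈ Γ → RB (proj₁ f) (proj₂ (proj₂ f)) ≡ true) →
    Σ (Fin N → A) λ h →
      (∀ u {x y} → x ∈ zs → y ∈ zs → TB u x y ≡ true → TA u (h x) (h y) ≡ true)
      × (∀ {x} → x ∈ zs → lab (h x) ≡ lab (proj x))
      × (∀ {f} → f ∈ Γ → RA (proj₁ f) (map h (proj₂ (proj₂ f))) ≡ true)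
  local zs zs≤ Γ Γ≤ ok = h ∘ nd′ ,
      (λ u {x} {y} x∈ y∈ t → T-pres pr u (there (∈-map⁺ nd′ x∈)) (there (∈-map⁺ nd′ y∈))
        (acr (inj₁ refl) (does-true (path? top u (nd x) (nd y)) t) (inj₁ refl)))
    , (λ x∈ → lab-pres pr (there (∈-map⁺ nd′ x∈)))
    , (λ {f} f∈ → trans (cong (RA (proj₁ f)) (trans (Vecₚ.map-∘ h nd′ (proj₂ (proj₂ f)))
          (cong (map h) (Vecₚ.map-∘ (λ y → y , tl top y) nd (proj₂ (proj₂ f))))))
        (R-pres pr (proj₂ (facts-∈ good f∈))))
    where
    nd′ : Fin N → Y top × A
    nd′ x = nd x , tl top (nd x)
    Good : Σ (Fin nb) (λ i → Use i × Vec (Fin N) (ar i)) → Set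
    Good (i , us , v) = Core.Atom top (All⊤ top) i (map nd v)
    good : All Good Γ
    good = All.tabulate (λ {f} f∈ → does-true (atom? top (proj₁ f) (map nd (proj₂ (proj₂ f)))) (ok f∈))
    mk : ∀ f → Good f → Fact (full top)
    mk (i , us , v) r = fact i us _ (cor (map nd v) r)
    facts : ∀ {Γ} → All Good Γ → List (Fact (full top))
    facts = All.reduce (λ {f} → mk f)
    facts-length : ∀ {Γ} (g : All Good Γ) → length (facts g) ≡ length Γ
    facts-length []      = refl
    facts-length (_ ∷ g) = cong suc (facts-length g)
    facts-∈ : ∀ {Γ f} (g : All Good Γ) → f ∈ Γ → Σ (Good f) λ r → mk f r ∈ facts g
    facts-∈ (r ∷ _) (here refl) = r , here refl
    facts-∈ (_ ∷ g) (there i) = let r , j = facts-∈ g i in r , there j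
    -- The query has no distinguished point, so any root will do.
    res = faithful big top ≤-refl s₀ (List.map nd′ zs) (≤-trans (≤-reflexive (Listₚ.length-map nd′ zs)) zs≤)
      (facts good) (≤-trans (≤-reflexive (facts-length good)) Γ≤)
    h = proj₁ res
    pr = proj₂ (proj₂ res)

  module Witness (b : Fin N) where
    x : X̂
    x = dc b

    a : A
    a = proj b

    Near : A → Set
    Near c = c ≡ a ⊎ ∃ λ d → c ≡ ch a d

    pick : ∀ c → Dec (c ≡ a) → Dec (∃ λ d → c ≡ ch a d) → Fin N
    -- Not `ec (dc b)`: several indices may decode to the same state, and `g` must return `b`
    -- itself.
    pick c (yes _) _             = b
    pick c (no _)  (yes (d , _)) = ec (child top x d)
    pick c (no _)  (no _)        = b

    g : A → Fin N
    g c = pick c (c Fin.≟ a) (Finₚ.any? (λ d → c Fin.≟ ch a d))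

    mem-top : ∀ d → mem top x (just d) ≡ inj₁ (child top x d)
    mem-top d with In? top (bs x) d
    ... | yes _ = refl
    ... | no ¬p = ⊥-elim (¬p (In-top (bs x) d))

    spot : ∀ {c} → Near c → Σ (Maybe (Fin D)) λ m → val (bs x) m ≡ c × nd (g c) ≡ mem top x m
    spot {c} nr = go (c Fin.≟ a) (Finₚ.any? (λ d → c Fin.≟ ch a d))
      where
      go : ∀ p q → Σ (Maybe (Fin D)) λ m → val (bs x) m ≡ c × nd (pick c p q) ≡ mem top x m
      go (yes e)  q             = nothing , sym e , refl
      go (no _)   (yes (d , e)) = just d , sym e , trans (cong inj₁ (dc-ec _)) (sym (mem-top d))
      go (no ¬e)  (no ¬q)       = ⊥-elim ([ ¬e , ¬q ]′ nr)

    g-self : g a ≡ b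
    g-self with a Fin.≟ a
    ... | yes _ = refl
    ... | no ¬e = ⊥-elim (¬e refl)

    lab-mem : ∀ m {y} → inj₁ y ≡ mem top x m → lab (el (bs y)) ≡ lab (val (bs x) m)
    lab-mem nothing  refl = refl
    lab-mem (just d) eq with trans eq (mem-top d)
    ... | refl = trans (cong (lab ∘ el) (base-child top x d (In-top (bs x) d))) (tp-lab (sym (nxt-tp (bs x) d)))

    g-lab : ∀ {c} → Near c → lab (proj (g c)) ≡ lab c
    g-lab nr = let m , v , e′ = spot nr in trans (lab-mem m e′) (cong lab v)

    g-T : ∀ u {c c′} → Near c → Near c′ → TA u c c′ ≡ true → TB u (g c) (g c′) ≡ true
    g-T u {c} {c′} nr nr′ t =
      let m , v , q = spot nr
          m′ , v′ , q′ = spot nr′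
      in dec-true (path? top u (nd (g c)) (nd (g c′)))
           (one (inj₁ (x , m , m′ , tt , subst₂ (λ y z → TA u y z ≡ true) (sym v) (sym v′) t , q , q′)))

    spots : ∀ {r} (v : Vec A r) → (∀ j → Near (lookup v j)) →
      Σ (Vec (Maybe (Fin D)) r) λ ms → map (val (bs x)) ms ≡ v × map nd (map g v) ≡ map (mem top x) ms
    spots []      nr = [] , refl , refl
    spots (c ∷ v) nr =
      let m , e₁ , e₂ = spot (nr zero)
          ms , e₃ , e₄ = spots v (nr ∘ suc)
      in m ∷ ms , cong₂ _∷_ e₁ e₃ , cong₂ _∷_ e₂ e₄

    g-R : ∀ i v → (∀ j → Near (lookup v j)) → RA i v ≡ true → RB i (map g v) ≡ true
    g-R i v nr r = let ms , e₁ , e₂ = spots v nr in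
      dec-true (atom? top i (map nd (map g v))) (x , ms , tt , trans (cong (RA i) e₁) r , e₂)

  cover : Cover 𝔐 ch N
  cover = record
    { proj = proj ; RB = RB ; TB = TB ; b₀ = ec (root top s₀)
    ; TB-trans = λ u {x} {y} {z} p q → dec-true (path? top u (nd x) (nd z))
        (path-trans (does-true (path? top u (nd x) (nd y)) p) (does-true (path? top u (nd y) (nd z)) q))
    ; local = local
    ; witness = λ b → Witness.g b , Witness.g-self b , Witness.g-lab b , Witness.g-T b , Witness.g-R b
    }

-- From bounded queries to formulas

open import Defs

sat-value : {σ : Sig} {n : ℕ} → Structure σ n → Formula σ → Fin n → Bool
sat-value 𝔄 χ a = sat 𝔄 χ (λ _ → a)

anyFin-∃ : ∀ n {f : Fin n → Bool} → anyFin n f ≡ true → ∃ λ a → f a ≡ true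
anyFin-∃ (suc n) {f} p with f zero in e
... | true  = zero , e
... | false = let a , q = anyFin-∃ n p in suc a , q

∃-anyFin : ∀ n {f : Fin n → Bool} a → f a ≡ true → anyFin n f ≡ true
∃-anyFin (suc n) {f} zero    p rewrite p = refl
∃-anyFin (suc n) {f} (suc a) p with f zero
... | true  = refl
... | false = ∃-anyFin n a p

anyFin-cong : ∀ n {f g : Fin n → Bool} → (∀ a → f a ≡ g a) → anyFin n f ≡ anyFin n g
anyFin-cong zero    e = refl
anyFin-cong (suc n) e = cong₂ _∨_ (e zero) (anyFin-cong n (e ∘ suc))

∧-split : ∀ {x y} → x ∧ y ≡ true → x ≡ true × y ≡ true
∧-split {true} {true} _ = refl , refl

∨-split : ∀ {x y} → x ∨ y ≡ true → x ≡ true ⊎ y ≡ true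
∨-split {true}  _ = inj₁ refl
∨-split {false} p = inj₂ p

∨-left : ∀ {x y} → x ≡ true → x ∨ y ≡ true
∨-left refl = refl

∨-right : ∀ {x y} → y ≡ true → x ∨ y ≡ true
∨-right {true}  _ = refl
∨-right {false} p = p

⌊⌋-true : ∀ {P : Set} (d : Dec P) → ⌊ d ⌋ ≡ true → P
⌊⌋-true (yes p) _ = p

true-⌊⌋ : ∀ {P : Set} (d : Dec P) → P → ⌊ d ⌋ ≡ true
true-⌊⌋ (yes _) _ = refl
true-⌊⌋ (no ¬p) p = ⊥-elim (¬p p)

module _ {σ : Sig} where

  module _ {n : ℕ} where

    update-cong : ∀ (ρ ρ′ : Assignment n) x a {y} → (¬ (y ≡ x) → ρ y ≡ ρ′ y) → update ρ x a y ≡ update ρ′ x a y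
    update-cong ρ ρ′ x a {y} e with y ≟ x
    ... | yes _ = refl
    ... | no ¬p = e ¬p

    update-self : ∀ (ρ : Assignment n) x y → update ρ x (ρ x) y ≡ ρ y
    update-self ρ x y with y ≟ x
    ... | yes refl = refl
    ... | no _     = refl

  update-∘ : ∀ {n m} (g : Fin n → Fin m) (ρ : Assignment n) x a y → g (update ρ x a y) ≡ update (g ∘ ρ) x (g a) y
  update-∘ g ρ x a y with y ≟ x
  ... | yes _ = refl
  ... | no _  = refl

  module _ {n : ℕ} (𝔄 : Structure σ n) where

    sat-fv : ∀ φ {ρ ρ′} → (∀ {y} → y ∈ fv φ → ρ y ≡ ρ′ y) → sat 𝔄 φ ρ ≡ sat 𝔄 φ ρ′
    sat-fv (atom B xs) e = cong (rel 𝔄 B) (map-cong-lookup xs (λ i → e (lookup∈toList xs i)))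
    sat-fv (eq x y) e = cong₂ (λ a b → ⌊ a Fin.≟ b ⌋) (e (here refl)) (e (there (here refl)))
    sat-fv (and φ ψ) e = cong₂ _∧_ (sat-fv φ (e ∘ ∈-++⁺ˡ)) (sat-fv ψ (e ∘ ∈-++⁺ʳ (fv φ)))
    sat-fv (or φ ψ) e = cong₂ _∨_ (sat-fv φ (e ∘ ∈-++⁺ˡ)) (sat-fv ψ (e ∘ ∈-++⁺ʳ (fv φ)))
    sat-fv (ex x φ) {ρ} {ρ′} e = anyFin-cong n (λ a → sat-fv φ (λ y∈ →
      update-cong ρ ρ′ x a (λ y≢x → e (∈-filter⁺ (λ y → ¬? (y ≟ x)) y∈ y≢x))))
    sat-fv (neg x φ) e = cong not (sat-fv φ e)

    sat-unary : ∀ φ {x ρ} → All (_≡ x) (fv φ) → sat 𝔄 φ ρ ≡ sat-value 𝔄 φ (ρ x)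
    sat-unary φ {x} {ρ} u = sat-fv φ (λ y∈ → cong ρ (All.lookup u y∈))

    -- One chosen value for each quantifier outside negations, along one true disjunct. Negated
    -- formulas contribute nothing, as they are handled by labels.
    wits  : Formula σ → Assignment n → List (Fin n)
    wits′ : ∀ φ x ρ → Dec (∃ λ a → sat 𝔄 φ (update ρ x a) ≡ true) → List (Fin n)
    wits (and φ ψ) ρ = wits φ ρ ++ wits ψ ρ
    wits (or φ ψ)  ρ = if sat 𝔄 φ ρ then wits φ ρ else wits ψ ρ
    wits (ex x φ)  ρ = wits′ φ x ρ (Finₚ.any? (λ a → sat 𝔄 φ (update ρ x a) Bool.≟ true))
    wits _         ρ = []
    wits′ φ x ρ (yes (a , _)) = a ∷ wits φ (update ρ x a)
    wits′ φ x ρ (no _)        = []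

    wits-length : ∀ φ ρ → length (wits φ ρ) ≤ size φ
    wits′-length : ∀ φ x ρ d → length (wits′ φ x ρ d) ≤ 2 + size φ
    wits-length (atom B xs) ρ = z≤n
    wits-length (eq x y)    ρ = z≤n
    wits-length (and φ ψ)   ρ = ≤-trans (≤-reflexive (Listₚ.length-++ (wits φ ρ)))
      (m≤n⇒m≤1+n (+-mono-≤ (wits-length φ ρ) (wits-length ψ ρ)))
    wits-length (or φ ψ)    ρ with sat 𝔄 φ ρ
    ... | true  = m≤n⇒m≤1+n (≤-trans (wits-length φ ρ) (m≤m+n _ _))
    ... | false = m≤n⇒m≤1+n (≤-trans (wits-length ψ ρ) (m≤n+m _ _))
    wits-length (ex x φ)    ρ = wits′-length φ x ρ (Finₚ.any? (λ a → sat 𝔄 φ (update ρ x a) Bool.≟ true))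
    wits-length (neg x φ)   ρ = z≤n
    wits′-length φ x ρ (yes (a , _)) = s≤s (m≤n⇒m≤1+n (wits-length φ _))
    wits′-length φ x ρ (no _)        = z≤n

  baseSyms : Formula σ → List (Fin (nb σ))
  baseSyms (atom (base i) _)   = i ∷ []
  baseSyms (atom (dist _ _) _) = []
  baseSyms (eq _ _)            = []
  baseSyms (and φ ψ)           = baseSyms φ ++ baseSyms ψ
  baseSyms (or φ ψ)            = baseSyms φ ++ baseSyms ψ
  baseSyms (ex _ φ)            = baseSyms φ
  baseSyms (neg _ φ)           = baseSyms φ

  distSyms : Formula σ → List (Fin (k σ))
  distSyms (atom (base _) _)   = []
  distSyms (atom (dist u _) _) = u ∷ []
  distSyms (eq _ _)            = []
  distSyms (and φ ψ)           = distSyms φ ++ distSyms ψ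
  distSyms (or φ ψ)            = distSyms φ ++ distSyms ψ
  distSyms (ex _ φ)            = distSyms φ
  distSyms (neg _ φ)           = distSyms φ

  negated : Formula σ → List (Formula σ)
  negated (atom _ _) = []
  negated (eq _ _)   = []
  negated (and φ ψ)  = negated φ ++ negated ψ
  negated (or φ ψ)   = negated φ ++ negated ψ
  negated (ex _ φ)   = negated φ
  negated (neg _ φ)  = φ ∷ negated φ

  +-length-≤ : ∀ {X : Set} (xs : List X) {ys m n} → length xs ≤ m → length ys ≤ n → length (xs ++ ys) ≤ 1 + m + n
  +-length-≤ xs p q = ≤-trans (≤-reflexive (Listₚ.length-++ xs)) (m≤n⇒m≤1+n (+-mono-≤ p q))

  baseSyms-length : ∀ φ → length (baseSyms φ) ≤ size φ
  baseSyms-length (atom (base _) _)   = s≤s z≤n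
  baseSyms-length (atom (dist _ _) _) = z≤n
  baseSyms-length (eq _ _)  = z≤n
  baseSyms-length (and φ ψ) = +-length-≤ (baseSyms φ) (baseSyms-length φ) (baseSyms-length ψ)
  baseSyms-length (or φ ψ)  = +-length-≤ (baseSyms φ) (baseSyms-length φ) (baseSyms-length ψ)
  baseSyms-length (ex _ φ)  = m≤n⇒m≤1+n (m≤n⇒m≤1+n (baseSyms-length φ))
  baseSyms-length (neg _ φ) = m≤n⇒m≤1+n (m≤n⇒m≤1+n (baseSyms-length φ))

  distSyms-length : ∀ φ → length (distSyms φ) ≤ size φ
  distSyms-length (atom (base _) _)   = z≤n
  distSyms-length (atom (dist _ _) _) = s≤s z≤n
  distSyms-length (eq _ _)  = z≤n
  distSyms-length (and φ ψ) = +-length-≤ (distSyms φ) (distSyms-length φ) (distSyms-length ψ)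
  distSyms-length (or φ ψ)  = +-length-≤ (distSyms φ) (distSyms-length φ) (distSyms-length ψ)
  distSyms-length (ex _ φ)  = m≤n⇒m≤1+n (m≤n⇒m≤1+n (distSyms-length φ))
  distSyms-length (neg _ φ) = m≤n⇒m≤1+n (m≤n⇒m≤1+n (distSyms-length φ))

  negated-length : ∀ φ → length (negated φ) ≤ size φ
  negated-length (atom _ _) = z≤n
  negated-length (eq _ _)  = z≤n
  negated-length (and φ ψ) = +-length-≤ (negated φ) (negated-length φ) (negated-length ψ)
  negated-length (or φ ψ)  = +-length-≤ (negated φ) (negated-length φ) (negated-length ψ)
  negated-length (ex _ φ)  = m≤n⇒m≤1+n (m≤n⇒m≤1+n (negated-length φ))
  negated-length (neg _ φ) = s≤s (m≤n⇒m≤1+n (negated-length φ))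

  fv-length : ∀ (φ : Formula σ) → length (fv φ) ≤ size φ
  fv-length (atom B xs) = ≤-trans (≤-reflexive (Vecₚ.length-toList xs)) (n≤1+n _)
  fv-length (eq _ _)  = s≤s (s≤s z≤n)
  fv-length (and φ ψ) = +-length-≤ (fv φ) (fv-length φ) (fv-length ψ)
  fv-length (or φ ψ)  = +-length-≤ (fv φ) (fv-length φ) (fv-length ψ)
  fv-length (ex x φ)  = m≤n⇒m≤1+n (m≤n⇒m≤1+n (≤-trans (Listₚ.length-filter (λ y → ¬? (y ≟ x)) (fv φ)) (fv-length φ)))
  fv-length (neg _ φ) = m≤n⇒m≤1+n (m≤n⇒m≤1+n (fv-length φ))

  negated-size : ∀ φ {χ} → χ ∈ negated φ → size χ ≤ size φ
  negated-size (and φ ψ) i = m≤n⇒m≤1+n ([ (λ j → ≤-trans (negated-size φ j) (m≤m+n _ _)) , (λ j → ≤-trans (negated-size ψ j) (m≤n+m _ _)) ]′ (∈-++⁻ (negated φ) i))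
  negated-size (or φ ψ)  i = m≤n⇒m≤1+n ([ (λ j → ≤-trans (negated-size φ j) (m≤m+n _ _)) , (λ j → ≤-trans (negated-size ψ j) (m≤n+m _ _)) ]′ (∈-++⁻ (negated φ) i))
  negated-size (ex _ φ)  i = m≤n⇒m≤1+n (m≤n⇒m≤1+n (negated-size φ i))
  negated-size (neg _ φ) (here refl) = m≤n⇒m≤1+n (n≤1+n _)
  negated-size (neg _ φ) (there i)   = m≤n⇒m≤1+n (m≤n⇒m≤1+n (negated-size φ i))

  baseSyms-arity : ∀ φ {i} → i ∈ baseSyms φ → arity σ i ≤ size φ
  baseSyms-arity (atom (base i) _) (here refl) = n≤1+n _
  baseSyms-arity (and φ ψ) i = m≤n⇒m≤1+n ([ (λ j → ≤-trans (baseSyms-arity φ j) (m≤m+n _ _)) , (λ j → ≤-trans (baseSyms-arity ψ j) (m≤n+m _ _)) ]′ (∈-++⁻ (baseSyms φ) i))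
  baseSyms-arity (or φ ψ)  i = m≤n⇒m≤1+n ([ (λ j → ≤-trans (baseSyms-arity φ j) (m≤m+n _ _)) , (λ j → ≤-trans (baseSyms-arity ψ j) (m≤n+m _ _)) ]′ (∈-++⁻ (baseSyms φ) i))
  baseSyms-arity (ex _ φ)  i = m≤n⇒m≤1+n (m≤n⇒m≤1+n (baseSyms-arity φ i))
  baseSyms-arity (neg _ φ) i = m≤n⇒m≤1+n (m≤n⇒m≤1+n (baseSyms-arity φ i))

  close : List Var → Formula σ → Formula σ
  close vs φ = List.foldr ex φ vs

  close-UNFO : ∀ vs {φ} → UNFO φ → UNFO (close vs φ)
  close-UNFO []       u = u
  close-UNFO (v ∷ vs) u = ex v (close-UNFO vs u)

  close-size : ∀ vs φ → size (close vs φ) ≡ length vs * 2 + size φ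
  close-size []       φ = refl
  close-size (v ∷ vs) φ = cong (2 +_) (close-size vs φ)

  close-fv : ∀ vs φ {y} → y ∈ fv (close vs φ) → y ∈ fv φ × ¬ (y ∈ vs)
  close-fv []       φ i = i , λ ()
  close-fv (v ∷ vs) φ i =
    let j , y≢v = ∈-filter⁻ (λ y → ¬? (y ≟ v)) {xs = fv (close vs φ)} i
        p , q = close-fv vs φ j
    in p , λ { (here e) → y≢v e ; (there l) → q l }

  close-sat : ∀ {n} (𝔄 : Structure σ n) vs φ {ρ} → sat 𝔄 φ ρ ≡ true → sat 𝔄 (close vs φ) ρ ≡ true
  close-sat 𝔄 []       φ p = p
  close-sat {n} 𝔄 (v ∷ vs) φ {ρ} p = ∃-anyFin n (ρ v)
    (trans (sat-fv 𝔄 (close vs φ) (λ {y} _ → update-self ρ v y)) (close-sat 𝔄 vs φ p))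

  open-sat : ∀ {n} (𝔄 : Structure σ n) vs φ {ρ} → sat 𝔄 (close vs φ) ρ ≡ true → ∃ λ ρ′ → sat 𝔄 φ ρ′ ≡ true
  open-sat 𝔄 []       φ p = _ , p
  open-sat {n} 𝔄 (v ∷ vs) φ p = open-sat 𝔄 vs φ (proj₂ (anyFin-∃ n p))

module Reduction {σ : Sig} {n : ℕ} (𝔄 : Structure σ n) (adm : Admissible 𝔄) (a₀ : Fin n) (φ : Formula σ)
  (uφ : UNFO φ) (cφ : All (_≡ 0) (fv φ)) where

  z : ℕ
  z = size φ

  χs : List (Formula σ)
  χs = φ ∷ negated φ

  syms : List (Fin (nb σ))
  syms = baseSyms φ

  us : List (Fin (k σ))
  us = distSyms φ

  -- Of each inverse pair only the symbol with `false` is kept, its partner being determined by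
  -- admissibility. The extra one in `nv` is for the element at which a subformula is evaluated.
  𝔐 : Model
  𝔐 = record
    { n = n ; a₀ = a₀ ; Lab = Vec Bool (length χs)
    ; lab = λ a → map (λ χ → sat-value 𝔄 χ a) (Vec.fromList χs)
    ; nb = nb σ ; ar = arity σ ; RA = λ i v → rel 𝔄 (base i) v ; Use = _∈ syms
    ; k = length us ; TA = λ j x y → T 𝔄 (List.lookup us j) false x y
    ; TA-trans = λ j {x} {y} {w} → proj₁ adm (List.lookup us j) false x y w
    ; nv = suc z ; nf = z }

  open Model 𝔐 using (lab)

  lab-sat : ∀ {a a′ χ} → χ ∈ χs → lab a ≡ lab a′ → sat-value 𝔄 χ a ≡ sat-value 𝔄 χ a′
  lab-sat = go χs
    where
    go : ∀ l {a a′ χ} → χ ∈ l → map (λ χ → sat-value 𝔄 χ a) (Vec.fromList l) ≡ map (λ χ → sat-value 𝔄 χ a′) (Vec.fromList l) →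
      sat-value 𝔄 χ a ≡ sat-value 𝔄 χ a′
    go (_ ∷ l) (here refl) e = Vecₚ.∷-injectiveˡ e
    go (_ ∷ l) (there i)   e = go l i (Vecₚ.∷-injectiveʳ e)

  D : ℕ
  D = length χs * z

  allWits : Fin n → List (Fin n)
  allWits a = concatMap (λ χ → wits 𝔄 χ (λ _ → a)) χs

  χ-size : ∀ {χ} → χ ∈ χs → size χ ≤ z
  χ-size (here refl) = ≤-refl
  χ-size (there i)   = negated-size φ i

  allWits-length : ∀ a → length (allWits a) ≤ D
  allWits-length a = go χs χ-size
    where
    go : ∀ l → (∀ {χ} → χ ∈ l → size χ ≤ z) → length (concatMap (λ χ → wits 𝔄 χ (λ _ → a)) l) ≤ length l * z
    go []      _ = z≤n
    go (χ ∷ l) b = ≤-trans (≤-reflexive (Listₚ.length-++ (wits 𝔄 χ (λ _ → a))))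
      (+-mono-≤ (≤-trans (wits-length 𝔄 χ _) (b (here refl))) (go l (b ∘ there)))

  ch : Fin n → Fin D → Fin n
  ch a d = lookup (fit a D (Vec.fromList (allWits a))) d

  ch-wits : ∀ {a χ c} → χ ∈ χs → c ∈ wits 𝔄 χ (λ _ → a) → ∃ λ d → c ≡ ch a d
  ch-wits {a} χ∈ c∈ =
    let j , e = fit-∈ a (∈-concatMap (λ χ → wits 𝔄 χ (λ _ → a)) χ∈ c∈) (allWits-length a) in j , sym e

  module FromCover {N : ℕ} (𝔠 : Cover 𝔐 ch N) where
    open Cover 𝔠

    ix′ : ∀ {m} (f : Fin m → Fin (k σ)) u → Dec (∃ λ j → f j ≡ u) → Maybe (Fin m)
    ix′ f u (yes (j , _)) = just j
    ix′ f u (no _)        = nothing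

    ix : Fin (k σ) → Maybe (Fin (length us))
    ix u = ix′ (List.lookup us) u (Finₚ.any? (λ j → List.lookup us j Fin.≟ u))

    ix-∈ : ∀ {u} → u ∈ us → ∃ λ j → ix u ≡ just j × List.lookup us j ≡ u
    ix-∈ {u} u∈ with Finₚ.any? (λ j → List.lookup us j Fin.≟ u)
    ... | yes (j , e) = j , refl , e
    ... | no ¬p = ⊥-elim (¬p (Any.index u∈ , sym (lookup-index u∈)))

    Tb′ : Maybe (Fin (length us)) → Fin N → Fin N → Bool
    Tb′ nothing  x y = false
    Tb′ (just j) x y = TB j x y

    Tb : Fin (k σ) → Fin N → Fin N → Bool
    Tb u = Tb′ (ix u)

    Tb′-trans : ∀ m {x y w} → Tb′ m x y ≡ true → Tb′ m y w ≡ true → Tb′ m x w ≡ true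
    Tb′-trans (just j) p q = TB-trans j p q

    relB : (B : Sym σ) → Vec (Fin N) (ar B) → Bool
    relB (base i)       v             = RB i v
    relB (dist u false) (x ∷ y ∷ []) = Tb u x y
    relB (dist u true)  (x ∷ y ∷ []) = Tb u y x

    𝔅 : Structure σ N
    𝔅 = record { rel = relB }

    adm-𝔅 : Admissible 𝔅
    adm-𝔅 = (λ { u false x y w p q → Tb′-trans (ix u) p q ; u true x y w p q → Tb′-trans (ix u) q p })
          , (λ u x y → refl)

    Agree : Formula σ → Set
    Agree χ = ∀ b → sat-value 𝔅 χ b ≡ sat-value 𝔄 χ (proj b)

    record Sub (ψ : Formula σ) : Set where
      field
        subB : ∀ {i} → i ∈ baseSyms ψ → i ∈ syms
        subD : ∀ {u} → u ∈ distSyms ψ → u ∈ us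
        subN : ∀ {χ} → χ ∈ negated ψ → χ ∈ χs
    open Sub

    sub-and : ∀ {ψ ψ′} → Sub (and ψ ψ′) → Sub ψ × Sub ψ′
    sub-and {ψ} s = record { subB = subB s ∘ ∈-++⁺ˡ ; subD = subD s ∘ ∈-++⁺ˡ ; subN = subN s ∘ ∈-++⁺ˡ }
                  , record { subB = subB s ∘ ∈-++⁺ʳ (baseSyms ψ) ; subD = subD s ∘ ∈-++⁺ʳ (distSyms ψ)
                           ; subN = subN s ∘ ∈-++⁺ʳ (negated ψ) }

    sub-or : ∀ {ψ ψ′} → Sub (or ψ ψ′) → Sub ψ × Sub ψ′
    sub-or s = sub-and (record { subB = subB s ; subD = subD s ; subN = subN s })

    sub-ex : ∀ {x ψ} → Sub (ex x ψ) → Sub ψ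
    sub-ex s = record { subB = subB s ; subD = subD s ; subN = subN s }

    T-at : ∀ {u} (u∈ : u ∈ us) {x y} → T 𝔄 u false x y ≡ T 𝔄 (List.lookup us (proj₁ (ix-∈ u∈))) false x y
    T-at u∈ {x} {y} = cong (λ v → T 𝔄 v false x y) (sym (proj₂ (proj₂ (ix-∈ u∈))))

    Tb-at : ∀ {u} (u∈ : u ∈ us) {x y} → Tb u x y ≡ TB (proj₁ (ix-∈ u∈)) x y
    Tb-at u∈ {x} {y} = cong (λ m → Tb′ m x y) (proj₁ (proj₂ (ix-∈ u∈)))

    module Positive (g : Fin n → Fin N) (Nr : Fin n → Set)
      (g-lab : ∀ {c} → Nr c → lab (proj (g c)) ≡ lab c)
      (g-T : ∀ j {c c′} → Nr c → Nr c′ → T 𝔄 (List.lookup us j) false c c′ ≡ true → TB j (g c) (g c′) ≡ true)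
      (g-R : ∀ i v → (∀ j → Nr (lookup v j)) → rel 𝔄 (base i) v ≡ true → RB i (map g v) ≡ true) where

      g-Tb : ∀ {u} → u ∈ us → ∀ {c c′} → Nr c → Nr c′ → T 𝔄 u false c c′ ≡ true → Tb u (g c) (g c′) ≡ true
      g-Tb u∈ p q t = trans (Tb-at u∈) (g-T _ p q (trans (sym (T-at u∈)) t))

      -- The values of the free variables and all chosen witnesses lie in one neighbourhood, so the
      -- same `g` works under every quantifier; a negated subformula keeps its value by `Agree` and
      -- equality of labels.
      positive : ∀ ψ → UNFO ψ → Sub ψ → (∀ {χ} → χ ∈ negated ψ → Agree χ) → ∀ {ρ} → sat 𝔄 ψ ρ ≡ true →
        (∀ {y} → y ∈ fv ψ → Nr (ρ y)) → (∀ {c} → c ∈ wits 𝔄 ψ ρ → Nr c) → sat 𝔅 ψ (g ∘ ρ) ≡ true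
      positive (atom (base i) xs) _ s ag {ρ} p nr _ = trans (cong (RB i) (Vecₚ.map-∘ g ρ xs))
        (g-R i (map ρ xs) (λ j → subst Nr (sym (Vecₚ.lookup-map j ρ xs)) (nr (lookup∈toList xs j))) p)
      positive (atom (dist u false) (x ∷ y ∷ [])) _ s ag p nr _ =
        g-Tb (subD s (here refl)) (nr (here refl)) (nr (there (here refl))) p
      positive (atom (dist u true) (x ∷ y ∷ [])) _ s ag {ρ} p nr _ =
        g-Tb (subD s (here refl)) (nr (there (here refl))) (nr (here refl)) (trans (sym (proj₂ adm u (ρ x) (ρ y))) p)
      positive (eq x y) _ s ag {ρ} p nr _ = true-⌊⌋ (g (ρ x) Fin.≟ g (ρ y)) (cong g (⌊⌋-true (ρ x Fin.≟ ρ y) p))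
      positive (and ψ ψ′) (and u u′) s ag {ρ} p nr w =
        let q , q′ = ∧-split p in
        cong₂ _∧_
          (positive ψ u (proj₁ (sub-and s))
            (ag ∘ ∈-++⁺ˡ) q (nr ∘ ∈-++⁺ˡ) (w ∘ ∈-++⁺ˡ))
          (positive ψ′ u′ (proj₂ (sub-and s))
            (ag ∘ ∈-++⁺ʳ (negated ψ)) q′ (nr ∘ ∈-++⁺ʳ (fv ψ)) (w ∘ ∈-++⁺ʳ (wits 𝔄 ψ ρ)))
      positive (or ψ ψ′) (or u u′) s ag {ρ} p nr w with sat 𝔄 ψ ρ in e
      ... | true  = ∨-left
          (positive ψ u (proj₁ (sub-or s))
            (ag ∘ ∈-++⁺ˡ) e (nr ∘ ∈-++⁺ˡ) w)
      ... | false = ∨-right {sat 𝔅 ψ (g ∘ ρ)}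
          (positive ψ′ u′ (proj₂ (sub-or s))
            (ag ∘ ∈-++⁺ʳ (negated ψ)) p (nr ∘ ∈-++⁺ʳ (fv ψ)) w)
      positive (ex x ψ) (ex _ u) s ag {ρ} p nr w = go (Finₚ.any? (λ a → sat 𝔄 ψ (update ρ x a) Bool.≟ true)) w
        where
        go : (d : Dec (∃ λ a → sat 𝔄 ψ (update ρ x a) ≡ true)) → (∀ {c} → c ∈ wits′ 𝔄 ψ x ρ d → Nr c) →
          sat 𝔅 (ex x ψ) (g ∘ ρ) ≡ true
        go (no ¬q) _ = ⊥-elim (¬q (anyFin-∃ n p))
        go (yes (a , q)) w′ = ∃-anyFin N (g a) (trans
          (sat-fv 𝔅 ψ (λ {y} _ → sym (update-∘ {σ = σ} g ρ x a y)))
          (positive ψ u (sub-ex s) ag q near (w′ ∘ there)))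
          where
          near : ∀ {y} → y ∈ fv ψ → Nr (update ρ x a y)
          near {y} y∈ with y ≟ x
          ... | yes _  = w′ (here refl)
          ... | no y≢x = nr (∈-filter⁺ (λ y → ¬? (y ≟ x)) y∈ y≢x)
      positive (neg x χ) (neg _ u c) s ag {ρ} p nr _ = trans (cong not same) p
        where
        same : sat 𝔅 χ (g ∘ ρ) ≡ sat 𝔄 χ ρ
        same = trans (sat-unary 𝔅 χ c) (trans (ag (here refl) (g (ρ x))) (go (fv χ) refl))
          where
          go : ∀ l → fv χ ≡ l → sat-value 𝔄 χ (proj (g (ρ x))) ≡ sat 𝔄 χ ρ
          -- If `χ` is closed, the value of `x` may lie outside the neighbourhood, but the truth
          -- value does not depend on it.
          go [] e = sat-fv 𝔄 χ (λ y∈ → ⊥-elim (nil (subst (_ ∈_) e y∈)))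
            where
            nil : ∀ {y : Var} → ¬ (y ∈ [])
            nil ()
          go (y ∷ l) e = trans (lab-sat (subN s (here refl)) (g-lab (subst (Nr ∘ ρ) (All.lookup c y∈) (nr y∈))))
            (sym (sat-unary 𝔄 χ c))
            where
            y∈ : y ∈ fv χ
            y∈ = subst (y ∈_) (sym e) (here refl)

    UFact : Set
    UFact = Σ (Fin (nb σ)) λ i → i ∈ syms × Vec (Fin N) (arity σ i)

    record Preserves (zs : List (Fin N)) (Γ : List UFact) (h : Fin N → Fin n) : Set where
      field
        pT : ∀ j {x y} → x ∈ zs → y ∈ zs → TB j x y ≡ true → T 𝔄 (List.lookup us j) false (h x) (h y) ≡ true
        pL : ∀ {x} → x ∈ zs → lab (h x) ≡ lab (proj x)
        pR : ∀ {f} → f ∈ Γ → rel 𝔄 (base (proj₁ f)) (map h (proj₂ (proj₂ f))) ≡ true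
    open Preserves

    narrow : ∀ {zs zs′ Γ Γ′ h} → (∀ {x} → x ∈ zs → x ∈ zs′) → (∀ {f} → f ∈ Γ → f ∈ Γ′) →
      Preserves zs′ Γ′ h → Preserves zs Γ h
    narrow f g p = record { pT = λ j x y → pT p j (f x) (f y) ; pL = pL p ∘ f ; pR = pR p ∘ g }

    -- The query behind one way of satisfying `ψ`: a disjunct of each disjunction and a value for
    -- each quantifier are fixed. Equalities add nothing to it, because every map preserves them; a
    -- negation adds a node whose label is to be kept.
    record Extract (ψ : Formula σ) (ρ : Assignment N) : Set where
      constructor extract
      field
        nodes : List (Fin N)
        facts : List UFact
        nodes≤ : length nodes ≤ size ψ
        facts≤ : length facts ≤ size ψ
        hold  : ∀ {f} → f ∈ facts → RB (proj₁ f) (proj₂ (proj₂ f)) ≡ true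
        back  : ∀ {h} → Preserves nodes facts h → sat 𝔄 ψ (h ∘ ρ) ≡ true
    open Extract

    negative : ∀ ψ → UNFO ψ → Sub ψ → (∀ {χ} → χ ∈ negated ψ → Agree χ) → ∀ {ρ} → sat 𝔅 ψ ρ ≡ true → Extract ψ ρ
    negative (atom (base i) xs) _ s ag {ρ} p = extract [] ((i , subB s (here refl) , map ρ xs) ∷ []) z≤n (s≤s z≤n)
      (λ { (here refl) → p })
      (λ {h} pr → trans (cong (rel 𝔄 (base i)) (Vecₚ.map-∘ h ρ xs)) (pR pr (here refl)))
    negative (atom (dist u false) (x ∷ y ∷ [])) _ s ag {ρ} p = extract (ρ x ∷ ρ y ∷ []) [] (s≤s (s≤s z≤n)) z≤n (λ ())
      (λ pr → trans (T-at u∈) (pT pr _ (here refl) (there (here refl)) (trans (sym (Tb-at u∈)) p)))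
      where u∈ = subD s (here refl)
    negative (atom (dist u true) (x ∷ y ∷ [])) _ s ag {ρ} p = extract (ρ y ∷ ρ x ∷ []) [] (s≤s (s≤s z≤n)) z≤n (λ ())
      (λ {h} pr → trans (proj₂ adm u (h (ρ x)) (h (ρ y)))
        (trans (T-at u∈) (pT pr _ (here refl) (there (here refl)) (trans (sym (Tb-at u∈)) p))))
      where u∈ = subD s (here refl)
    negative (eq x y) _ s ag {ρ} p = extract [] [] z≤n z≤n (λ ())
      (λ {h} _ → true-⌊⌋ (h (ρ x) Fin.≟ h (ρ y)) (cong h (⌊⌋-true (ρ x Fin.≟ ρ y) p)))
    negative (and ψ ψ′) (and u u′) s ag {ρ} p =
      let q , q′ = ∧-split p
          e = negative ψ u (proj₁ (sub-and s)) (ag ∘ ∈-++⁺ˡ) q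
          e′ = negative ψ′ u′ (proj₂ (sub-and s))
                 (ag ∘ ∈-++⁺ʳ (negated ψ)) q′
      in extract (nodes e ++ nodes e′) (facts e ++ facts e′)
           (+-length-≤ {σ} (nodes e) (nodes≤ e) (nodes≤ e′)) (+-length-≤ {σ} (facts e) (facts≤ e) (facts≤ e′))
           (λ f∈ → [ hold e , hold e′ ]′ (∈-++⁻ (facts e) f∈))
           (λ pr → cong₂ _∧_ (back e (narrow ∈-++⁺ˡ ∈-++⁺ˡ pr))
                             (back e′ (narrow (∈-++⁺ʳ (nodes e)) (∈-++⁺ʳ (facts e)) pr)))
    negative (or ψ ψ′) (or u u′) s ag {ρ} p with ∨-split p
    ... | inj₁ q =
      let e = negative ψ u (proj₁ (sub-or s)) (ag ∘ ∈-++⁺ˡ) q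
      in extract (nodes e) (facts e) (m≤n⇒m≤1+n (≤-trans (nodes≤ e) (m≤m+n _ _)))
           (m≤n⇒m≤1+n (≤-trans (facts≤ e) (m≤m+n _ _))) (hold e) (λ pr → ∨-left (back e pr))
    ... | inj₂ q =
      let e = negative ψ′ u′ (proj₂ (sub-or s))
                 (ag ∘ ∈-++⁺ʳ (negated ψ)) q
      in extract (nodes e) (facts e) (m≤n⇒m≤1+n (≤-trans (nodes≤ e) (m≤n+m _ _)))
           (m≤n⇒m≤1+n (≤-trans (facts≤ e) (m≤n+m _ _))) (hold e) (λ {h} pr → ∨-right {sat 𝔄 ψ (h ∘ ρ)} (back e pr))
    negative (ex x ψ) (ex _ u) s ag {ρ} p =
      let a , q = anyFin-∃ N p
          e = negative ψ u (sub-ex s) ag q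
      in extract (nodes e) (facts e) (m≤n⇒m≤1+n (m≤n⇒m≤1+n (nodes≤ e))) (m≤n⇒m≤1+n (m≤n⇒m≤1+n (facts≤ e))) (hold e)
           (λ {h} pr → ∃-anyFin n (h a) (trans
             (sat-fv 𝔄 ψ (λ {y} _ → sym (update-∘ {σ = σ} h ρ x a y))) (back e pr)))
    negative (neg x χ) (neg _ u c) s ag {ρ} p = extract (ρ x ∷ []) [] (s≤s z≤n) z≤n (λ ())
      (λ {h} pr → trans (cong not (trans (sat-unary 𝔄 χ c)
        (trans (lab-sat (subN s (here refl)) (pL pr (here refl)))
          (trans (sym (ag (here refl) (ρ x))) (sym (sat-unary 𝔅 χ c)))))) p)

    Bool-≡ : ∀ {x y} → (x ≡ true → y ≡ true) → (y ≡ true → x ≡ true) → x ≡ y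
    Bool-≡ {false} {false} f g = refl
    Bool-≡ {false} {true}  f g = g refl
    Bool-≡ {true}  {_}     f g = sym (f refl)

    agree : ∀ χ {x} → UNFO χ → All (_≡ x) (fv χ) → χ ∈ χs → Sub χ → (∀ {χ′} → χ′ ∈ negated χ → Agree χ′) → Agree χ
    agree χ u c χ∈ s ag b = Bool-≡ forth back′
      where
      back′ : sat-value 𝔄 χ (proj b) ≡ true → sat-value 𝔅 χ b ≡ true
      back′ p =
        let g , gs , gl , gT , gR = witness b
        in subst (λ w → sat-value 𝔅 χ w ≡ true) gs
             (Positive.positive g (Near (proj b)) gl gT gR χ u s ag p (λ _ → inj₁ refl) (λ c∈ → inj₂ (ch-wits χ∈ c∈)))
      forth : sat-value 𝔅 χ b ≡ true → sat-value 𝔄 χ (proj b) ≡ true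
      forth p =
        let e = negative χ u s ag p
            -- The formula is obtained at `h b`, which need not be `proj b`; `b` joins the query so
            -- that the two have the same label.
            h , hT , hL , hR = local (b ∷ nodes e) (s≤s (≤-trans (nodes≤ e) (χ-size χ∈))) (facts e)
                                 (≤-trans (facts≤ e) (χ-size χ∈)) (hold e)
        in trans (sym (lab-sat χ∈ (hL (here refl))))
             (back e (record { pT = λ j x∈ y∈ → hT j (there x∈) (there y∈) ; pL = hL ∘ there ; pR = hR }))

    agree-negated : ∀ ψ → UNFO ψ → Sub ψ → ∀ {χ} → χ ∈ negated ψ → Agree χ
    agree-negated (and ψ ψ′) (and u u′) s i with ∈-++⁻ (negated ψ) i
    ... | inj₁ j = agree-negated ψ u (proj₁ (sub-and s)) j
    ... | inj₂ j = agree-negated ψ′ u′ (proj₂ (sub-and s)) j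
    agree-negated (or ψ ψ′) (or u u′) s i with ∈-++⁻ (negated ψ) i
    ... | inj₁ j = agree-negated ψ u (proj₁ (sub-or s)) j
    ... | inj₂ j = agree-negated ψ′ u′ (proj₂ (sub-or s)) j
    agree-negated (ex _ ψ) (ex _ u) s i = agree-negated ψ u (sub-ex s) i
    agree-negated (neg _ ψ) (neg _ u c) s i = go i
      where
      s′ : Sub ψ
      s′ = record { subB = subB s ; subD = subD s ; subN = subN s ∘ there }
      go : ∀ {χ} → χ ∈ (ψ ∷ negated ψ) → Agree χ
      go (here refl) = agree ψ u c (subN s (here refl)) s′ (agree-negated ψ u s′)
      go (there j)   = agree-negated ψ u s′ j

    sub-φ : Sub φ
    sub-φ = record { subB = id ; subD = id ; subN = there }

    model : (∀ a → sat-value 𝔄 φ a ≡ true) → ∀ ρ → sat 𝔅 φ ρ ≡ true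
    model p ρ = trans (sat-unary 𝔅 φ cφ)
      (trans (agree φ uφ cφ (here refl) sub-φ (agree-negated φ uφ sub-φ) (ρ 0)) (p (proj (ρ 0))))

-- The triply exponential bound

n≤2^n : ∀ n → n ≤ 2 ^ n
n≤2^n zero    = z≤n
n≤2^n (suc n) = ≤-trans (+-mono-≤ (m^n>0 2 n) (n≤2^n n)) (≤-reflexive (cong (2 ^ n +_) (sym (+-identityʳ (2 ^ n)))))

-- Sizes are measured by the exponent, in multiples of a fixed unit u.
module Exponents (u : ℕ) (u>0 : 1 ≤ u) where

  record Fits (c a : ℕ) : Set where
    constructor fits
    field
      bound : a ≤ 2 ^ (c * u)

  open Fits public

  weaken : ∀ {c d a} → c ≤ d → Fits c a → Fits d a
  weaken c≤d (fits p) = fits (≤-trans p (^-monoʳ-≤ 2 (*-monoˡ-≤ u c≤d)))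

  below : ∀ {c a b} → a ≤ b → Fits c b → Fits c a
  below a≤b (fits p) = fits (≤-trans a≤b p)

  double : ∀ {c a b} → Fits c a → Fits c b → Fits (suc c) (a + b)
  double {c} (fits p) (fits q) = fits (≤-trans (+-mono-≤ p q) (≤-trans
    (≤-reflexive (cong (2 ^ (c * u) +_) (sym (+-identityʳ (2 ^ (c * u))))))
    (^-monoʳ-≤ 2 (+-monoˡ-≤ (c * u) u>0))))

  add : ∀ {c d a b} → Fits c a → Fits d b → Fits (suc (c + d)) (a + b)
  add {c} {d} p q = double (weaken (m≤m+n c d) p) (weaken (m≤n+m d c) q)

  mul : ∀ {c d a b} → Fits c a → Fits d b → Fits (c + d) (a * b)
  mul {c} {d} (fits p) (fits q) = fits (≤-trans (*-mono-≤ p q) (≤-reflexive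
    (trans (sym (^-distribˡ-+-* 2 (c * u) (d * u))) (cong (2 ^_) (sym (*-distribʳ-+ u c d))))))

  fits-1 : Fits 0 1
  fits-1 = fits ≤-refl

  fits-2 : Fits 1 2
  fits-2 = fits (^-monoʳ-≤ 2 {1} (≤-trans u>0 (≤-reflexive (sym (*-identityˡ u)))))

  fits-suc : ∀ {c a} → Fits c a → Fits (suc c) (suc a)
  fits-suc p = add fits-1 p

  fits-unit : ∀ {a} → a ≤ u → Fits 1 a
  fits-unit p = fits (≤-trans p (≤-trans (n≤2^n u) (≤-reflexive (cong (2 ^_) (sym (*-identityˡ u))))))

  fits-exp : ∀ {a} → a ≤ u → Fits 1 (2 ^ a)
  fits-exp p = fits (^-monoʳ-≤ 2 (≤-trans p (≤-reflexive (sym (*-identityˡ u)))))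

opaque
  -- Each level adds at most 39 units to the exponent, as `le` in `feX` shows; the base states need
  -- 31.
  C : ℕ
  C = 40

  39≤C : 39 ≤ C
  39≤C = ≤ᵇ⇒≤ 39 40 tt

-- `Types.qc` with each parameter replaced by a bound in terms of the size of the formula.
queryBits : ℕ → ℕ
queryBits Z = Z * (V * (V * 1)) + (V * suc Z + Z * (Z + Z * nw))
  where
  nw V : ℕ
  nw = suc Z + Z * Z
  V  = suc nw

module Assemble {σ : Sig} {n : ℕ} (𝔄 : Structure σ n) (adm : Admissible 𝔄) (a₀ : Fin n) (φ : Formula σ)
  (uφ : UNFO φ) (cφ : All (_≡ 0) (fv φ)) where

  open Reduction 𝔄 adm a₀ φ uφ cφ

  module Ty = Types 𝔐 (length χs) code-Bits (length syms) (List.lookup syms)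
    (λ i∈ → Any.index i∈ , sym (lookup-index i∈)) z (λ j → baseSyms-arity φ (∈-lookup j))

  module Ba = BaseStates 𝔐 Ty.tp Ty.tp-refl D ch

  L₀ : ℕ
  L₀ = length us * (suc (suc z) * (suc (suc z) * (suc Ba.M + (suc Ba.M + suc Ba.M)))) + z * 1

  module Co = MakeCover 𝔐 Ty.tp Ty.transfer Ty.tp-lab Ba.auto L₀ ≤-refl

  exponent : ℕ
  exponent = Co.e

  module Bound (Z : ℕ) (z≤Z : z ≤ Z) where

    -- Singly exponential in `Z`, and at least as large as `Q`, so that the number `2 ^ Q` of types
    -- fits into one unit.
    unit : ℕ
    unit = suc (Z + 2 ^ queryBits Z)

    open Exponents unit (s≤s z≤n)

    k≤z : length us ≤ z
    k≤z = distSyms-length φ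

    z≤u : z ≤ unit
    z≤u = ≤-trans z≤Z (≤-trans (m≤m+n Z _) (n≤1+n _))

    nw≤ : Ty.nw ≤ suc Z + Z * Z
    nw≤ = +-mono-≤ (s≤s z≤Z) (*-mono-≤ z≤Z z≤Z)

    qc≤ : Ty.qc ≤ queryBits Z
    qc≤ = +-mono-≤ (*-mono-≤ (≤-trans k≤z z≤Z) (*-mono-≤ (s≤s nw≤) (*-monoˡ-≤ 1 (s≤s nw≤))))
      (+-mono-≤ (*-mono-≤ (s≤s nw≤) (s≤s (≤-trans (negated-length φ) z≤Z)))
        (*-mono-≤ z≤Z (+-mono-≤ (≤-trans (baseSyms-length φ) z≤Z) (*-mono-≤ z≤Z nw≤))))

    Q≤u : Ty.Q ≤ unit
    Q≤u = ≤-trans (^-monoʳ-≤ 2 qc≤) (≤-trans (m≤n+m _ Z) (n≤1+n _))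

    fz : Fits 1 z
    fz = fits-unit z≤u
    fk : Fits 1 (length us)
    fk = below k≤z fz
    fQ : Fits 1 Ty.Q
    fQ = fits-unit Q≤u
    fN : Fits 1 Ba.N
    fN = fits-exp Q≤u
    J≡ : Ba.J₀ ≡ length us * 2
    J≡ = Runs.length-allW 𝔐 Ty.tp
    fJ : Fits 2 Ba.J₀
    fJ = below (≤-reflexive J≡) (mul {1} {1} fk fits-2)
    fM : Fits 7 Ba.M
    fM = add {5} {1} (mul {3} {2} (fits-suc fJ) (fits-suc fN)) fits-2
    fL₀ : Fits 35 L₀
    fL₀ = add {33} {1}
      (mul {1} {32} fk (mul {3} {29} (fits-suc (fits-suc fz)) (mul {3} {26} (fits-suc (fits-suc fz))
        (add {8} {17} (fits-suc fM) (add {8} {8} (fits-suc fM) (fits-suc fM))))))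
      (mul {1} {0} fz fits-1)
    fD : Fits 3 D
    fD = mul {2} {1} (fits-suc (below (negated-length φ) fz)) fz
    fe₀ : Fits 31 Ba.e₀
    fe₀ = add {4} {26} (mul {2} {2} fJ (add {1} {0} fk fits-1))
      (add {9} {16}
        (add {1} {7} fQ (mul {3} {4} (fits-suc fJ) (add {1} {2} fN (add {1} {0} fN fits-1))))
        (add {3} {12} (mul {1} {2} fk (fits-suc fits-2)) (mul {1} {11} fk (mul {1} {10} fits-2 (mul {3} {7} (fits-suc fJ) fM)))))

    -- The history stores `L` places of the level below, so the code length grows by a factor of
    -- about `L`, that is, by a fixed number of units in the exponent.
    feX : ∀ ℓ → Fits (C * suc ℓ) (Ladder.eX 𝔐 Ty.tp Ty.transfer Ba.auto L₀ ℓ)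
    feX zero    = weaken {31} (≤-trans (m≤m+n 31 8) (≤-trans 39≤C (m≤m*n C 1))) fe₀
    feX (suc ℓ) = weaken le (double {suc (36 + suc c)}
        (weaken (≤-trans (m≤m+n 35 2) (s≤s (m≤m+n 36 (suc c)))) fL₀)
        (double {36 + suc c} (mul {36} {suc c} (fits-suc fL₀) (double {c} (feX ℓ) (weaken c≥3 fD)))
          (weaken (≤-trans (n≤1+n c) (m≤n+m (suc c) 36)) (feX ℓ))))
      where
      c = C * suc ℓ
      c≥3 : 3 ≤ c
      c≥3 = ≤-trans (≤-trans (m≤m+n 3 36) 39≤C) (m≤m*n C (suc ℓ))
      le : suc (suc (36 + suc c)) ≤ C * suc (suc ℓ)
      le = ≤-trans (≤-reflexive (cong (λ w → suc (suc w)) (+-suc 36 c)))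
        (≤-trans (+-monoˡ-≤ c 39≤C) (≤-reflexive (sym (*-suc C (suc ℓ)))))

    unit≤ : unit ≤ 2 ^ suc (suc Z + queryBits Z)
    unit≤ = ≤-trans (+-mono-≤ {suc Z}
        (≤-trans (n≤2^n (suc Z)) (^-monoʳ-≤ 2 (m≤m+n (suc Z) (queryBits Z))))
        (^-monoʳ-≤ 2 (m≤n+m (queryBits Z) (suc Z))))
      (≤-reflexive (cong (2 ^ (suc Z + queryBits Z) +_) (sym (+-identityʳ (2 ^ (suc Z + queryBits Z))))))

    exponent≤ : exponent ≤ 2 ^ (2 ^ ((C + (2 + Z * 2)) + suc (suc Z + queryBits Z)))
    exponent≤ = ≤-trans (bound (feX (suc Ba.J₀))) (^-monoʳ-≤ 2 (≤-trans
      (*-mono-≤ (*-mono-≤ (n≤2^n C)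
        (≤-trans (s≤s (s≤s (≤-trans (≤-reflexive J≡) (*-monoˡ-≤ 2 (≤-trans k≤z z≤Z))))) (n≤2^n (2 + Z * 2)))) unit≤)
      (≤-reflexive (trans (cong (_* 2 ^ suc (suc Z + queryBits Z)) (sym (^-distribˡ-+-* 2 C (2 + Z * 2))))
        (sym (^-distribˡ-+-* 2 (C + (2 + Z * 2)) (suc (suc Z + queryBits Z))))))))

  opaque
    sentence-model : (∀ a → sat-value 𝔄 φ a ≡ true) → ∀ Z → z ≤ Z →
      ∃ λ N → FinModelOfSize φ N × N ≤ 2 ^ (2 ^ (2 ^ ((C + (2 + Z * 2)) + suc (suc Z + queryBits Z))))
    sentence-model p Z z≤Z = 2 ^ exponent ,
      (FromCover.𝔅 Co.cover , FromCover.adm-𝔅 Co.cover , (λ _ → Cover.b₀ Co.cover) ,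
        FromCover.model Co.cover p (λ _ → Cover.b₀ Co.cover)) ,
      ^-monoʳ-≤ 2 (Bound.exponent≤ Z z≤Z)

-- Polynomials, and the closing of free variables

_⊕_ _⊗_ : Poly → Poly → Poly
[]      ⊕ q       = q
(c ∷ p) ⊕ []      = c ∷ p
(c ∷ p) ⊕ (d ∷ q) = c + d ∷ p ⊕ q
[]      ⊗ q = []
(c ∷ p) ⊗ q = List.map (c *_) q ⊕ (0 ∷ p ⊗ q)

eval-⊕ : ∀ p q x → evalPoly (p ⊕ q) x ≡ evalPoly p x + evalPoly q x
eval-⊕ []      q       x = refl
eval-⊕ (c ∷ p) []      x = sym (+-identityʳ _)
eval-⊕ (c ∷ p) (d ∷ q) x = trans (cong (λ w → c + d + x * w) (eval-⊕ p q x))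
  (solve 5 (λ c d x p q → c :+ d :+ x :* (p :+ q) := (c :+ x :* p) :+ (d :+ x :* q)) refl c d x (evalPoly p x) (evalPoly q x))
  where open +-*-Solver

eval-scale : ∀ c q x → evalPoly (List.map (c *_) q) x ≡ c * evalPoly q x
eval-scale c []      x = sym (*-zeroʳ c)
eval-scale c (d ∷ q) x = trans (cong (λ w → c * d + x * w) (eval-scale c q x))
  (solve 4 (λ c d x q → c :* d :+ x :* (c :* q) := c :* (d :+ x :* q)) refl c d x (evalPoly q x))
  where open +-*-Solver

eval-⊗ : ∀ p q x → evalPoly (p ⊗ q) x ≡ evalPoly p x * evalPoly q x
eval-⊗ []      q x = refl
eval-⊗ (c ∷ p) q x = trans (eval-⊕ (List.map (c *_) q) (0 ∷ p ⊗ q) x)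
  (trans (cong₂ (λ v w → v + x * w) (eval-scale c q x) (eval-⊗ p q x))
    (solve 4 (λ c x p q → c :* q :+ x :* (p :* q) := (c :+ x :* p) :* q) refl c x (evalPoly p x) (evalPoly q x)))
  where open +-*-Solver

Polynomial : (ℕ → ℕ) → Set
Polynomial f = Σ Poly λ p → ∀ x → evalPoly p x ≡ f x

poly-const : ∀ c → Polynomial (λ _ → c)
poly-const c = c ∷ [] , λ x → trans (cong (c +_) (*-zeroʳ x)) (+-identityʳ c)

poly-id : Polynomial (λ x → x)
poly-id = 0 ∷ 1 ∷ [] , λ x → trans (cong (λ w → x * (1 + w)) (*-zeroʳ x)) (*-identityʳ x)

poly-+ : ∀ {f g} → Polynomial f → Polynomial g → Polynomial (λ x → f x + g x)
poly-+ (p , e) (q , e′) = p ⊕ q , λ x → trans (eval-⊕ p q x) (cong₂ _+_ (e x) (e′ x))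

poly-* : ∀ {f g} → Polynomial f → Polynomial g → Polynomial (λ x → f x * g x)
poly-* (p , e) (q , e′) = p ⊗ q , λ x → trans (eval-⊗ p q x) (cong₂ _*_ (e x) (e′ x))

-- The factor 3 comes from closing the formula: each of at most `size φ` occurrences of free
-- variables costs a quantifier of size 2.
tower : ℕ → ℕ
tower x = (C + (2 + x * 3 * 2)) + suc (suc (x * 3) + queryBits (x * 3))

opaque
  poly-tower : Polynomial tower
  poly-tower = poly-+ (poly-+ (poly-const C) (poly-+ (poly-const 2) (poly-* Z (poly-const 2))))
    (poly-+ (poly-const 1) (poly-+ sZ
      (poly-+ (poly-* Z (poly-* V (poly-* V (poly-const 1)))) (poly-+ (poly-* V sZ) (poly-* Z (poly-+ Z (poly-* Z nw)))))))
    where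
    Z : Polynomial (λ x → x * 3)
    Z = poly-* poly-id (poly-const 3)
    sZ : Polynomial (λ x → suc (x * 3))
    sZ = poly-+ (poly-const 1) Z
    nw : Polynomial (λ x → suc (x * 3) + x * 3 * (x * 3))
    nw = poly-+ sZ (poly-* Z Z)
    V : Polynomial (λ x → suc (suc (x * 3) + x * 3 * (x * 3)))
    V = poly-+ (poly-const 1) nw

theorem20 : ∃ λ (p : Poly) → ∀ (σ : Sig) (φ : Formula σ) → UNFO φ →
    FinitelySatisfiable φ →
    ∃ λ n → FinModelOfSize φ n × n ≤ 2 ^ (2 ^ (2 ^ evalPoly p (size φ)))
theorem20 = proj₁ poly-tower , bounded
  where
  bounded : ∀ (σ : Sig) (φ : Formula σ) → UNFO φ → FinitelySatisfiable φ →
    ∃ λ n → FinModelOfSize φ n × n ≤ 2 ^ (2 ^ (2 ^ evalPoly (proj₁ poly-tower) (size φ)))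
  bounded σ φ uφ (n , 𝔄 , adm , ρ , satφ) = finish
    (Assemble.sentence-model 𝔄 adm (ρ 0) (close (fv φ) φ) (close-UNFO (fv φ) uφ)
      (All.tabulate (λ y∈ → ⊥-elim (nofv y∈)))
      (λ a → trans (sat-fv 𝔄 (close (fv φ) φ) (λ y∈ → ⊥-elim (nofv y∈))) (close-sat 𝔄 (fv φ) φ satφ))
      (size φ * 3) small)
    where
    nofv : ∀ {y} → ¬ (y ∈ fv (close (fv φ) φ))
    nofv y∈ = let p , q = close-fv (fv φ) φ y∈ in q p
    small : size (close (fv φ) φ) ≤ size φ * 3
    small = ≤-trans (≤-reflexive (close-size (fv φ) φ)) (≤-trans (+-monoˡ-≤ (size φ) (*-monoˡ-≤ 2 (fv-length φ)))
      (≤-reflexive (trans (+-comm (size φ * 2) (size φ)) (sym (*-suc (size φ) 2)))))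
    finish : (∃ λ N → FinModelOfSize (close (fv φ) φ) N × N ≤ 2 ^ (2 ^ (2 ^ tower (size φ)))) →
      ∃ λ n → FinModelOfSize φ n × n ≤ 2 ^ (2 ^ (2 ^ evalPoly (proj₁ poly-tower) (size φ)))
    finish (N , (𝔅 , adm-𝔅 , ρ′ , satB) , N≤) =
      let ρ″ , satφ′ = open-sat 𝔅 (fv φ) φ satB in
      N , (𝔅 , adm-𝔅 , ρ″ , satφ′) ,
      ≤-trans N≤ (≤-reflexive (cong (λ w → 2 ^ (2 ^ (2 ^ w))) (sym (proj₂ poly-tower (size φ)))))
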